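{- Let $q$ be a power of a prime $p$ which is a perfect square, and let $\lambda\in\mathbb{F}_q^*$. (1) Let $d\ge 2$ be a divisor of $q-1$, and let $r$ be the remainder of $\frac{q-1}{d}$ upon division by $p\sqrt q$. If $r\le(p-1)\sqrt q$, then $MSD_d(\lambda,\mathbb{F}_q)\le\sqrt q-1$. (2) Let $q\ge 25$ and let $d\ge 3$ be a divisor of $q-1$, and let $r$ be the remainder of $\frac{q-1}{d}$ upon division by $p\sqrt q$. If $r\le(p-1)\sqrt q$, then $MD_d(\lambda,\mathbb{F}_q)\le\sqrt q-1$.
   Context: $S_d=\{x^d:x\in\mathbb{F}_q^*\}$. A set of distinct elements $a_1,\dots,a_m$ of $\mathbb{F}_q^*$ has property $D_d(\lambda,\mathbb{F}_q)$ if $a_ia_j+\lambda\in S_d\cup\{0\}$ whenever $i\ne j$, and property $SD_d(\lambda,\mathbb{F}_q)$ if $a_ia_j+\lambda\in S_d\cup\{0\}$ for all $i,j$ (including $i=j$). $MD_d(\lambda,\mathbb{F}_q)$, $MSD_d(\lambda,\mathbb{F}_q)$ are the maximum sizes of subsets of $\mathbb{F}_q^*$ with these respective properties. -}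

module Defs where

open import Level using (0ℓ)
open import Data.Nat using (ℕ; zero; suc; _≤_)
open import Data.Fin using (Fin)
open import Data.Product using (∃; _×_)
open import Data.Sum using (_⊎_)
open import Relation.Nullary using (¬_)
open import Relation.Binary.PropositionalEquality as ≡ using (_≡_)
open import Function.Bundles using (Bijection)
open import Algebra.Bundles using (CommutativeRing)

record FiniteField (q : ℕ) : Set₁ where
  field
    cring : CommutativeRing 0ℓ 0ℓ
  open CommutativeRing cring public
  field
    1≉0     : ¬ (1# ≈ 0#)
    inverse : ∀ x → ¬ (x ≈ 0#) → ∃ λ y → (x * y) ≈ 1#
    enum    : Bijection setoid (≡.setoid (Fin q))

module _ {q : ℕ} (F : FiniteField q) where
  open FiniteField F

  pow : Carrier → ℕ → Carrier
  pow x zero    = 1#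
  pow x (suc n) = x * pow x n

  InS : ℕ → Carrier → Set
  InS d y = ∃ λ x → ¬ (x ≈ 0#) × (y ≈ pow x d)

  InS₀ : ℕ → Carrier → Set
  InS₀ d y = InS d y ⊎ (y ≈ 0#)

  DistinctNonzero : (m : ℕ) → (Fin m → Carrier) → Set
  DistinctNonzero m a =
    (∀ i → ¬ (a i ≈ 0#)) × (∀ i j → a i ≈ a j → i ≡ j)

  HasD : ℕ → Carrier → (m : ℕ) → (Fin m → Carrier) → Set
  HasD d λ' m a = DistinctNonzero m a ×
    (∀ i j → ¬ (i ≡ j) → InS₀ d ((a i * a j) + λ'))

  HasSD : ℕ → Carrier → (m : ℕ) → (Fin m → Carrier) → Set
  HasSD d λ' m a = DistinctNonzero m a ×
    (∀ i j → InS₀ d ((a i * a j) + λ'))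

  MD≤ : ℕ → Carrier → ℕ → Set
  MD≤ d λ' N = ∀ m (a : Fin m → Carrier) → HasD d λ' m a → m ≤ N

  MSD≤ : ℕ → Carrier → ℕ → Set
  MSD≤ d λ' N = ∀ m (a : Fin m → Carrier) → HasSD d λ' m a → m ≤ N

{-# OPTIONS --safe #-}
module Submission where

-- Stepanov's method.  Let e = (q - 1) / d = τ s + l with 0 < l < s; the bound
-- on r says that τ + 1 is invertible mod p.  If y is 0 or a d-th power then
-- y^(N + e) = y^N for N > 0.  Given s elements aᵢ, choose weights cᵢ with
-- Σ cᵢ aᵢʷ = 0 for 0 < w < s and Σ cᵢ aᵢˢ = 1, and put σ₀ = Σ cᵢ.  Then
--   f(x) = Σ cᵢ (aᵢ - x)ᵏ (aᵢ x + λ)^(N + e) - σ₀ λᴺ (- x)ᵏ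
-- vanishes to high order at every aⱼ, the factor (aᵢ - x)ᵏ making up for the
-- missing hypothesis on aⱼ² + λ, and often at 0 too.  Since (x + y)ˢ = xˢ + yˢ,
-- a suitable coefficient of f is nonzero, and f has too many zeros.  For (1)
-- take k = 0 and N = s - 1.  For (2) take k = τ + 1 if l + 2 τ + 2 ≤ s or
-- τ = l = (s - 1) / 3, and (N , k) = (s - l , l - 1) if l ≥ τ + 3.  Only
-- q = 25, d = 3 remains; there y² is fixed by y ↦ y⁵ for every d-th power y,
-- and the resulting relations between power sums are inconsistent.

open import Defs
open import Level using (0ℓ)
open import Algebra.Bundles using (CommutativeRing)
open import Algebra.Solver.Ring.AlmostCommutativeRing using (fromCommutativeRing; _-Raw-AlmostCommutative⟶_)
open import Data.Empty using (⊥; ⊥-elim)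
open import Data.Fin using (Fin; zero; suc; punchIn; inject≤)
open import Data.Fin.Permutation using (Permutation; permutation)
import Data.Fin.Properties as Finₚ
open import Data.Integer as ℤ using (ℤ; +_; -[1+_]; _⊖_)
import Data.Integer.Properties as ℤₚ
open import Data.List using (List; []; _∷_)
open import Data.Maybe using (Maybe; just; nothing)
open import Data.Nat as ℕ using (ℕ; zero; suc; z≤n; s≤s; _≤_; _<_; _∸_)
open import Data.Nat.Combinatorics using (_C_; nCk+nC[k+1]≡[n+1]C[k+1]; k>n⇒nCk≡0; nC1≡n)
open import Data.Nat.Coprimality using (prime⇒coprime; coprime-Bézout)
open import Data.Nat.Divisibility
  using (_∣_; _∤_; _∣?_; divides; divides-refl; ∣-trans; m∣m*n; n∣m*n; *-monoʳ-∣; *-cancelˡ-∣; ∣m+n∣m⇒∣n; ∣⇒≤; ∣1⇒≡1; 1∣_)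
open import Data.Nat.DivMod using (_/_; _%_; m≡m%n+[m/n]*n; m%n<n)
open import Data.Nat.GCD using (module Bézout)
open import Data.Nat.Primality using (Prime; euclidsLemma; prime⇒nonZero; ¬prime[1])
import Data.Nat.Properties as ℕₚ
open import Data.Nat.Solver using (module +-*-Solver)
open import Data.Product using (∃; _,_; proj₁; proj₂; _×_)
open import Data.Sum using (_⊎_; inj₁; inj₂)
open import Function using (_∘_)
open import Function.Bundles using (Bijection)
open import Relation.Nullary using (¬_; Dec; yes; no)
open import Relation.Nullary.Decidable using (map′)
open import Relation.Binary.PropositionalEquality as ≡ using (_≡_)
import Algebra.Properties.AbelianGroup
import Algebra.Properties.CommutativeMonoid.Sum
import Algebra.Properties.CommutativeSemiring.Exp
import Algebra.Properties.Ring
import Algebra.Properties.Semiring.Mult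
import Algebra.Properties.Semiring.Mult.TCOptimised
import Algebra.Properties.Semiring.Sum
import Algebra.Solver.Ring
import Relation.Binary.Reasoning.Setoid

open +-*-Solver using () renaming (solve to solveℕ; _:+_ to _⊕_; _:*_ to _⊗_; _:=_ to _⊜_; con to #)

-- Arithmetic of the parameters

-- Expanded at `b = a j`, a value `y = a i * b + λ` enters `f` with exponents `N + e - v`, and for
-- `v < N` these may be replaced by `N - v`. The coefficients then have degree at most `N + k` in
-- `a i`. If `N + k < s`, the weights see only the constant term, and the subtracted monomial
-- cancels it. So `f` has order `M` at `a j` provided that every `v < M` satisfies `v < N` or kills
-- the binomial coefficient of `E = N + e`, and that `M ≤ k` where nothing is known on the diagonal.
-- Against these zeros stand `k + N + e + 1` coefficients with `e` between `τ s` and `(τ + 1) s`, so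
-- `M` should be about `τ + 1`. In (2) the demands `M ≤ k`, `M ≤ N` and `N + k < s` compete. For a
-- large remainder `l` the way out is to make `E` a multiple of `s`: its binomial coefficients
-- vanish for `0 < v < s`, and `N` no longer limits `M`.

root-prime-power : ∀ {p} → Prime p → ∀ k s → s ℕ.* s ≡ p ℕ.^ k → ∃ λ h → s ≡ p ℕ.^ h
root-prime-power {p} p-prime zero s eq = 0 , ℕₚ.m*n≡1⇒m≡1 s s eq
root-prime-power {p} p-prime (suc k) s eq with p∣s
  where
  p∣s : p ∣ s
  p∣s with euclidsLemma s s p-prime (≡.subst (p ∣_) (≡.sym eq) (m∣m*n (p ℕ.^ k)))
  ... | inj₁ p∣s = p∣s
  ... | inj₂ p∣s = p∣s
... | divides-refl s₁ = go k cancelled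
  where
  instance _ = prime⇒nonZero p-prime
  cancelled : p ℕ.* (s₁ ℕ.* s₁) ≡ p ℕ.^ k
  cancelled = ℕₚ.*-cancelˡ-≡ _ _ p (≡.trans (solveℕ 2 (λ p s → p ⊗ (p ⊗ (s ⊗ s)) ⊜ s ⊗ p ⊗ (s ⊗ p)) ≡.refl p s₁) eq)
  go : ∀ k → p ℕ.* (s₁ ℕ.* s₁) ≡ p ℕ.^ k → ∃ λ h → s₁ ℕ.* p ≡ p ℕ.^ h
  go zero    eq = ⊥-elim (¬prime[1] (≡.subst Prime (ℕₚ.m*n≡1⇒m≡1 p _ eq) p-prime))
  go (suc k) eq with root-prime-power p-prime k s₁ (ℕₚ.*-cancelˡ-≡ _ _ p eq)
  ... | h , eq′ = suc h , ≡.trans (ℕₚ.*-comm s₁ p) (≡.cong (p ℕ.*_) eq′)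

square-cancel : ∀ {m n} → m ℕ.* m ≤ n ℕ.* n → m ≤ n
square-cancel {m} {n} m²≤n² = ℕₚ.≮⇒≥ (λ n<m → ℕₚ.<-irrefl ≡.refl (ℕₚ.≤-<-trans m²≤n² (ℕₚ.*-mono-< n<m n<m)))

-- Doubling gives `2 s + 2 e ≤ s s + e d`, and `e d < s s`. This is the comparison of degree and
-- zeros for (1), where `f` has `s + e` coefficients.
half-bound : ∀ s d e → 2 ≤ s → 2 ≤ d → e ℕ.* d ℕ.+ 1 ≡ s ℕ.* s → s ℕ.+ e ≤ s ℕ.* s
half-bound s d e 2≤s 2≤d eq = ℕₚ.*-cancelˡ-≤ 2 (ℕₚ.≤-trans
  (ℕₚ.≤-reflexive (solveℕ 2 (λ s e → # 2 ⊗ (s ⊕ e) ⊜ # 2 ⊗ s ⊕ e ⊗ # 2) ≡.refl s e))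
  (ℕₚ.≤-trans (ℕₚ.+-mono-≤ (ℕₚ.*-monoˡ-≤ s 2≤s) (ℕₚ.≤-trans (ℕₚ.*-monoʳ-≤ e 2≤d) (ℕₚ.≤-trans (ℕₚ.m≤m+n _ 1) (ℕₚ.≤-reflexive eq))))
  (ℕₚ.≤-reflexive (≡.cong (s ℕ.* s ℕ.+_) (≡.sym (ℕₚ.+-identityʳ _))))))

-- The alternatives are, in order, the ranges of `small-l`, `third` and `large-l` and the
-- exceptional triple. Here `l` is the full remainder of `e` modulo `s`; inside `Bounds` the same
-- remainder is `suc l`.
ParameterCase : ℕ → ℕ → ℕ → Set
ParameterCase s τ l = l ℕ.+ (suc τ ℕ.+ suc τ) ≤ s ⊎ (2 ≤ τ × l ≡ τ × s ≡ suc (3 ℕ.* τ)) ⊎ 3 ℕ.+ τ ≤ l ⊎ (s ≡ 5 × τ ≡ 1 × l ≡ 3)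

-- Here s = τ d + u + 1 and l d + 1 = (u + 1) s, so that (l - τ) d = u (s + 1).
split-cases : ∀ s d τ l u → 5 ≤ s → 3 ≤ d → 1 ≤ l → τ ℕ.* d ℕ.+ suc u ≡ s → l ℕ.* d ≡ τ ℕ.* d ℕ.+ u ℕ.* suc s → ParameterCase s τ l
split-cases s d@(suc _) τ l zero 5≤s 3≤d 1≤l s≡ ld≡ with ℕₚ.*-cancelʳ-≡ l τ d (≡.trans ld≡ (ℕₚ.+-identityʳ _)) | d ℕ.≟ 3
... | ≡.refl | yes ≡.refl = inj₂ (inj₁ (2≤τ , ≡.refl , s≡3τ+1))
  where
  s≡3τ+1 : s ≡ suc (3 ℕ.* τ)
  s≡3τ+1 = ≡.trans (≡.sym s≡) (solveℕ 1 (λ t → t ⊗ # 3 ⊕ # 1 ⊜ # 1 ⊕ # 3 ⊗ t) ≡.refl τ)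
  2≤τ : 2 ≤ τ
  2≤τ = ℕₚ.≰⇒> (λ τ≤1 → ℕₚ.<⇒≱ 5≤s (≡.subst (_≤ 4) (≡.sym s≡3τ+1) (s≤s (ℕₚ.*-monoʳ-≤ 3 τ≤1))))
-- Now `d ≥ 4` and `τ = l ≥ 1`, so `s ≥ 4 τ + 1 ≥ 3 τ + 2`.
... | ≡.refl | no d≢3 = inj₁ (≡.subst (τ ℕ.+ (suc τ ℕ.+ suc τ) ≤_) s≡ (ℕₚ.≤-trans
  (≡.subst₂ _≤_ (solveℕ 1 (λ t → # 3 ⊗ t ⊕ # 1 ⊕ # 1 ⊜ t ⊕ (# 1 ⊕ t ⊕ (# 1 ⊕ t))) ≡.refl τ)
    (solveℕ 1 (λ t → # 3 ⊗ t ⊕ # 1 ⊕ t ⊜ t ⊗ # 4 ⊕ # 1) ≡.refl τ) (ℕₚ.+-monoʳ-≤ (3 ℕ.* τ ℕ.+ 1) 1≤l))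
  (ℕₚ.+-monoˡ-≤ 1 (ℕₚ.*-monoʳ-≤ τ (ℕₚ.≤∧≢⇒< 3≤d (λ e → d≢3 (≡.sym e)))))))
split-cases s d@(suc d′) τ l (suc u) 5≤s 3≤d 1≤l s≡ ld≡ with ℕₚ.m≤n⇒∃[o]m+o≡n τ<l
  where
  τ<l : τ < l
  τ<l = ℕₚ.*-cancelʳ-< d τ l (≡.subst (τ ℕ.* d <_) (≡.sym ld≡) (ℕₚ.m<m+n (τ ℕ.* d) (s≤s z≤n)))
-- With `l = τ + 1 + x` the relation reads `(x + 1) d = (u + 1) (s + 1)`. For `x = 0`, and for
-- `x = 1` with `u > 0`, it forces `d > s` and hence `τ = 0`; `x ≥ 2` is the case of a large
-- remainder.
... | x , ≡.refl = cases x (ℕₚ.+-cancelˡ-≡ (τ ℕ.* d) _ _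
    (≡.trans (solveℕ 3 (λ t x d → t ⊗ d ⊕ (# 1 ⊕ x) ⊗ d ⊜ (# 1 ⊕ (t ⊕ x)) ⊗ d) ≡.refl τ x d) ld≡)) 1≤l
  where
  τ≡0 : s < d → ∀ τ → τ ℕ.* d ℕ.+ suc (suc u) ≡ s → τ ≡ 0
  τ≡0 s<d zero    _  = ≡.refl
  τ≡0 s<d (suc τ) s≡ = ⊥-elim (ℕₚ.<⇒≱ s<d (≡.subst (d ≤_) s≡ (ℕₚ.≤-trans (ℕₚ.m≤m+n d (τ ℕ.* d)) (ℕₚ.m≤m+n _ _))))
  twice : ∀ τ u → τ ℕ.* d ℕ.+ suc (suc u) ≡ s → 2 ℕ.* d ≡ suc u ℕ.* suc s → ParameterCase s τ (suc τ ℕ.+ 1)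
  twice zero _ _ _ = inj₁ (ℕₚ.≤-trans (s≤s (s≤s (s≤s (s≤s z≤n)))) 5≤s)
  twice (suc τ) (suc u) s≡ 2d≡ = ⊥-elim (ℕₚ.<⇒≱ s<d (≡.subst (d ≤_) s≡ (ℕₚ.≤-trans (ℕₚ.m≤m+n d (τ ℕ.* d)) (ℕₚ.m≤m+n _ _))))
    where
    s<d : s < d
    s<d = ℕₚ.*-cancelˡ-≤ 2 (≡.subst (2 ℕ.* suc s ≤_) (≡.sym 2d≡) (ℕₚ.*-monoˡ-≤ (suc s) (s≤s (s≤s (z≤n {u})))))
  twice (suc (suc τ)) zero s≡ 2d≡ = ⊥-elim (ℕₚ.<-irrefl (≡.trans 2d≡ (ℕₚ.+-identityʳ (suc s)))
    (s≤s (≡.subst (2 ℕ.* d ≤_) s≡ (ℕₚ.≤-trans (ℕₚ.*-monoˡ-≤ d (s≤s (s≤s (z≤n {τ})))) (ℕₚ.m≤m+n _ _)))))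
  -- The only survivor: `2 d = s + 1` together with `s = d + 2`.
  twice (suc zero) zero s≡ 2d≡ = inj₂ (inj₂ (inj₂ (≡.trans (≡.sym s≡) (≡.cong (λ d → 1 ℕ.* d ℕ.+ 2) d≡3) , ≡.refl , ≡.refl)))
    where
    d≡3 : d ≡ 3
    d≡3 = ℕₚ.+-cancelˡ-≡ d d 3 (≡.trans (solveℕ 1 (λ d → d ⊕ d ⊜ # 2 ⊗ d) ≡.refl d) (≡.trans 2d≡
      (≡.trans (≡.cong (λ s → 1 ℕ.* suc s) (≡.sym s≡)) (solveℕ 1 (λ d → # 1 ⊗ (# 1 ⊕ (# 1 ⊗ d ⊕ # 2)) ⊜ d ⊕ # 3) ≡.refl d))))
  cases : ∀ x → suc x ℕ.* d ≡ suc u ℕ.* suc s → 1 ≤ suc τ ℕ.+ x → ParameterCase s τ (suc τ ℕ.+ x)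
  cases 0 d≡ _ with τ≡0 (≡.subst (s <_) (≡.trans (≡.sym d≡) (ℕₚ.+-identityʳ d)) (ℕₚ.m≤m+n (suc s) (u ℕ.* suc s))) τ s≡
  ... | ≡.refl = inj₁ (ℕₚ.≤-trans (s≤s (s≤s (s≤s z≤n))) 5≤s)
  cases 1 2d≡ _ = twice τ u s≡ 2d≡
  cases (suc (suc x)) _ _ = inj₂ (inj₂ (inj₁ (≡.subst (3 ℕ.+ τ ≤_) (≡.cong suc (solveℕ 2 (λ t x → # 2 ⊕ t ⊕ x ⊜ t ⊕ (# 2 ⊕ x)) ≡.refl τ x)) (ℕₚ.m≤m+n (3 ℕ.+ τ) x))))

parameter-cases : ∀ s d τ l → 5 ≤ s → 3 ≤ d → 1 ≤ l → (τ ℕ.* s ℕ.+ l) ℕ.* d ℕ.+ 1 ≡ s ℕ.* s → ParameterCase s τ l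
parameter-cases s@(suc s′) d τ l 5≤s 3≤d 1≤l eq with ℕₚ.m≤n⇒∃[o]m+o≡n τd<s
  where
  τd<s : τ ℕ.* d < s
  τd<s = ℕₚ.*-cancelʳ-< s (τ ℕ.* d) s (≡.subst (τ ℕ.* d ℕ.* s <_)
    (≡.trans (solveℕ 4 (λ t s l d → t ⊗ d ⊗ s ⊕ (l ⊗ d ⊕ # 1) ⊜ (t ⊗ s ⊕ l) ⊗ d ⊕ # 1) ≡.refl τ s l d) eq)
    (ℕₚ.m<m+n _ (≡.subst (1 ≤_) (ℕₚ.+-comm 1 (l ℕ.* d)) (s≤s z≤n))))
... | u , s≡ = split-cases s d τ l u 5≤s 3≤d 1≤l (≡.trans (ℕₚ.+-suc (τ ℕ.* d) u) s≡)
    (ℕₚ.+-cancelʳ-≡ 1 _ _ (ℕₚ.+-cancelˡ-≡ (τ ℕ.* d ℕ.* s) _ _ (begin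
      τ ℕ.* d ℕ.* s ℕ.+ (l ℕ.* d ℕ.+ 1)  ≡⟨ solveℕ 4 (λ t s l d → t ⊗ d ⊗ s ⊕ (l ⊗ d ⊕ # 1) ⊜ (t ⊗ s ⊕ l) ⊗ d ⊕ # 1) ≡.refl τ s l d ⟩
      (τ ℕ.* s ℕ.+ l) ℕ.* d ℕ.+ 1        ≡⟨ eq ⟩
      s ℕ.* s                            ≡⟨ ≡.cong (ℕ._* s) s≡ ⟨
      suc (τ ℕ.* d ℕ.+ u) ℕ.* s          ≡⟨ solveℕ 3 (λ x u s → (# 1 ⊕ (x ⊕ u)) ⊗ s ⊜ x ⊗ s ⊕ (u ⊗ s ⊕ s)) ≡.refl (τ ℕ.* d) u s ⟩
      τ ℕ.* d ℕ.* s ℕ.+ (u ℕ.* s ℕ.+ s)  ≡⟨ ≡.cong (λ x → τ ℕ.* d ℕ.* s ℕ.+ (u ℕ.* s ℕ.+ x)) s≡ ⟨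
      τ ℕ.* d ℕ.* s ℕ.+ (u ℕ.* s ℕ.+ suc (τ ℕ.* d ℕ.+ u))
        ≡⟨ ≡.cong (τ ℕ.* d ℕ.* s ℕ.+_) (solveℕ 3 (λ x u s → u ⊗ s ⊕ (# 1 ⊕ (x ⊕ u)) ⊜ x ⊕ u ⊗ (# 1 ⊕ s) ⊕ # 1) ≡.refl (τ ℕ.* d) u s) ⟩
      τ ℕ.* d ℕ.* s ℕ.+ (τ ℕ.* d ℕ.+ u ℕ.* suc s ℕ.+ 1) ∎)))
  where open ≡.≡-Reasoning

-- Binomial coefficients of a prime power

absorption : ∀ n k → suc k ℕ.* (suc n C suc k) ≡ suc n ℕ.* (n C k)
absorption zero    zero    = ≡.refl
absorption zero    (suc k) = ≡.trans (≡.cong (suc (suc k) ℕ.*_) (k>n⇒nCk≡0 (s≤s (s≤s (z≤n {k})))))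
  (≡.trans (ℕₚ.*-zeroʳ k) (≡.sym (≡.trans (ℕₚ.*-identityˡ _) (k>n⇒nCk≡0 (s≤s (z≤n {k}))))))
absorption (suc n) zero    = ≡.trans (ℕₚ.*-identityˡ _) (≡.trans (nC1≡n (suc (suc n))) (≡.sym (ℕₚ.*-identityʳ (suc (suc n)))))
absorption (suc n) (suc k) = begin
  suc (suc k) ℕ.* (suc (suc n) C suc (suc k))                ≡⟨ ≡.cong (suc (suc k) ℕ.*_) (nCk+nC[k+1]≡[n+1]C[k+1] (suc n) (suc k)) ⟨
  suc (suc k) ℕ.* (x ℕ.+ (suc n C suc (suc k)))              ≡⟨ ℕₚ.*-distribˡ-+ (suc (suc k)) x _ ⟩
  x ℕ.+ suc k ℕ.* x ℕ.+ suc (suc k) ℕ.* (suc n C suc (suc k))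
    ≡⟨ ≡.cong₂ (λ u v → x ℕ.+ u ℕ.+ v) (absorption n k) (absorption n (suc k)) ⟩
  x ℕ.+ suc n ℕ.* (n C k) ℕ.+ suc n ℕ.* (n C suc k)          ≡⟨ ℕₚ.+-assoc x _ _ ⟩
  x ℕ.+ (suc n ℕ.* (n C k) ℕ.+ suc n ℕ.* (n C suc k))        ≡⟨ ≡.cong (x ℕ.+_) (ℕₚ.*-distribˡ-+ (suc n) (n C k) _) ⟨
  x ℕ.+ suc n ℕ.* ((n C k) ℕ.+ (n C suc k))                  ≡⟨ ≡.cong (λ u → x ℕ.+ suc n ℕ.* u) (nCk+nC[k+1]≡[n+1]C[k+1] n k) ⟩
  suc (suc n) ℕ.* x                                          ∎
  where
  open ≡.≡-Reasoning
  x : ℕ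
  x = suc n C suc k

-- Since `p` is prime and misses `c`, the factors `p` can be moved into `m` one at a time.
p^h∣mc⇒p^h∣m : ∀ {p c} → Prime p → p ∤ c → ∀ h m → p ℕ.^ h ∣ m ℕ.* c → p ℕ.^ h ∣ m
p^h∣mc⇒p^h∣m p-prime p∤c zero    m _ = 1∣ m
p^h∣mc⇒p^h∣m {p} {c} p-prime p∤c (suc h) m div with euclidsLemma m c p-prime (∣-trans (m∣m*n (p ℕ.^ h)) div)
... | inj₂ p∣c = ⊥-elim (p∤c p∣c)
... | inj₁ (divides-refl m′) = ≡.subst (p ℕ.^ suc h ∣_) (ℕₚ.*-comm p m′) (*-monoʳ-∣ p
    (p^h∣mc⇒p^h∣m p-prime p∤c h m′ (*-cancelˡ-∣ p {{prime⇒nonZero p-prime}} (≡.subst (p ℕ.^ suc h ∣_) eq div))))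
  where
  eq : m′ ℕ.* p ℕ.* c ≡ p ℕ.* (m′ ℕ.* c)
  eq = ≡.trans (≡.cong (ℕ._* c) (ℕₚ.*-comm m′ p)) (ℕₚ.*-assoc p m′ c)

-- By `absorption`, `p ^ h` divides `v` times the binomial coefficient. Were that coefficient prime
-- to `p`, then `p ^ h` would divide the smaller positive number `v`.
p∣p^hCv : ∀ {p} → Prime p → ∀ h v → 0 < v → v < p ℕ.^ h → p ∣ (p ℕ.^ h) C v
p∣p^hCv {p} p-prime h (suc v) _ v<s with p ∣? ((p ℕ.^ h) C suc v)
... | yes p∣c = p∣c
... | no p∤c  = ⊥-elim (ℕₚ.<⇒≱ v<s (∣⇒≤ (p^h∣mc⇒p^h∣m p-prime p∤c h (suc v) (s∣ (p ℕ.^ h) v<s))))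
  where
  s∣ : ∀ s → suc v < s → s ∣ suc v ℕ.* (s C suc v)
  s∣ (suc s) _ = ≡.subst (suc s ∣_) (≡.sym (absorption s v)) (m∣m*n (s C v))

-- Finite fields

-- Arithmetic in an abstract carrier does not compute, so the solver normalises with coefficients in
-- ℤ. This makes signs cancel and lets numerals such as 5 be used in identities.
module IntegerSolver (R : CommutativeRing 0ℓ 0ℓ) where
  open CommutativeRing R
  open Algebra.Properties.Ring ring
  open Algebra.Properties.AbelianGroup +-abelianGroup using (⁻¹-∙-comm)
  open Algebra.Properties.Semiring.Mult.TCOptimised semiring renaming (_×_ to _·_)
  open Relation.Binary.Reasoning.Setoid setoid

  ⟦_⟧ℤ : ℤ → Carrier
  ⟦ ℤ.+ n ⟧ℤ     = n · 1#
  ⟦ -[1+ n ] ⟧ℤ = - (suc n · 1#)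

  ⊖-homo : ∀ m n → ⟦ m ⊖ n ⟧ℤ ≈ m · 1# + - (n · 1#)
  ⊖-homo m zero = sym (trans (+-congˡ -0#≈0#) (+-identityʳ _))
  ⊖-homo zero (suc n) = sym (+-identityˡ _)
  ⊖-homo (suc m) (suc n) = begin
    ⟦ suc m ⊖ suc n ⟧ℤ                 ≡⟨ ≡.cong ⟦_⟧ℤ (ℤₚ.[1+m]⊖[1+n]≡m⊖n m n) ⟩
    ⟦ m ⊖ n ⟧ℤ                         ≈⟨ ⊖-homo m n ⟩
    m · 1# + - (n · 1#)                ≈⟨ +-congʳ (+-identityʳ _) ⟨
    m · 1# + 0# + - (n · 1#)           ≈⟨ +-congʳ (+-congˡ (-‿inverseʳ 1#)) ⟨
    m · 1# + (1# + - 1#) + - (n · 1#)  ≈⟨ +-congʳ (+-assoc _ _ _) ⟨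
    m · 1# + 1# + - 1# + - (n · 1#)    ≈⟨ +-assoc _ _ _ ⟩
    m · 1# + 1# + (- 1# + - (n · 1#))  ≈⟨ +-cong (trans (+-comm _ _) (sym (1+× m 1#))) (⁻¹-∙-comm _ _) ⟩
    suc m · 1# + - (1# + n · 1#)       ≈⟨ +-congˡ (-‿cong (1+× n 1#)) ⟨
    suc m · 1# + - (suc n · 1#)        ∎

  neg-homo : ∀ i → ⟦ ℤ.- i ⟧ℤ ≈ - ⟦ i ⟧ℤ
  neg-homo (ℤ.+ zero)    = sym -0#≈0#
  neg-homo (ℤ.+ suc n)   = refl
  neg-homo -[1+ n ]    = sym (-‿involutive _)

  add-homo : ∀ i j → ⟦ i ℤ.+ j ⟧ℤ ≈ ⟦ i ⟧ℤ + ⟦ j ⟧ℤ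
  add-homo (ℤ.+ m)    (ℤ.+ n)    = ×-homo-+ 1# m n
  add-homo (ℤ.+ m)    -[1+ n ] = ⊖-homo m (suc n)
  add-homo -[1+ m ] (ℤ.+ n)    = trans (⊖-homo n (suc m)) (+-comm _ _)
  add-homo -[1+ m ] -[1+ n ] = begin
    - (suc (suc (m ℕ.+ n)) · 1#)       ≈⟨ -‿cong (1+× (suc (m ℕ.+ n)) 1#) ⟩
    - (1# + suc (m ℕ.+ n) · 1#)        ≈⟨ -‿cong (+-congˡ (×-homo-+ 1# (suc m) n)) ⟩
    - (1# + (suc m · 1# + n · 1#))     ≈⟨ -‿cong (trans (sym (+-assoc _ _ _)) (trans (+-congʳ (+-comm _ _)) (+-assoc _ _ _))) ⟩
    - (suc m · 1# + (1# + n · 1#))     ≈⟨ -‿cong (+-congˡ (1+× n 1#)) ⟨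
    - (suc m · 1# + suc n · 1#)        ≈⟨ ⁻¹-∙-comm _ _ ⟨
    - (suc m · 1#) + - (suc n · 1#)    ∎

  mul-homo⁺ : ∀ m j → ⟦ ℤ.+ m ℤ.* j ⟧ℤ ≈ ⟦ ℤ.+ m ⟧ℤ * ⟦ j ⟧ℤ
  mul-homo⁺ m (ℤ.+ n) = trans (reflexive (≡.cong ⟦_⟧ℤ (≡.sym (ℤₚ.pos-* m n)))) (×1-homo-* m n)
  mul-homo⁺ m -[1+ n ] = begin
    ⟦ ℤ.+ m ℤ.* -[1+ n ] ⟧ℤ         ≡⟨ ≡.cong ⟦_⟧ℤ (ℤₚ.neg-distribʳ-* (ℤ.+ m) (ℤ.+ suc n)) ⟨
    ⟦ ℤ.- (ℤ.+ m ℤ.* ℤ.+ suc n) ⟧ℤ  ≈⟨ neg-homo (ℤ.+ m ℤ.* ℤ.+ suc n) ⟩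
    - ⟦ ℤ.+ m ℤ.* ℤ.+ suc n ⟧ℤ      ≈⟨ -‿cong (mul-homo⁺ m (ℤ.+ suc n)) ⟩
    - (m · 1# * (suc n · 1#))       ≈⟨ -‿distribʳ-* _ _ ⟩
    m · 1# * - (suc n · 1#)         ∎

  mul-homo : ∀ i j → ⟦ i ℤ.* j ⟧ℤ ≈ ⟦ i ⟧ℤ * ⟦ j ⟧ℤ
  mul-homo (ℤ.+ m)  j = mul-homo⁺ m j
  mul-homo -[1+ m ] j = begin
    ⟦ -[1+ m ] ℤ.* j ⟧ℤ             ≡⟨ ≡.cong ⟦_⟧ℤ (ℤₚ.neg-distribˡ-* (ℤ.+ suc m) j) ⟨
    ⟦ ℤ.- (ℤ.+ suc m ℤ.* j) ⟧ℤ      ≈⟨ neg-homo (ℤ.+ suc m ℤ.* j) ⟩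
    - ⟦ ℤ.+ suc m ℤ.* j ⟧ℤ          ≈⟨ -‿cong (mul-homo⁺ (suc m) j) ⟩
    - (suc m · 1# * ⟦ j ⟧ℤ)         ≈⟨ -‿distribˡ-* _ _ ⟩
    - (suc m · 1#) * ⟦ j ⟧ℤ         ∎

  morphism : ℤ.+-*-rawRing -Raw-AlmostCommutative⟶ fromCommutativeRing R
  morphism = record
    { ⟦_⟧    = ⟦_⟧ℤ
    ; +-homo = add-homo
    ; *-homo = mul-homo
    ; -‿homo = neg-homo
    ; 0-homo = refl
    ; 1-homo = refl
    }

  coeff≟ : ∀ i j → Maybe (⟦ i ⟧ℤ ≈ ⟦ j ⟧ℤ)
  coeff≟ i j with i ℤ.≟ j
  ... | yes ≡.refl = just refl
  ... | no _       = nothing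

  open Algebra.Solver.Ring ℤ.+-*-rawRing (fromCommutativeRing R) morphism coeff≟ public
    using (solve; _:=_; _:+_; _:*_; _:^_; _:-_; :-_; con)

module Field {q : ℕ} (F : FiniteField q) where
  open FiniteField F hiding (zero)
  open Algebra.Properties.Ring ring public using (x∙y⁻¹≈ε⇒x≈y; x≈y⇒x∙y⁻¹≈ε; +-cancelˡ)
  open Algebra.Properties.Semiring.Mult semiring using (×-homo-+; ×1-homo-*) renaming (_×_ to _·_)
  open Algebra.Properties.CommutativeSemiring.Exp commutativeSemiring public
  open Algebra.Properties.Semiring.Sum semiring public
    using (sum; sum-cong-≋; ∑-distrib-+; *-distribˡ-sum; sum-permute; sum-replicate; sum-replicate-zero)
  private module Prod = Algebra.Properties.CommutativeMonoid.Sum *-commutativeMonoid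
  open IntegerSolver cring public
  open Relation.Binary.Reasoning.Setoid setoid

  ι : ℕ → Carrier
  ι n = n · 1#

  ι-+ : ∀ m n → ι (m ℕ.+ n) ≈ ι m + ι n
  ι-+ = ×-homo-+ 1#

  ι-* : ∀ m n → ι (m ℕ.* n) ≈ ι m * ι n
  ι-* = ×1-homo-*

  ι-1 : ι 1 ≈ 1#
  ι-1 = +-identityʳ 1#

  toFin : Carrier → Fin q
  toFin = Bijection.to enum

  fromFin : Fin q → Carrier
  fromFin i = proj₁ (Bijection.surjective enum i)

  toFin-fromFin : ∀ i → toFin (fromFin i) ≡ i
  toFin-fromFin i = proj₂ (Bijection.surjective enum i) refl

  fromFin-toFin : ∀ x → fromFin (toFin x) ≈ x
  fromFin-toFin x = Bijection.injective enum (toFin-fromFin (toFin x))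

  infix 4 _≟_
  _≟_ : ∀ x y → Dec (x ≈ y)
  x ≟ y = map′ (Bijection.injective enum) (Bijection.cong enum) (toFin x Finₚ.≟ toFin y)

  -‿≈0 : ∀ {x y} → x - y ≈ 0# → x ≈ y
  -‿≈0 {x} {y} = x∙y⁻¹≈ε⇒x≈y x y

  ≈⇒-‿≈0 : ∀ {x y} → x ≈ y → x - y ≈ 0#
  ≈⇒-‿≈0 = x≈y⇒x∙y⁻¹≈ε

  *-cancelˡ : ∀ {x y z} → ¬ x ≈ 0# → x * y ≈ x * z → y ≈ z
  *-cancelˡ {x} {y} {z} x≉0 xy≈xz with inverse x x≉0
  ... | x⁻¹ , xx⁻¹≈1 = begin
    y              ≈⟨ *-identityˡ y ⟨
    1# * y         ≈⟨ *-congʳ xx⁻¹≈1 ⟨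
    x * x⁻¹ * y    ≈⟨ solve 3 (λ a b c → a :* b :* c := b :* (a :* c)) refl x x⁻¹ y ⟩
    x⁻¹ * (x * y)  ≈⟨ *-congˡ xy≈xz ⟩
    x⁻¹ * (x * z)  ≈⟨ solve 3 (λ a b c → b :* (a :* c) := a :* b :* c) refl x x⁻¹ z ⟩
    x * x⁻¹ * z    ≈⟨ *-congʳ xx⁻¹≈1 ⟩
    1# * z         ≈⟨ *-identityˡ z ⟩
    z              ∎

  noZeroDivisor : ∀ {x y} → x * y ≈ 0# → ¬ x ≈ 0# → y ≈ 0#
  noZeroDivisor {x} xy≈0 x≉0 = *-cancelˡ x≉0 (trans xy≈0 (sym (zeroʳ x)))

  *-≉0 : ∀ {x y} → ¬ x ≈ 0# → ¬ y ≈ 0# → ¬ x * y ≈ 0#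
  *-≉0 x≉0 y≉0 xy≈0 = y≉0 (noZeroDivisor xy≈0 x≉0)

  ^-≉0 : ∀ {x} n → ¬ x ≈ 0# → ¬ x ^ n ≈ 0#
  ^-≉0 zero    x≉0 = 1≉0
  ^-≉0 (suc n) x≉0 = *-≉0 x≉0 (^-≉0 n x≉0)

  x^n≈0⇒x≈0 : ∀ {x} n → x ^ n ≈ 0# → x ≈ 0#
  x^n≈0⇒x≈0 {x} n xⁿ≈0 with x ≟ 0#
  ... | yes x≈0 = x≈0
  ... | no x≉0  = ⊥-elim (^-≉0 n x≉0 xⁿ≈0)

  0^n≈0 : ∀ {x} n → x ≈ 0# → x ^ suc n ≈ 0#
  0^n≈0 n x≈0 = trans (*-congʳ x≈0) (zeroˡ _)

  1^n≈1 : ∀ n → 1# ^ n ≈ 1#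
  1^n≈1 zero    = refl
  1^n≈1 (suc n) = trans (*-identityˡ _) (1^n≈1 n)

  -- Transports a bijection of the carrier to `Fin q`, so that sums and products over the whole
  -- field can be reindexed by `sum-permute`.
  relabel : (g h : Carrier → Carrier) → (∀ {x y} → x ≈ y → g x ≈ g y) → (∀ {x y} → x ≈ y → h x ≈ h y) →
    (∀ x → g (h x) ≈ x) → (∀ x → h (g x) ≈ x) → Permutation q q
  relabel g h g-cong h-cong gh hg = permutation (conj g) (conj h) (inv g-cong gh) (inv h-cong hg)
    where
    conj : (Carrier → Carrier) → Fin q → Fin q
    conj u i = toFin (u (fromFin i))
    inv : ∀ {u v} → (∀ {x y} → x ≈ y → u x ≈ u y) → (∀ x → u (v x) ≈ x) → ∀ i → conj u (conj v i) ≡ i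
    inv u-cong uv i = ≡.trans
      (Bijection.cong enum (trans (u-cong (fromFin-toFin _)) (uv _)))
      (toFin-fromFin i)

  -- Translation by `1#` permutes the field and adds `ι q` to the sum of all its elements.
  ιq≈0 : ι q ≈ 0#
  ιq≈0 = +-cancelˡ _ _ _ (begin
    sum fromFin + ι q                        ≈⟨ +-congˡ (sum-replicate q) ⟨
    sum fromFin + sum {q} (λ _ → 1#)         ≈⟨ ∑-distrib-+ fromFin (λ _ → 1#) ⟨
    sum (λ i → fromFin i + 1#)               ≈⟨ sum-cong-≋ {q} (λ i → fromFin-toFin _) ⟨
    sum (λ i → fromFin (toFin (fromFin i + 1#))) ≈⟨ sum-permute fromFin shift ⟨
    sum fromFin                              ≈⟨ +-identityʳ _ ⟨
    sum fromFin + 0#                         ∎)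
    where
    shift : Permutation q q
    shift = relabel (_+ 1#) (_- 1#) +-congʳ +-congʳ
      (solve 1 (λ x → x :- con (+ 1) :+ con (+ 1) := x) refl)
      (solve 1 (λ x → x :+ con (+ 1) :- con (+ 1) := x) refl)

  product-≉0 : ∀ {n} (t : Fin n → Carrier) → (∀ i → ¬ t i ≈ 0#) → ¬ Prod.sum t ≈ 0#
  product-≉0 {zero}  t t≉0 = 1≉0
  product-≉0 {suc n} t t≉0 = *-≉0 (t≉0 zero) (product-≉0 (t ∘ suc) (t≉0 ∘ suc))

  product-const-except : ∀ {n} (t : Fin n → Carrier) (z : Fin n) {a} → t z ≈ 1# →
    (∀ i → ¬ i ≡ z → t i ≈ a) → Prod.sum t ≈ a ^ (n ℕ.∸ 1)
  product-const-except {suc n} t z {a} tz≈1 t≈a = begin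
    Prod.sum t                            ≈⟨ Prod.sum-remove t ⟩
    t z * Prod.sum (λ i → t (punchIn z i))  ≈⟨ *-cong tz≈1 (Prod.sum-cong-≋ {n} (λ i → t≈a _ (Finₚ.punchInᵢ≢i z i))) ⟩
    1# * Prod.sum {n} (λ _ → a)           ≈⟨ *-identityˡ _ ⟩
    Prod.sum {n} (λ _ → a)                ≈⟨ Prod.sum-replicate n ⟩
    a ^ n                                 ∎

  -- Multiplication by `a` permutes the field. Since 0 would spoil the product of all elements, `φ`
  -- replaces it by 1; the ratio of `φ (a * x)` to `φ x` is then `ψ′ x`, which is 1 at 0 and `a` at
  -- the other `q - 1` elements.
  fermat : ∀ {a} → ¬ a ≈ 0# → a ^ (q ℕ.∸ 1) ≈ 1#
  fermat {a} a≉0 = trans (sym (product-const-except ψ (toFin 0#) ψ-zero ψ-nonzero))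
    (*-cancelˡ (product-≉0 (φ ∘ fromFin) (φ≉0 ∘ fromFin)) (begin
      Prod.sum (φ ∘ fromFin) * Prod.sum ψ                   ≈⟨ Prod.∑-distrib-+ (φ ∘ fromFin) ψ ⟨
      Prod.sum (λ i → φ (fromFin i) * ψ i)                  ≈⟨ Prod.sum-cong-≋ scaled ⟨
      Prod.sum (λ i → φ (fromFin (toFin (a * fromFin i))))  ≈⟨ Prod.sum-permute (φ ∘ fromFin) scale ⟨
      Prod.sum (φ ∘ fromFin)                                ≈⟨ *-identityʳ _ ⟨
      Prod.sum (φ ∘ fromFin) * 1#                           ∎))
    where
    a⁻¹ : Carrier
    a⁻¹ = proj₁ (inverse a a≉0)
    φ : Carrier → Carrier
    φ x with x ≟ 0#
    ... | yes _ = 1#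
    ... | no _  = x
    φ≉0 : ∀ x → ¬ φ x ≈ 0#
    φ≉0 x with x ≟ 0#
    ... | yes _  = 1≉0
    ... | no x≉0 = x≉0
    φ-cong : ∀ {x y} → x ≈ y → φ x ≈ φ y
    φ-cong {x} {y} x≈y with x ≟ 0# | y ≟ 0#
    ... | yes _   | yes _   = refl
    ... | no _    | no _    = x≈y
    ... | yes x≈0 | no y≉0  = ⊥-elim (y≉0 (trans (sym x≈y) x≈0))
    ... | no x≉0  | yes y≈0 = ⊥-elim (x≉0 (trans x≈y y≈0))
    ψ′ : Carrier → Carrier
    ψ′ x with x ≟ 0#
    ... | yes _ = 1#
    ... | no _  = a
    ψ : Fin q → Carrier
    ψ i = ψ′ (fromFin i)
    ψ-zero : ψ (toFin 0#) ≈ 1#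
    ψ-zero with fromFin (toFin 0#) ≟ 0#
    ... | yes _ = refl
    ... | no ≉0 = ⊥-elim (≉0 (fromFin-toFin 0#))
    ψ-nonzero : ∀ i → ¬ i ≡ toFin 0# → ψ i ≈ a
    ψ-nonzero i i≢0 with fromFin i ≟ 0#
    ... | yes ≈0 = ⊥-elim (i≢0 (≡.trans (≡.sym (toFin-fromFin i)) (Bijection.cong enum ≈0)))
    ... | no _   = refl
    φ-scale : ∀ x → φ (a * x) ≈ φ x * ψ′ x
    φ-scale x with x ≟ 0# | a * x ≟ 0#
    ... | yes _   | yes _    = sym (*-identityˡ _)
    ... | no _    | no _     = *-comm _ _
    ... | yes x≈0 | no ax≉0  = ⊥-elim (ax≉0 (trans (*-congˡ x≈0) (zeroʳ a)))
    ... | no x≉0  | yes ax≈0 = ⊥-elim (*-≉0 a≉0 x≉0 ax≈0)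
    scaled : ∀ i → φ (fromFin (toFin (a * fromFin i))) ≈ φ (fromFin i) * ψ i
    scaled i = trans (φ-cong (fromFin-toFin _)) (φ-scale (fromFin i))
    scale : Permutation q q
    scale = relabel (a *_) (a⁻¹ *_) *-congˡ *-congˡ
      (λ x → trans (sym (*-assoc _ _ _)) (trans (*-congʳ (proj₂ (inverse a a≉0))) (*-identityˡ x)))
      (λ x → trans (sym (*-assoc _ _ _)) (trans (*-congʳ (trans (*-comm _ _) (proj₂ (inverse a a≉0)))) (*-identityˡ x)))

  ι-^ : ∀ p k → ι (p ℕ.^ k) ≈ ι p ^ k
  ι-^ p zero    = ι-1
  ι-^ p (suc k) = trans (ι-* p (p ℕ.^ k)) (*-congˡ (ι-^ p k))

  bézout : ∀ u m v n → 1 ℕ.+ u ℕ.* m ≡ v ℕ.* n → ι m ≈ 0# → ι n ≈ 0# → 1# ≈ 0#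
  bézout u m v n eq ιm≈0 ιn≈0 = begin
    1#                     ≈⟨ +-identityʳ 1# ⟨
    1# + 0#                ≈⟨ +-congˡ (trans (ι-* u m) (trans (*-congˡ ιm≈0) (zeroʳ _))) ⟨
    ι (1 ℕ.+ u ℕ.* m)      ≡⟨ ≡.cong ι eq ⟩
    ι (v ℕ.* n)            ≈⟨ ι-* v n ⟩
    ι v * ι n              ≈⟨ *-congˡ ιn≈0 ⟩
    ι v * 0#               ≈⟨ zeroʳ _ ⟩
    0#                     ∎

  ι-unit : ∀ {p c} → Prime p → ι p ≈ 0# → 0 ℕ.< c → c ℕ.< p → ¬ ι c ≈ 0#
  ι-unit {p} {suc c} p-prime ιp≈0 _ c<p ιc≈0 with coprime-Bézout (prime⇒coprime p-prime c<p)
  ... | Bézout.+- x y eq = 1≉0 (bézout y (suc c) x p eq ιc≈0 ιp≈0)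
  ... | Bézout.-+ x y eq = 1≉0 (bézout x p y (suc c) eq ιp≈0 ιc≈0)

-- Polynomials as coefficient sequences: multiplicities and Taylor expansion

module Sequences {q : ℕ} (F : FiniteField q) where
  open FiniteField F hiding (zero)
  open Field F
  open Relation.Binary.Reasoning.Setoid setoid

  Seq : Set
  Seq = ℕ → Carrier

  infix 4 _≋_
  _≋_ : Seq → Seq → Set
  f ≋ g = ∀ n → f n ≈ g n

  Below : ℕ → Seq → Set
  Below n f = ∀ i → n ≤ i → f i ≈ 0#

  δ : Seq
  δ zero    = 1#
  δ (suc _) = 0#

  -- Multiplication by `α X + β`. All polynomials below are combinations of products of linear
  -- factors, so this one operation takes the place of a general product.
  lin : Carrier → Carrier → Seq → Seq
  lin α β f zero    = β * f zero
  lin α β f (suc n) = α * f n + β * f (suc n)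

  lin^ : ℕ → Carrier → Carrier → Seq → Seq
  lin^ zero    α β f = f
  lin^ (suc m) α β f = lin α β (lin^ m α β f)

  lin-cong : ∀ {α α′ β β′ f f′} → α ≈ α′ → β ≈ β′ → f ≋ f′ → lin α β f ≋ lin α′ β′ f′
  lin-cong α≈ β≈ f≈ zero    = *-cong β≈ (f≈ zero)
  lin-cong α≈ β≈ f≈ (suc n) = +-cong (*-cong α≈ (f≈ n)) (*-cong β≈ (f≈ (suc n)))

  lin-congʳ : ∀ {α β f f′} → f ≋ f′ → lin α β f ≋ lin α β f′
  lin-congʳ = lin-cong refl refl

  lin-comm : ∀ α β γ ε f → lin α β (lin γ ε f) ≋ lin γ ε (lin α β f)
  lin-comm α β γ ε f zero = solve 3 (λ β ε x → β :* (ε :* x) := ε :* (β :* x)) refl β ε (f 0)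
  lin-comm α β γ ε f (suc zero) = solve 6 (λ α β γ ε x y →
    α :* (ε :* x) :+ β :* (γ :* x :+ ε :* y) := γ :* (β :* x) :+ ε :* (α :* x :+ β :* y)) refl α β γ ε (f 0) (f 1)
  lin-comm α β γ ε f (suc (suc n)) = solve 7 (λ α β γ ε x y z →
    α :* (γ :* x :+ ε :* y) :+ β :* (γ :* y :+ ε :* z) := γ :* (α :* x :+ β :* y) :+ ε :* (α :* y :+ β :* z))
    refl α β γ ε (f n) (f (suc n)) (f (suc (suc n)))

  lin-linear : ∀ α β c f g → lin α β (λ n → c * f n + g n) ≋ (λ n → c * lin α β f n + lin α β g n)
  lin-linear α β c f g zero = solve 4 (λ β c x y → β :* (c :* x :+ y) := c :* (β :* x) :+ β :* y) refl β c (f 0) (g 0)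
  lin-linear α β c f g (suc n) = solve 7 (λ α β c x y x′ y′ →
    α :* (c :* x :+ y) :+ β :* (c :* x′ :+ y′) := c :* (α :* x :+ β :* x′) :+ (α :* y :+ β :* y′))
    refl α β c (f n) (g n) (f (suc n)) (g (suc n))

  lin-zero : ∀ {α β f} → Below 0 f → Below 0 (lin α β f)
  lin-zero f≈0 zero    _ = trans (*-congˡ (f≈0 0 z≤n)) (zeroʳ _)
  lin-zero f≈0 (suc n) _ = trans (+-cong (trans (*-congˡ (f≈0 n z≤n)) (zeroʳ _)) (trans (*-congˡ (f≈0 (suc n) z≤n)) (zeroʳ _))) (+-identityʳ _)

  lin^-zero : ∀ m {α β f} → Below 0 f → Below 0 (lin^ m α β f)
  lin^-zero zero    f≈0 = f≈0
  lin^-zero (suc m) f≈0 = lin-zero (lin^-zero m f≈0)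

  Below-lin : ∀ {n α β f} → Below n f → Below (suc n) (lin α β f)
  Below-lin f≈0 (suc i) (s≤s n≤i) =
    trans (+-cong (trans (*-congˡ (f≈0 i n≤i)) (zeroʳ _)) (trans (*-congˡ (f≈0 (suc i) (ℕₚ.m≤n⇒m≤1+n n≤i))) (zeroʳ _))) (+-identityʳ _)

  Below-lin^ : ∀ m {n α β f} → Below n f → Below (m ℕ.+ n) (lin^ m α β f)
  Below-lin^ zero    f≈0 = f≈0
  Below-lin^ (suc m) f≈0 = Below-lin (Below-lin^ m f≈0)

  Below-mono : ∀ {m n f} → m ≤ n → Below m f → Below n f
  Below-mono m≤n f≈0 i n≤i = f≈0 i (ℕₚ.≤-trans m≤n n≤i)

  Below-linear : ∀ {n c f g} → Below n f → Below n g → Below n (λ i → c * f i + g i)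
  Below-linear f≈0 g≈0 i n≤i = trans (+-cong (trans (*-congˡ (f≈0 i n≤i)) (zeroʳ _)) (g≈0 i n≤i)) (+-identityʳ _)

  Below-δ : Below 1 δ
  Below-δ (suc i) _ = refl

  Finite : Seq → Set
  Finite f = ∃ λ n → Below n f

  Finite-lin^ : ∀ m {α β f} → Finite f → Finite (lin^ m α β f)
  Finite-lin^ m (n , f≈0) = m ℕ.+ n , Below-lin^ m f≈0

  Finite-linear : ∀ {c f g} → Finite f → Finite g → Finite (λ i → c * f i + g i)
  Finite-linear (m , f≈0) (n , g≈0) = m ℕ.+ n ,
    Below-linear (Below-mono (ℕₚ.m≤m+n m n) f≈0) (Below-mono (ℕₚ.m≤n+m n m) g≈0)

  -- Divisibility by powers of `X - b`

  Z : Carrier → Seq → Seq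
  Z b = lin 1# (- b)

  Z^ : ℕ → Carrier → Seq → Seq
  Z^ m b = lin^ m 1# (- b)

  -- Finiteness supplies some bound `m` to start from: the coefficient of degree `m + 1` in
  -- `(X - b) f` is `f m - b f (m + 1)`, so while `n ≤ m` a bound `m + 1` improves to `m`. For power
  -- series such as `1 / (X - b)` the claim fails.
  Z-degree : ∀ {n b f} → Finite f → Below (suc n) (Z b f) → Below n f
  Z-degree {n} {b} {f} (m , f≈0) Zf≈0 = descend m f≈0
    where
    descend : ∀ m → Below m f → Below n f
    descend zero    f≈0 = Below-mono z≤n f≈0
    descend (suc m) f≈0 with n ℕ.≤? m
    ... | no n≰m  = Below-mono (ℕₚ.≰⇒> n≰m) f≈0
    ... | yes n≤m = descend m below-m
      where
      top : f m ≈ 0#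
      top = begin
        f m                                   ≈⟨ solve 3 (λ b x y → x := con (+ 1) :* x :+ :- b :* y :+ b :* y) refl b (f m) (f (suc m)) ⟩
        1# * f m + - b * f (suc m) + b * f (suc m) ≈⟨ +-cong (Zf≈0 (suc m) (s≤s n≤m)) (*-congˡ (f≈0 (suc m) ℕₚ.≤-refl)) ⟩
        0# + b * 0#                           ≈⟨ solve 1 (λ b → con (+ 0) :+ b :* con (+ 0) := con (+ 0)) refl b ⟩
        0#                                    ∎
      below-m : Below m f
      below-m i m≤i with m ℕ.≟ i
      ... | yes ≡.refl = top
      ... | no m≢i     = f≈0 i (ℕₚ.≤∧≢⇒< m≤i m≢i)

  Z-degree∸ : ∀ {n b f} → Finite f → Below n (Z b f) → Below (n ∸ 1) f
  Z-degree∸ {zero}  fin Zf≈0 = Z-degree fin (Below-mono z≤n Zf≈0)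
  Z-degree∸ {suc n} fin Zf≈0 = Z-degree fin Zf≈0

  Z^-degree : ∀ m {n b f} → Finite f → Below n (Z^ m b f) → Below (n ∸ m) f
  Z^-degree zero          fin Zf≈0 = Zf≈0
  Z^-degree (suc m) {n} {b} {f} fin Zf≈0 = ≡.subst (λ k → Below k f) (ℕₚ.∸-+-assoc n 1 m)
    (Z^-degree m fin (Z-degree∸ (Finite-lin^ m fin) Zf≈0))

  Z-injective : ∀ {b f g} → Finite f → Finite g → Z b f ≋ Z b g → f ≋ g
  Z-injective {b} {f} {g} fin-f fin-g Zf≋Zg n = begin
    f n                       ≈⟨ solve 2 (λ x y → x := y :- (:- con (+ 1) :* x :+ y)) refl (f n) (g n) ⟩
    g n - (- 1# * f n + g n)  ≈⟨ +-congˡ (-‿cong (Z-degree∸ (Finite-linear fin-f fin-g) Zd≈0 n z≤n)) ⟩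
    g n - 0#                  ≈⟨ solve 1 (λ y → y :- con (+ 0) := y) refl (g n) ⟩
    g n                       ∎
    where
    Zd≈0 : Below 0 (Z b (λ n → - 1# * f n + g n))
    Zd≈0 i _ = begin
      Z b (λ n → - 1# * f n + g n) i  ≈⟨ lin-linear 1# (- b) (- 1#) f g i ⟩
      - 1# * Z b f i + Z b g i        ≈⟨ +-congʳ (*-congˡ (Zf≋Zg i)) ⟩
      - 1# * Z b g i + Z b g i        ≈⟨ solve 1 (λ x → :- con (+ 1) :* x :+ x := con (+ 0)) refl (Z b g i) ⟩
      0#                              ∎

  -- Bézout for the linear factors: (x - b) - (x - b′) is the unit b′ - b.
  Z-coprime : ∀ {b b′ f g} → ¬ b ≈ b′ → Z b f ≋ Z b′ g →
    ∃ λ u → f ≋ Z b′ (λ n → u * (- 1# * f n + g n))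
  Z-coprime {b} {b′} {f} {g} b≉b′ eq with inverse (b′ - b) (λ e → b≉b′ (sym (-‿≈0 e)))
  ... | u , inv = u , λ n → begin
    f n                                    ≈⟨ trans (sym (*-identityˡ _)) (*-congʳ (sym inv)) ⟩
    (b′ - b) * u * f n                     ≈⟨ solve 3 (λ d u x → d :* u :* x := u :* (d :* x)) refl (b′ - b) u (f n) ⟩
    u * ((b′ - b) * f n)                   ≈⟨ *-congˡ (diff n) ⟩
    u * (- 1# * Z b′ f n + Z b f n)        ≈⟨ *-congˡ (+-congˡ (eq n)) ⟩
    u * (- 1# * Z b′ f n + Z b′ g n)       ≈⟨ *-congˡ (lin-linear 1# (- b′) (- 1#) f g n) ⟨
    u * Z b′ (λ n → - 1# * f n + g n) n    ≈⟨ +-identityʳ _ ⟨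
    u * Z b′ (λ n → - 1# * f n + g n) n + 0#  ≈⟨ +-congˡ (lin-zero {f = λ _ → 0#} (λ _ _ → refl) n z≤n) ⟨
    u * Z b′ (λ n → - 1# * f n + g n) n + Z b′ (λ _ → 0#) n  ≈⟨ lin-linear 1# (- b′) u _ (λ _ → 0#) n ⟨
    Z b′ (λ n → u * (- 1# * f n + g n) + 0#) n  ≈⟨ lin-congʳ (λ _ → +-identityʳ _) n ⟩
    Z b′ (λ n → u * (- 1# * f n + g n)) n  ∎
    where
    diff : ∀ n → (b′ - b) * f n ≈ - 1# * Z b′ f n + Z b f n
    diff zero = solve 3 (λ b b′ x → (b′ :- b) :* x := :- con (+ 1) :* (:- b′ :* x) :+ :- b :* x) refl b b′ (f 0)
    diff (suc n) = solve 4 (λ b b′ x y → (b′ :- b) :* y := :- con (+ 1) :* (con (+ 1) :* x :+ :- b′ :* y) :+ (con (+ 1) :* x :+ :- b :* y))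
      refl b b′ (f n) (f (suc n))

  -- The quotient has to be finite: among power series `X - b` is invertible for nonzero `b`, and
  -- divisibility would say nothing.
  Div : ℕ → Carrier → Seq → Set
  Div m b f = ∃ λ g → Finite g × f ≋ Z^ m b g

  -- `Z-coprime` extracts one factor `X - b′` from `f`. Cancelling it on both sides leaves the same
  -- claim for the cofactor `h` with exponent `m`, one less than before.
  Div-Z : ∀ m {b b′ f} → ¬ b ≈ b′ → Finite f → Div m b′ (Z b f) → Div m b′ f
  Div-Z zero    {f = f} _ fin _ = f , fin , λ _ → refl
  Div-Z (suc m) {b} {b′} {f} b≉b′ fin (g , fin-g , eq) with Z-coprime b≉b′ eq
  ... | u , f≋ = proj₁ rec , proj₁ (proj₂ rec) , λ n → trans (f≋ n) (lin-congʳ (proj₂ (proj₂ rec)) n)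
    where
    h : Seq
    h n = u * (- 1# * f n + Z^ m b′ g n)
    fin-h : Finite h
    fin-h = let (k , below) = Finite-linear { - 1# } {f} fin (Finite-lin^ m fin-g)
            in k , λ i k≤i → trans (*-congˡ (below i k≤i)) (zeroʳ u)
    swap : Z b′ (Z b h) ≋ Z b′ (Z^ m b′ g)
    swap n = trans (lin-comm 1# (- b′) 1# (- b) h n) (trans (sym (lin-congʳ f≋ n)) (eq n))
    rec : Div m b′ h
    rec = Div-Z m b≉b′ fin-h (g , fin-g , Z-injective (Finite-lin^ 1 fin-h) (Finite-lin^ m fin-g) swap)

  Div-Z^ : ∀ k m {b b′ f} → ¬ b ≈ b′ → Finite f → Div m b′ (Z^ k b f) → Div m b′ f
  Div-Z^ zero    m b≉b′ fin d = d
  Div-Z^ (suc k) m b≉b′ fin d = Div-Z^ k m b≉b′ fin (Div-Z m b≉b′ (Finite-lin^ k fin) d)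

  Div-cong : ∀ {m b f g} → f ≋ g → Div m b f → Div m b g
  Div-cong f≋g (h , fin , eq) = h , fin , λ n → trans (sym (f≋g n)) (eq n)

  -- Zeros counted with multiplicity. Splitting off the `m`-th power of `X - b zero` lowers the
  -- degree bound by `m`, and the quotient keeps its divisibility at the other points because those
  -- linear factors are coprime to the removed one.
  vanishes : ∀ n m {D f} (b : Fin n → Carrier) → (∀ i j → b i ≈ b j → i ≡ j) →
    Below D f → (∀ j → Div m (b j) f) → D ≤ n ℕ.* m → Below 0 f
  vanishes zero m b inj f≈0 divs z≤n = f≈0
  vanishes (suc n) m {D} {f} b inj f≈0 divs D≤ with divs zero
  ... | g , fin , f≋ = λ i _ → trans (f≋ i) (lin^-zero m g≈0 i z≤n)
    where
    g≈0 : Below 0 g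
    g≈0 = vanishes n m (b ∘ suc) (λ i j e → Finₚ.suc-injective (inj _ _ e))
      (Z^-degree m fin (λ i D≤i → trans (sym (f≋ i)) (f≈0 i D≤i)))
      (λ j → Div-Z^ m m (λ e → Finₚ.0≢1+n (inj zero (suc j) e)) fin (Div-cong {m} {b (suc j)} f≋ (divs (suc j))))
      (≡.subst (D ∸ m ≤_) (ℕₚ.m+n∸m≡n m (n ℕ.* m)) (ℕₚ.∸-monoˡ-≤ m D≤))

  vanishes₀ : ∀ n m m₀ {D f} (b : Fin n → Carrier) → (∀ i j → b i ≈ b j → i ≡ j) → (∀ j → ¬ b j ≈ 0#) →
    Below D f → (∀ j → Div m (b j) f) → Div m₀ 0# f → D ≤ n ℕ.* m ℕ.+ m₀ → Below 0 f
  vanishes₀ n m m₀ {D} {f} b inj b≉0 f≈0 divs (g , fin , f≋) D≤ = λ i _ → trans (f≋ i) (lin^-zero m₀ g≈0 i z≤n)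
    where
    g≈0 : Below 0 g
    g≈0 = vanishes n m b inj
      (Z^-degree m₀ fin (λ i D≤i → trans (sym (f≋ i)) (f≈0 i D≤i)))
      (λ j → Div-Z^ m₀ m (λ e → b≉0 j (sym e)) fin (Div-cong {m} {b j} f≋ (divs j)))
      (≡.subst (D ∸ m₀ ≤_) (ℕₚ.m+n∸n≡m (n ℕ.* m) m₀) (ℕₚ.∸-monoˡ-≤ m₀ D≤))

  -- Taylor expansion about a point

  Φ : Carrier → ℕ → Seq → Seq
  Φ b zero    h i = 0#
  Φ b (suc n) h i = h 0 * δ i + Z b (Φ b n (h ∘ suc)) i

  Φ-cong : ∀ b n {h h′} → h ≋ h′ → Φ b n h ≋ Φ b n h′
  Φ-cong b zero    h≋ i = refl
  Φ-cong b (suc n) h≋ i = +-cong (*-congʳ (h≋ 0)) (lin-congʳ (Φ-cong b n (h≋ ∘ suc)) i)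

  Φ-linear : ∀ b n c h g → Φ b n (λ i → c * h i + g i) ≋ (λ i → c * Φ b n h i + Φ b n g i)
  Φ-linear b zero    c h g i = solve 1 (λ c → con (+ 0) := c :* con (+ 0) :+ con (+ 0)) refl c
  Φ-linear b (suc n) c h g i = begin
    (c * h 0 + g 0) * δ i + Z b (Φ b n (λ j → c * h (suc j) + g (suc j))) i
      ≈⟨ +-congˡ (trans (lin-congʳ (Φ-linear b n c (h ∘ suc) (g ∘ suc)) i) (lin-linear 1# (- b) c _ _ i)) ⟩
    (c * h 0 + g 0) * δ i + (c * Z b (Φ b n (h ∘ suc)) i + Z b (Φ b n (g ∘ suc)) i)
      ≈⟨ solve 6 (λ c x y d u v → (c :* x :+ y) :* d :+ (c :* u :+ v) := c :* (x :* d :+ u) :+ (y :* d :+ v))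
           refl c (h 0) (g 0) (δ i) (Z b (Φ b n (h ∘ suc)) i) (Z b (Φ b n (g ∘ suc)) i) ⟩
    c * (h 0 * δ i + Z b (Φ b n (h ∘ suc)) i) + (g 0 * δ i + Z b (Φ b n (g ∘ suc)) i) ∎

  Φ-zero : ∀ b n {h} → Below 0 h → Below 0 (Φ b n h)
  Φ-zero b zero    h≈0 i _ = refl
  Φ-zero b (suc n) h≈0 i _ = trans
    (+-cong (trans (*-congʳ (h≈0 0 z≤n)) (zeroˡ _)) (lin-zero (Φ-zero b n (λ j _ → h≈0 (suc j) z≤n)) i z≤n)) (+-identityʳ _)

  Φ-extend : ∀ b n {h} → Below n h → Φ b (suc n) h ≋ Φ b n h
  Φ-extend b zero    h≈0 i = Φ-zero b 1 h≈0 i z≤n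
  Φ-extend b (suc n) h≈0 i = +-congˡ (lin-congʳ (Φ-extend b n (λ j n≤j → h≈0 (suc j) (s≤s n≤j))) i)

  -- In the local coordinate `T = X - b` the factor `α T + β` is `α X + (β - α b)`. This lets
  -- expansions of products of linear factors be written down one factor at a time.
  Φ-lin : ∀ b n α β {h} → Below n h → Φ b (suc n) (lin α β h) ≋ lin α (β - α * b) (Φ b n h)
  Φ-lin b n α β {h} h≈0 i = begin
    Φ b (suc n) (lin α β h) i                           ≈⟨ Φ-cong b (suc n) split i ⟩
    Φ b (suc n) (λ j → α * shift j + β * h j) i         ≈⟨ Φ-linear b (suc n) α shift (λ j → β * h j) i ⟩
    α * Φ b (suc n) shift i + Φ b (suc n) (λ j → β * h j) i
      ≈⟨ +-cong (*-congˡ (trans (+-congʳ (zeroˡ _)) (+-identityˡ _)))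
           (trans (Φ-cong b (suc n) {λ j → β * h j} (λ _ → sym (+-identityʳ _)) i)
           (trans (Φ-linear b (suc n) β h (λ _ → 0#) i)
           (trans (+-congˡ (Φ-zero b (suc n) (λ _ _ → refl) i z≤n)) (+-identityʳ _)))) ⟩
    α * Z b (Φ b n h) i + β * Φ b (suc n) h i           ≈⟨ +-congˡ (*-congˡ (Φ-extend b n h≈0 i)) ⟩
    α * Z b (Φ b n h) i + β * Φ b n h i                 ≈⟨ combine (Φ b n h) i ⟩
    lin α (β - α * b) (Φ b n h) i                       ∎
    where
    shift : Seq
    shift zero    = 0#
    shift (suc j) = h j
    split : lin α β h ≋ (λ j → α * shift j + β * h j)
    split zero    = sym (trans (+-congʳ (zeroʳ α)) (+-identityˡ _))
    split (suc j) = refl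
    combine : ∀ f i → α * Z b f i + β * f i ≈ lin α (β - α * b) f i
    combine f zero = solve 4 (λ α β b x → α :* (:- b :* x) :+ β :* x := (β :- α :* b) :* x) refl α β b (f 0)
    combine f (suc i) = solve 5 (λ α β b x y → α :* (con (+ 1) :* x :+ :- b :* y) :+ β :* y := α :* x :+ (β :- α :* b) :* y)
      refl α β b (f i) (f (suc i))

  Φ-low : ∀ b n m h → (∀ j → j < m → h j ≈ 0#) → Φ b n h ≋ Z^ m b (Φ b (n ∸ m) (h ∘ (m ℕ.+_)))
  Φ-low b n       zero    h low i = refl
  Φ-low b zero    (suc m) h low i = sym (lin^-zero (suc m) (λ _ _ → refl) i z≤n)
  Φ-low b (suc n) (suc m) h low i = trans (+-congʳ (trans (*-congʳ (low 0 (s≤s z≤n))) (zeroˡ _)))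
    (trans (+-identityˡ _) (lin-congʳ (Φ-low b n m (h ∘ suc) (λ j j<m → low (suc j) (s≤s j<m))) i))

  Φ-below : ∀ b n h → Below n (Φ b n h)
  Φ-below b zero    h i _ = refl
  Φ-below b (suc n) h i n≤i = trans (+-cong (trans (*-congˡ (Below-δ i (ℕₚ.≤-trans (s≤s z≤n) n≤i))) (zeroʳ _))
    (Below-lin (Φ-below b n (h ∘ suc)) i n≤i)) (+-identityʳ _)

  -- `Φ b n h` is the Horner form of the sum of `h i * (X - b) ^ i` over `i < n`, so `h` lists the
  -- Taylor coefficients of `f` at `b`.
  record Taylor (b : Carrier) (n : ℕ) (f h : Seq) : Set where
    constructor taylor
    field
      bounded : Below n h
      expand  : Φ b n h ≋ f

  Taylor-δ : ∀ b → Taylor b 1 δ δ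
  Taylor-δ b = taylor Below-δ (λ i → trans (+-cong (*-identityˡ _) (lin-zero {f = λ _ → 0#} (λ _ _ → refl) i z≤n)) (+-identityʳ _))

  Taylor-lin : ∀ {b n f h α β γ} → γ ≈ β - α * b → Taylor b n f h → Taylor b (suc n) (lin α γ f) (lin α β h)
  Taylor-lin {b} {n} {α = α} {β} γ≈ (taylor below expand) = taylor (Below-lin below)
    (λ i → trans (Φ-lin b n α β below i) (lin-cong refl (sym γ≈) expand i))

  Taylor-lin^ : ∀ m {b n f h α β γ} → γ ≈ β - α * b → Taylor b n f h → Taylor b (m ℕ.+ n) (lin^ m α γ f) (lin^ m α β h)
  Taylor-lin^ zero    γ≈ t = t
  Taylor-lin^ (suc m) γ≈ t = Taylor-lin γ≈ (Taylor-lin^ m γ≈ t)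

  Taylor-zero : ∀ {b n} → Taylor b n (λ _ → 0#) (λ _ → 0#)
  Taylor-zero {b} {n} = taylor (λ _ _ → refl) (λ i → Φ-zero b n (λ _ _ → refl) i z≤n)

  Taylor-linear : ∀ {b n c f h f′ h′} → Taylor b n f h → Taylor b n f′ h′ →
    Taylor b n (λ i → c * f i + f′ i) (λ i → c * h i + h′ i)
  Taylor-linear {b} {n} {c} (taylor below expand) (taylor below′ expand′) =
    taylor (Below-linear below below′) (λ i → trans (Φ-linear b n c _ _ i) (+-cong (*-congˡ (expand i)) (expand′ i)))

  Taylor-raise : ∀ {b n f h} k → Taylor b n f h → Taylor b (k ℕ.+ n) f h
  Taylor-raise zero t = t
  Taylor-raise {b} {n} (suc k) t with Taylor-raise k t
  ... | taylor below expand = taylor (Below-mono (ℕₚ.n≤1+n _) below) (λ i → trans (Φ-extend b (k ℕ.+ n) below i) (expand i))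

  Taylor-sum : ∀ {b n s} (c : Fin s → Carrier) {f h : Fin s → Seq} → (∀ i → Taylor b n (f i) (h i)) →
    Taylor b n (λ j → sum (λ i → c i * f i j)) (λ j → sum (λ i → c i * h i j))
  Taylor-sum {s = zero}  c t = Taylor-zero
  Taylor-sum {s = suc s} c t = Taylor-linear (t zero) (Taylor-sum (c ∘ suc) (t ∘ suc))

  Taylor⇒Div : ∀ {b n m f h} → Taylor b n f h → (∀ j → j < m → h j ≈ 0#) → Div m b f
  Taylor⇒Div {b} {n} {m} {h = h} (taylor _ expand) low =
    Φ b (n ∸ m) (h ∘ (m ℕ.+_)) , (n ∸ m , Φ-below b (n ∸ m) _) , λ i → trans (sym (expand i)) (Φ-low b n m h low i)

  Taylor⇒Below : ∀ {b n f h} → Taylor b n f h → Below n f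
  Taylor⇒Below {b} {n} {h = h} (taylor _ expand) i n≤i = trans (sym (expand i)) (Φ-below b n h i n≤i)

  Taylor-0 : ∀ {n f} → Below n f → Taylor 0# n f f
  Taylor-0 {n} {f} below = taylor below (expand n f below)
    where
    expand : ∀ n f → Below n f → Φ 0# n f ≋ f
    expand zero    f below i = sym (below i z≤n)
    expand (suc n) f below zero = solve 2 (λ x y → x :* con (+ 1) :+ :- con (+ 0) :* y := x) refl (f 0) (Φ 0# n (f ∘ suc) 0)
    expand (suc n) f below (suc i) = trans
      (solve 3 (λ x y z → x :* con (+ 0) :+ (con (+ 1) :* y :+ :- con (+ 0) :* z) := y) refl (f 0) (Φ 0# n (f ∘ suc) i) (Φ 0# n (f ∘ suc) (suc i)))
      (expand n (f ∘ suc) (λ j n≤j → below (suc j) (s≤s n≤j)) i)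

-- Binomial coefficients in characteristic p

module Binomials {q : ℕ} (F : FiniteField q) where
  open FiniteField F hiding (zero)
  open Field F
  open Sequences F
  open Relation.Binary.Reasoning.Setoid setoid

  -- The coefficients of `(1 + X) ^ n`, taken in the field itself: Pascal's rule holds by
  -- computation and the characteristic is already built in.
  bin : ℕ → Seq
  bin n = lin^ n 1# 1# δ

  bin-above : ∀ {n v} → n < v → bin n v ≈ 0#
  bin-above {n} {v} n<v = Below-lin^ n Below-δ v (≡.subst (_≤ v) (≡.sym (ℕₚ.+-comm n 1)) n<v)

  bin-0 : ∀ n → bin n 0 ≈ 1#
  bin-0 zero    = refl
  bin-0 (suc n) = trans (*-identityˡ _) (bin-0 n)

  bin-n : ∀ n → bin n n ≈ 1#
  bin-n zero    = refl
  bin-n (suc n) = trans (+-cong (trans (*-identityˡ _) (bin-n n)) (trans (*-identityˡ _) (bin-above {n} ℕₚ.≤-refl))) (+-identityʳ _)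

  bin-suc-n : ∀ n → bin (suc n) n ≈ ι (suc n)
  bin-suc-n zero    = trans (*-identityˡ _) (sym (+-identityʳ _))
  bin-suc-n (suc n) = trans (+-cong (*-identityˡ _) (*-identityˡ _)) (trans (+-comm _ _) (+-cong (bin-n (suc n)) (bin-suc-n n)))

  bin-C : ∀ n v → bin n v ≈ ι (n C v)
  bin-C n       zero    = trans (bin-0 n) (sym ι-1)
  bin-C zero    (suc v) = sym (reflexive (≡.cong ι (k>n⇒nCk≡0 {0} {suc v} (s≤s z≤n))))
  bin-C (suc n) (suc v) = begin
    1# * bin n v + 1# * bin n (suc v)  ≈⟨ +-cong (*-identityˡ _) (*-identityˡ _) ⟩
    bin n v + bin n (suc v)            ≈⟨ +-cong (bin-C n v) (bin-C n (suc v)) ⟩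
    ι (n C v) + ι (n C suc v)          ≈⟨ ι-+ (n C v) (n C suc v) ⟨
    ι ((n C v) ℕ.+ (n C suc v))        ≡⟨ ≡.cong ι (nCk+nC[k+1]≡[n+1]C[k+1] n v) ⟩
    ι (suc n C suc v)                  ∎

  bin-prime-power : ∀ {p} → Prime p → ι p ≈ 0# → ∀ h v → 0 < v → v < p ℕ.^ h → bin (p ℕ.^ h) v ≈ 0#
  bin-prime-power {p} p-prime ιp≈0 h v 0<v v<s with p∣p^hCv p-prime h v 0<v v<s
  ... | divides k eq = begin
    bin (p ℕ.^ h) v      ≈⟨ bin-C (p ℕ.^ h) v ⟩
    ι ((p ℕ.^ h) C v)    ≡⟨ ≡.cong ι eq ⟩
    ι (k ℕ.* p)          ≈⟨ ι-* k p ⟩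
    ι k * ι p            ≈⟨ *-congˡ ιp≈0 ⟩
    ι k * 0#             ≈⟨ zeroʳ _ ⟩
    0#                   ∎

  lin^-coefficient : ∀ E α β v → lin^ E α β δ v ≈ bin E v * (α ^ v * β ^ (E ∸ v))
  lin^-coefficient zero    α β zero    = solve 0 (con (+ 1) := con (+ 1) :* (con (+ 1) :* con (+ 1))) refl
  lin^-coefficient zero    α β (suc v) = sym (zeroˡ _)
  lin^-coefficient (suc E) α β zero    = trans (*-congˡ (lin^-coefficient E α β zero))
    (solve 3 (λ β x y → β :* (x :* (con (+ 1) :* y)) := (con (+ 1) :* x) :* (con (+ 1) :* (β :* y))) refl β (bin E 0) (β ^ E))
  lin^-coefficient (suc E) α β (suc v) = trans (+-cong (*-congˡ (lin^-coefficient E α β v)) (*-congˡ (lin^-coefficient E α β (suc v)))) merge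
    where
    merge : α * (bin E v * (α ^ v * β ^ (E ∸ v))) + β * (bin E (suc v) * (α ^ suc v * β ^ (E ∸ suc v)))
      ≈ (1# * bin E v + 1# * bin E (suc v)) * (α ^ suc v * β ^ (E ∸ v))
    merge with v ℕ.<? E
    ... | yes v<E rewrite ℕₚ.+-∸-assoc 1 v<E = solve 6 (λ α β x y a b →
      α :* (x :* (a :* (β :* b))) :+ β :* (y :* (α :* a :* b)) := (con (+ 1) :* x :+ con (+ 1) :* y) :* (α :* a :* (β :* b)))
      refl α β (bin E v) (bin E (suc v)) (α ^ v) (β ^ (E ∸ suc v))
    -- Here `E ∸ suc v` is truncated and the power of `β` does not split; the second binomial
    -- coefficient is 0 instead.
    ... | no v≮E = begin
      α * (bin E v * (α ^ v * β ^ (E ∸ v))) + β * (bin E (suc v) * (α ^ suc v * β ^ (E ∸ suc v)))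
        ≈⟨ +-congˡ (*-congˡ (*-congʳ above)) ⟩
      α * (bin E v * (α ^ v * β ^ (E ∸ v))) + β * (0# * (α ^ suc v * β ^ (E ∸ suc v)))
        ≈⟨ solve 6 (λ α β x a b c → α :* (x :* (a :* b)) :+ β :* (con (+ 0) :* (α :* a :* c))
             := (con (+ 1) :* x :+ con (+ 1) :* con (+ 0)) :* (α :* a :* b)) refl α β (bin E v) (α ^ v) (β ^ (E ∸ v)) (β ^ (E ∸ suc v)) ⟩
      (1# * bin E v + 1# * 0#) * (α ^ suc v * β ^ (E ∸ v))
        ≈⟨ *-congʳ (+-congˡ (*-congˡ above)) ⟨
      (1# * bin E v + 1# * bin E (suc v)) * (α ^ suc v * β ^ (E ∸ v)) ∎
      where
      above : bin E (suc v) ≈ 0#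
      above = bin-above {E} (s≤s (ℕₚ.≮⇒≥ v≮E))

  FrobeniusExponent : ℕ → Set
  FrobeniusExponent s = ∀ v → 0 < v → v < s → bin s v ≈ 0#

  module Lucas (s : ℕ) (frob : FrobeniusExponent (suc s)) where

    -- (1 + x)^(n + s) = (1 + x)^n (1 + x^s), read off below and above degree s.
    bin-+s-low : ∀ n v → v < suc s → bin (n ℕ.+ suc s) v ≈ bin n v
    bin-+s-low zero    zero    _ = bin-0 (suc s)
    bin-+s-low zero    (suc v) v<s = frob (suc v) (s≤s z≤n) v<s
    bin-+s-low (suc n) zero    0<s = *-congˡ (bin-+s-low n zero 0<s)
    bin-+s-low (suc n) (suc v) v<s = +-cong (*-congˡ (bin-+s-low n v (ℕₚ.<⇒≤ v<s))) (*-congˡ (bin-+s-low n (suc v) v<s))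

    bin-+s-high : ∀ n v → bin (n ℕ.+ suc s) (v ℕ.+ suc s) ≈ bin n (v ℕ.+ suc s) + bin n v
    bin-+s-high zero    zero    = trans (bin-n (suc s)) (sym (+-identityˡ _))
    bin-+s-high zero    (suc v) = trans (bin-above {suc s} (s≤s (ℕₚ.m≤n+m (suc s) v))) (sym (+-identityˡ _))
    bin-+s-high (suc n) zero    = trans
      (+-cong (*-congˡ (bin-+s-low n s ℕₚ.≤-refl)) (*-congˡ (bin-+s-high n zero)))
      (solve 3 (λ x y z → con (+ 1) :* x :+ con (+ 1) :* (y :+ z) := con (+ 1) :* x :+ con (+ 1) :* y :+ con (+ 1) :* z)
        refl (bin n s) (bin n (suc s)) (bin n 0))
    bin-+s-high (suc n) (suc v) = trans
      (+-cong (*-congˡ (bin-+s-high n v)) (*-congˡ (bin-+s-high n (suc v))))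
      (solve 4 (λ x y z w → con (+ 1) :* (x :+ y) :+ con (+ 1) :* (z :+ w) := con (+ 1) :* x :+ con (+ 1) :* z :+ (con (+ 1) :* y :+ con (+ 1) :* w))
        refl (bin n (v ℕ.+ suc s)) (bin n v) (bin n (suc v ℕ.+ suc s)) (bin n (suc v)))

    reassoc : ∀ t n → suc t ℕ.* suc s ℕ.+ n ≡ t ℕ.* suc s ℕ.+ n ℕ.+ suc s
    reassoc t n = ≡.trans (ℕₚ.+-assoc (suc s) _ n) (ℕₚ.+-comm (suc s) _)

    lucas-low : ∀ t n v → v < suc s → bin (t ℕ.* suc s ℕ.+ n) v ≈ bin n v
    lucas-low zero    n v v<s = refl
    lucas-low (suc t) n v v<s = begin
      bin (suc t ℕ.* suc s ℕ.+ n) v        ≡⟨ ≡.cong (λ m → bin m v) (reassoc t n) ⟩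
      bin (t ℕ.* suc s ℕ.+ n ℕ.+ suc s) v  ≈⟨ bin-+s-low (t ℕ.* suc s ℕ.+ n) v v<s ⟩
      bin (t ℕ.* suc s ℕ.+ n) v            ≈⟨ lucas-low t n v v<s ⟩
      bin n v                              ∎

    -- In `(1 + x^s)^t (1 + x)^n` only the terms `1` and `t x^s` of the first factor can contribute
    -- in degree `v + s < 2 s`.
    lucas-high : ∀ t n v → v < suc s → bin (t ℕ.* suc s ℕ.+ n) (v ℕ.+ suc s) ≈ bin n (v ℕ.+ suc s) + ι t * bin n v
    lucas-high zero    n v v<s = sym (trans (+-congˡ (zeroˡ _)) (+-identityʳ _))
    lucas-high (suc t) n v v<s = begin
      bin (suc t ℕ.* suc s ℕ.+ n) (v ℕ.+ suc s)            ≡⟨ ≡.cong (λ m → bin m (v ℕ.+ suc s)) (reassoc t n) ⟩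
      bin (t ℕ.* suc s ℕ.+ n ℕ.+ suc s) (v ℕ.+ suc s)      ≈⟨ bin-+s-high (t ℕ.* suc s ℕ.+ n) v ⟩
      bin (t ℕ.* suc s ℕ.+ n) (v ℕ.+ suc s) + bin (t ℕ.* suc s ℕ.+ n) v
        ≈⟨ +-cong (lucas-high t n v v<s) (lucas-low t n v v<s) ⟩
      bin n (v ℕ.+ suc s) + ι t * bin n v + bin n v
        ≈⟨ solve 3 (λ x y z → x :+ y :* z :+ z := x :+ (con (+ 1) :+ y) :* z) refl (bin n (v ℕ.+ suc s)) (ι t) (bin n v) ⟩
      bin n (v ℕ.+ suc s) + ι (suc t) * bin n v            ∎

-- Weights annihilating low powers

module Functionals {q : ℕ} (F : FiniteField q) where
  open FiniteField F hiding (zero)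
  open Field F
  open Relation.Binary.Reasoning.Setoid setoid

  L : ∀ {n} → (c a : Fin n → Carrier) → (Carrier → Carrier) → Carrier
  L c a φ = sum (λ i → c i * φ (a i))

  L-cong : ∀ {n} (c a : Fin n → Carrier) φ ψ → (∀ i → φ (a i) ≈ ψ (a i)) → L c a φ ≈ L c a ψ
  L-cong {n} c a φ ψ φ≈ψ = sum-cong-≋ {n} (λ i → *-congˡ (φ≈ψ i))

  L-zero : ∀ {n} (c a : Fin n → Carrier) → L c a (λ _ → 0#) ≈ 0#
  L-zero {n} c a = trans (sum-cong-≋ {n} (λ i → zeroʳ (c i))) (sum-replicate-zero n)

  L-linear : ∀ {n} (c a : Fin n → Carrier) α φ ψ → L c a (λ x → α * φ x + ψ x) ≈ α * L c a φ + L c a ψ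
  L-linear {zero}  c a α φ ψ = solve 1 (λ α → con (+ 0) := α :* con (+ 0) :+ con (+ 0)) refl α
  L-linear {suc n} c a α φ ψ = trans (+-congˡ (L-linear (c ∘ suc) (a ∘ suc) α φ ψ))
    (solve 6 (λ α c x y u v → c :* (α :* x :+ y) :+ (α :* u :+ v) := α :* (c :* x :+ u) :+ (c :* y :+ v))
      refl α (c zero) (φ (a zero)) (ψ (a zero)) (L (c ∘ suc) (a ∘ suc) φ) (L (c ∘ suc) (a ∘ suc) ψ))

  -- Divided differences: the weights at the points a₀, a₁, … are obtained by
  -- applying the weights at a₁, … to (φ x - φ a₀) / (x - a₀).
  dividedDifference : ∀ n (a : Fin (suc n) → Carrier) → (∀ i j → a i ≈ a j → i ≡ j) →
    ∃ λ c → (∀ w → w < n → L c a (_^ w) ≈ 0#) × L c a (_^ n) ≈ 1#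
  dividedDifference zero a inj = (λ _ → 1#) , (λ _ ()) ,
    solve 0 (con (+ 1) :* con (+ 1) :+ con (+ 0) := con (+ 1)) refl
  dividedDifference (suc n) a inj with dividedDifference n (a ∘ suc) (λ i j e → Finₚ.suc-injective (inj _ _ e))
  ... | c , low , top = c′ , low′ , top′
    where
    d : ∀ i → ∃ λ y → (a (suc i) - a zero) * y ≈ 1#
    d i = inverse (a (suc i) - a zero) (λ e → Finₚ.0≢1+n (≡.sym (inj (suc i) zero (-‿≈0 e))))
    c″ : Fin (suc n) → Carrier
    c″ i = c i * proj₁ (d i)
    c′ : Fin (suc (suc n)) → Carrier
    c′ zero    = - sum c″
    c′ (suc i) = c″ i
    S S′ : ℕ → Carrier
    S w = L c (a ∘ suc) (_^ w)
    S′ w = L c′ a (_^ w)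
    S″ : ℕ → Carrier
    S″ w = L c″ (a ∘ suc) (_^ w)
    base : S′ 0 ≈ 0#
    base = trans (+-congˡ (sum-cong-≋ {suc n} (λ i → *-identityʳ (c″ i))))
      (solve 1 (λ x → :- x :* con (+ 1) :+ x := con (+ 0)) refl (sum c″))
    step″ : ∀ w → S″ (suc w) ≈ a zero * S″ w + S w
    step″ w = begin
      S″ (suc w)                                                     ≈⟨ sum-cong-≋ {suc n} term ⟩
      sum (λ i → a zero * (c″ i * a (suc i) ^ w) + c i * a (suc i) ^ w)  ≈⟨ ∑-distrib-+ {suc n} (λ i → a zero * (c″ i * a (suc i) ^ w)) (λ i → c i * a (suc i) ^ w) ⟩
      sum (λ i → a zero * (c″ i * a (suc i) ^ w)) + S w              ≈⟨ +-congʳ (*-distribˡ-sum {suc n} (a zero) (λ i → c″ i * a (suc i) ^ w)) ⟨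
      a zero * S″ w + S w                                            ∎
      where
      term : ∀ i → c″ i * a (suc i) ^ suc w ≈ a zero * (c″ i * a (suc i) ^ w) + c i * a (suc i) ^ w
      term i = begin
        c″ i * (a (suc i) * x)
          ≈⟨ solve 5 (λ a₀ a c y x → c :* y :* (a :* x) := a₀ :* (c :* y :* x) :+ c :* ((a :- a₀) :* y) :* x)
               refl (a zero) (a (suc i)) (c i) (proj₁ (d i)) x ⟩
        a zero * (c″ i * x) + c i * ((a (suc i) - a zero) * proj₁ (d i)) * x
          ≈⟨ +-congˡ (*-congʳ (trans (*-congˡ (proj₂ (d i))) (*-identityʳ _))) ⟩
        a zero * (c″ i * x) + c i * x ∎
        where x = a (suc i) ^ w
    step : ∀ w → S′ (suc w) ≈ a zero * S′ w + S w
    step w = trans (+-congˡ (step″ w))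
      (solve 5 (λ m a₀ x u v → m :* (a₀ :* x) :+ (a₀ :* u :+ v) := a₀ :* (m :* x :+ u) :+ v)
        refl (- sum c″) (a zero) (a zero ^ w) (S″ w) (S w))
    low′ : ∀ w → w < suc n → S′ w ≈ 0#
    low′ zero    _ = base
    low′ (suc w) (s≤s w<n) = trans (step w)
      (trans (+-cong (trans (*-congˡ (low′ w (ℕₚ.m≤n⇒m≤1+n w<n))) (zeroʳ _)) (low w w<n)) (+-identityʳ _))
    top′ : S′ (suc n) ≈ 1#
    top′ = trans (step n) (trans (+-cong (trans (*-congˡ (low′ n ℕₚ.≤-refl)) (zeroʳ _)) top) (+-identityˡ _))

  -- Dividing each divided-difference weight by `a i` moves the controlled exponents from `0, …, n`
  -- to `1, …, n + 1`. Polynomials of one degree more are thereby annihilated up to their constant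
  -- term, at the price of an unknown `σ₀`.
  weights : ∀ n (a : Fin (suc n) → Carrier) → (∀ i → ¬ a i ≈ 0#) → (∀ i j → a i ≈ a j → i ≡ j) →
    ∃ λ c → (∀ w → 0 < w → w < suc n → L c a (_^ w) ≈ 0#) × L c a (_^ suc n) ≈ 1#
  weights n a a≉0 inj with dividedDifference n a inj
  ... | c , low , top = c′ , low′ , trans (shift n) top
    where
    c′ : Fin (suc n) → Carrier
    c′ i = c i * proj₁ (inverse (a i) (a≉0 i))
    shift : ∀ w → L c′ a (_^ suc w) ≈ L c a (_^ w)
    shift w = sum-cong-≋ {suc n} (λ i → let y , inv = inverse (a i) (a≉0 i) in begin
      c i * y * (a i * a i ^ w)      ≈⟨ solve 4 (λ c y a x → c :* y :* (a :* x) := c :* (a :* y) :* x) refl (c i) y (a i) (a i ^ w) ⟩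
      c i * (a i * y) * a i ^ w      ≈⟨ *-congʳ (trans (*-congˡ inv) (*-identityʳ _)) ⟩
      c i * a i ^ w                  ∎)
    low′ : ∀ w → 0 < w → w < suc n → L c′ a (_^ w) ≈ 0#
    low′ (suc w) _ (s≤s w<n) = trans (shift w) (low w w<n)

-- The auxiliary polynomial

module Stepanov {q : ℕ} (F : FiniteField q) (s′ : ℕ)
  (c a : Fin (suc s′) → FiniteField.Carrier F) where
  open FiniteField F hiding (zero)
  open Field F
  open Sequences F
  open Binomials F
  open Functionals F
  open Relation.Binary.Reasoning.Setoid setoid

  s : ℕ
  s = suc s′

  ⟨_⟩ : (Carrier → Carrier) → Carrier
  ⟨ φ ⟩ = L c a φ

  ⟨⟩-cong : ∀ φ ψ → (∀ i → φ (a i) ≈ ψ (a i)) → ⟨ φ ⟩ ≈ ⟨ ψ ⟩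
  ⟨⟩-cong = L-cong c a

  ⟨0⟩≈0 : ⟨ (λ _ → 0#) ⟩ ≈ 0#
  ⟨0⟩≈0 = L-zero c a

  σ₀ : Carrier
  σ₀ = ⟨ (λ _ → 1#) ⟩

  -- φ behaves under the functional like a polynomial of degree at most n
  -- with constant term z and coefficient ℓ in degree n.
  record Poly (n : ℕ) (φ : Carrier → Carrier) (z ℓ : Carrier) : Set where
    constructor poly
    field
      low : ∀ w → w ℕ.+ n < s → ⟨ (λ x → x ^ w * φ x) ⟩ ≈ σ₀ * (z * δ w)
      top : ∀ w → w ℕ.+ n ≡ s → ⟨ (λ x → x ^ w * φ x) ⟩ ≈ σ₀ * (z * δ w) + ℓ
  open Poly

  Poly-eval : ∀ {n φ z ℓ} → Poly n φ z ℓ → n < s → ⟨ φ ⟩ ≈ σ₀ * z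
  Poly-eval {φ = φ} P n<s = trans (⟨⟩-cong φ (λ x → x ^ 0 * φ x) (λ i → sym (*-identityˡ _))) (trans (low P 0 n<s) (*-congˡ (*-identityʳ _)))

  Poly-eval-top : ∀ {n φ z ℓ} → Poly n φ z ℓ → n ≡ s → ⟨ φ ⟩ ≈ σ₀ * z + ℓ
  Poly-eval-top {φ = φ} P n≡s = trans (⟨⟩-cong φ (λ x → x ^ 0 * φ x) (λ i → sym (*-identityˡ _))) (trans (top P 0 n≡s) (+-congʳ (*-congˡ (*-identityʳ _))))

  Poly-cong : ∀ {n φ φ′ z z′ ℓ ℓ′} → (∀ x → φ x ≈ φ′ x) → z ≈ z′ → ℓ ≈ ℓ′ → Poly n φ z ℓ → Poly n φ′ z′ ℓ′
  Poly-cong {φ = φ} {φ′} φ≈ z≈ ℓ≈ P = poly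
    (λ w w< → trans (⟨⟩-cong (λ x → x ^ w * φ′ x) (λ x → x ^ w * φ x) (λ i → *-congˡ (sym (φ≈ _)))) (trans (low P w w<) (*-congˡ (*-congʳ z≈))))
    (λ w w≡ → trans (⟨⟩-cong (λ x → x ^ w * φ′ x) (λ x → x ^ w * φ x) (λ i → *-congˡ (sym (φ≈ _)))) (trans (top P w w≡) (+-cong (*-congˡ (*-congʳ z≈)) ℓ≈)))

  Poly-linear : ∀ {n φ ψ z y ℓ m} γ → Poly n φ z ℓ → Poly n ψ y m → Poly n (λ x → γ * φ x + ψ x) (γ * z + y) (γ * ℓ + m)
  Poly-linear {n} {φ} {ψ} {z} {y} {ℓ} {m} γ P Q = poly
    (λ w w< → trans (split w) (trans (+-cong (*-congˡ (low P w w<)) (low Q w w<))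
      (solve 5 (λ γ s z y d → γ :* (s :* (z :* d)) :+ s :* (y :* d) := s :* ((γ :* z :+ y) :* d)) refl γ σ₀ z y (δ w))))
    (λ w w≡ → trans (split w) (trans (+-cong (*-congˡ (top P w w≡)) (top Q w w≡))
      (solve 7 (λ γ s z y d l m → γ :* (s :* (z :* d) :+ l) :+ (s :* (y :* d) :+ m) := s :* ((γ :* z :+ y) :* d) :+ (γ :* l :+ m)) refl γ σ₀ z y (δ w) ℓ m)))
    where
    split : ∀ w → ⟨ (λ x → x ^ w * (γ * φ x + ψ x)) ⟩ ≈ γ * ⟨ (λ x → x ^ w * φ x) ⟩ + ⟨ (λ x → x ^ w * ψ x) ⟩
    split w = trans
      (⟨⟩-cong (λ x → x ^ w * (γ * φ x + ψ x)) (λ x → γ * (x ^ w * φ x) + x ^ w * ψ x)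
        (λ i → solve 4 (λ x γ u v → x :* (γ :* u :+ v) := γ :* (x :* u) :+ x :* v) refl (a i ^ w) γ (φ (a i)) (ψ (a i))))
      (L-linear c a γ (λ x → x ^ w * φ x) (λ x → x ^ w * ψ x))

  Poly-raise : ∀ {n φ z ℓ} → Poly n φ z ℓ → Poly (suc n) φ z 0#
  Poly-raise {n} P = poly
    (λ w w< → low P w (ℕₚ.<-trans (ℕₚ.+-monoʳ-< w (ℕₚ.n<1+n n)) w<))
    (λ w w≡ → trans (low P w (≡.subst (suc (w ℕ.+ n) ≤_) (≡.trans (≡.sym (ℕₚ.+-suc w n)) w≡) ℕₚ.≤-refl)) (sym (+-identityʳ _)))

  Poly-zero : ∀ {n} → Poly n (λ _ → 0#) 0# 0#
  Poly-zero {n} = poly (λ w _ → trans (zero-sum w) (sym (zero-const w))) (λ w _ → trans (zero-sum w) (sym (trans (+-identityʳ _) (zero-const w))))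
    where
    zero-const : ∀ w → σ₀ * (0# * δ w) ≈ 0#
    zero-const w = trans (*-congˡ (zeroˡ _)) (zeroʳ _)
    zero-sum : ∀ w → ⟨ (λ x → x ^ w * 0#) ⟩ ≈ 0#
    zero-sum w = trans (⟨⟩-cong (λ x → x ^ w * 0#) (λ _ → 0#) (λ i → zeroʳ _)) ⟨0⟩≈0

  Poly-scale : ∀ {n φ z ℓ} γ → Poly n φ z ℓ → Poly n (λ x → γ * φ x) (γ * z) (γ * ℓ)
  Poly-scale γ P = Poly-cong (λ _ → +-identityʳ _) (+-identityʳ _) (+-identityʳ _) (Poly-linear γ P Poly-zero)

  -- A factor `x` turns the weight `x ^ w` into `x ^ suc w` and costs one degree. This closure is
  -- the reason for the quantification over `w` in `Poly`.
  Poly-mul : ∀ {n φ z ℓ} α β → Poly n φ z ℓ → Poly (suc n) (λ x → (α * x + β) * φ x) (β * z) (α * ℓ)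
  Poly-mul {n} {φ} {z} {ℓ} α β P = poly
    (λ w w< → let w+n< = ≡.subst (_< s) (ℕₚ.+-suc w n) w< in
      trans (split w) (trans (+-cong (*-congˡ (low P (suc w) w+n<)) (*-congˡ (low P w (ℕₚ.<⇒≤ w+n<))))
      (solve 5 (λ α β s z d → α :* (s :* (z :* con (+ 0))) :+ β :* (s :* (z :* d)) := s :* (β :* z :* d)) refl α β σ₀ z (δ w))))
    (λ w w≡ → let w+n≡ = ≡.trans (≡.sym (ℕₚ.+-suc w n)) w≡ in
      trans (split w) (trans (+-cong (*-congˡ (top P (suc w) w+n≡)) (*-congˡ (low P w (ℕₚ.≤-reflexive w+n≡))))
      (solve 6 (λ α β s z d l → α :* (s :* (z :* con (+ 0)) :+ l) :+ β :* (s :* (z :* d)) := s :* (β :* z :* d) :+ α :* l) refl α β σ₀ z (δ w) ℓ)))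
    where
    split : ∀ w → ⟨ (λ x → x ^ w * ((α * x + β) * φ x)) ⟩ ≈ α * ⟨ (λ x → x ^ suc w * φ x) ⟩ + β * ⟨ (λ x → x ^ w * φ x) ⟩
    split w = trans
      (⟨⟩-cong (λ x → x ^ w * ((α * x + β) * φ x)) (λ x → α * (x ^ suc w * φ x) + (β * (x ^ w * φ x) + 0#))
        (λ i → solve 5 (λ x y α β u → y :* ((α :* x :+ β) :* u) := α :* (x :* y :* u) :+ (β :* (y :* u) :+ con (+ 0))) refl (a i) (a i ^ w) α β (φ (a i))))
      (trans (L-linear c a α (λ x → x ^ suc w * φ x) (λ x → β * (x ^ w * φ x) + 0#))
      (+-congˡ (trans (L-linear c a β (λ x → x ^ w * φ x) (λ _ → 0#))
      (trans (+-congˡ ⟨0⟩≈0) (+-identityʳ _)))))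

  Poly-mul^ : ∀ m {n φ z ℓ} α β → Poly n φ z ℓ → Poly (m ℕ.+ n) (λ x → (α * x + β) ^ m * φ x) (β ^ m * z) (α ^ m * ℓ)
  Poly-mul^ zero    α β P = Poly-cong (λ _ → sym (*-identityˡ _)) (sym (*-identityˡ _)) (sym (*-identityˡ _)) P
  Poly-mul^ (suc m) α β P = Poly-cong (λ _ → sym (*-assoc _ _ _)) (sym (*-assoc _ _ _)) (sym (*-assoc _ _ _)) (Poly-mul α β (Poly-mul^ m α β P))

  lin-cong-< : ∀ M {α β f g} → (∀ j → j < M → f j ≈ g j) → ∀ j → j < M → lin α β f j ≈ lin α β g j
  lin-cong-< M f≈ zero    j<M = *-congˡ (f≈ zero j<M)
  lin-cong-< M f≈ (suc j) j<M = +-cong (*-congˡ (f≈ j (ℕₚ.<⇒≤ j<M))) (*-congˡ (f≈ (suc j) j<M))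

  lin^-cong-< : ∀ k M {α β f g} → (∀ j → j < M → f j ≈ g j) → ∀ j → j < M → lin^ k α β f j ≈ lin^ k α β g j
  lin^-cong-< zero    M f≈ = f≈
  lin^-cong-< (suc k) M f≈ = lin-cong-< M (lin^-cong-< k M f≈)

  lin^-0-low : ∀ k {α β f} → β ≈ 0# → ∀ j → j < k → lin^ k α β f j ≈ 0#
  lin^-0-low (suc k) β≈0 zero    _         = trans (*-congʳ β≈0) (zeroˡ _)
  lin^-0-low (suc k) β≈0 (suc j) (s≤s j<k) =
    trans (+-cong (trans (*-congˡ (lin^-0-low k β≈0 j j<k)) (zeroʳ _)) (trans (*-congʳ β≈0) (zeroˡ _))) (+-identityʳ _)

  module Construction
    (0<w<s⇒⟨w⟩≈0 : ∀ w → 0 < w → w < s → ⟨ _^ w ⟩ ≈ 0#) (⟨s⟩≈1 : ⟨ _^ s ⟩ ≈ 1#)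
    (a≉0 : ∀ i → ¬ a i ≈ 0#) (a-injective : ∀ i j → a i ≈ a j → i ≡ j)
    (lam : Carrier) (N k e : ℕ) where

    E : ℕ
    E = N ℕ.+ e

    Poly-1 : Poly 0 (λ _ → 1#) 1# 1#
    Poly-1 = poly low-1 top-1
      where
      ⟨^*1⟩ : ∀ w → ⟨ (λ x → x ^ w * 1#) ⟩ ≈ ⟨ _^ w ⟩
      ⟨^*1⟩ w = ⟨⟩-cong (λ x → x ^ w * 1#) (_^ w) (λ i → *-identityʳ _)
      low-1 : ∀ w → w ℕ.+ 0 < s → ⟨ (λ x → x ^ w * 1#) ⟩ ≈ σ₀ * (1# * δ w)
      low-1 zero    _  = trans (⟨^*1⟩ 0) (sym (trans (*-congˡ (*-identityˡ _)) (*-identityʳ _)))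
      low-1 (suc w) w< = trans (⟨^*1⟩ (suc w)) (trans (0<w<s⇒⟨w⟩≈0 (suc w) (s≤s z≤n) (≡.subst (_< s) (ℕₚ.+-identityʳ _) w<))
        (sym (trans (*-congˡ (zeroʳ _)) (zeroʳ _))))
      top-1 : ∀ w → w ℕ.+ 0 ≡ s → ⟨ (λ x → x ^ w * 1#) ⟩ ≈ σ₀ * (1# * δ w) + 1#
      top-1 w w≡ with ≡.trans (≡.sym (ℕₚ.+-identityʳ w)) w≡
      ... | ≡.refl = trans (⟨^*1⟩ s) (trans ⟨s⟩≈1 (sym (trans (+-congʳ (trans (*-congˡ (zeroʳ _)) (zeroʳ _))) (+-identityˡ _))))

    -- The constant polynomial `μ`. The trailing `0#` matches the shape that `Taylor-linear`
    -- produces from `Taylor-δ` and `Taylor-zero`.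
    μδ : Carrier → Seq
    μδ μ j = μ * δ j + 0#

    -- f = Σᵢ cᵢ (aᵢ - x)ᵏ (aᵢ x + λ)ᴱ - σ₀ λᴺ (- x)ᵏ, and f-at b is its
    -- expansion in powers of x - b.
    term : Carrier → Seq
    term x = lin^ k (- 1#) x (lin^ E x lam δ)

    term-at : Carrier → Carrier → Seq
    term-at b x = lin^ k (- 1#) (x - b) (lin^ E x (x * b + lam) δ)

    const-at : Carrier → Seq
    const-at b = lin^ k (- 1#) (- b) (μδ (lam ^ N))

    f : Seq
    f j = - σ₀ * lin^ k (- 1#) 0# (μδ (lam ^ N)) j + ⟨ (λ x → term x j) ⟩

    f-at : Carrier → Seq
    f-at b j = - σ₀ * const-at b j + ⟨ (λ x → term-at b x j) ⟩

    D : ℕ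
    D = k ℕ.+ (E ℕ.+ 1)

    Taylor-f : ∀ b → Taylor b D f (f-at b)
    Taylor-f b = Taylor-linear
      (≡.subst (λ n → Taylor b n (lin^ k (- 1#) 0# (μδ (lam ^ N))) (const-at b)) (≡.trans (ℕₚ.+-comm E _) (≡.trans (ℕₚ.+-assoc k 1 E) (≡.cong (k ℕ.+_) (ℕₚ.+-comm 1 E))))
        (Taylor-raise E (Taylor-lin^ k (solve 1 (λ b → con (+ 0) := :- b :- :- con (+ 1) :* b) refl b) (Taylor-linear (Taylor-δ b) Taylor-zero))))
      (Taylor-sum {b} {D} c {λ i → term (a i)} {λ i → term-at b (a i)}
        (λ i → Taylor-lin^ k (solve 2 (λ x b → x := x :- b :- :- con (+ 1) :* b) refl (a i) b)
        (Taylor-lin^ E (solve 3 (λ x b l → l := x :* b :+ l :- x :* b) refl (a i) b lam) (Taylor-δ b))))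

    Residue : Carrier → Set
    Residue y = y ^ e ≈ 1# ⊎ y ≈ 0#

    module Order (b : Carrier) (M : ℕ) (N+k<s : k ℕ.+ N < s)
      (small : ∀ v → v < M → v < N ⊎ bin E v ≈ 0#)
      (residues : ∀ i → Residue (a i * b + lam) ⊎ (a i ≈ b × M ≤ k)) where

      -- The Taylor coefficient at `b` of `(x X + λ) ^ E` with the exponent `E ∸ v` cut down to
      -- `N ∸ v`. For `v < N` it has degree only `N` in `x`.
      ω : Carrier → Seq
      ω x v = bin E v * (x ^ v * (x * b + lam) ^ (N ∸ v))

      Poly-ω : ∀ v → v < M → ∃ λ ℓ → Poly N (λ x → ω x v) (μδ (lam ^ N) v) ℓ
      Poly-ω v v<M with small v v<M
      ... | inj₂ bin≈0 = 0# , Poly-cong (λ x → sym (trans (*-congʳ bin≈0) (zeroˡ _))) (const v bin≈0) refl Poly-zero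
        where
        const : ∀ v → bin E v ≈ 0# → 0# ≈ μδ (lam ^ N) v
        const zero    bin≈0 = ⊥-elim (1≉0 (trans (sym (bin-0 E)) bin≈0))
        const (suc v) _     = sym (trans (+-identityʳ _) (zeroʳ _))
      ... | inj₁ v<N = _ , Poly-cong
          (λ x → *-congˡ (*-cong (^-congˡ v (trans (+-identityʳ _) (*-identityˡ _)))
            (trans (*-identityʳ _) (^-congˡ (N ∸ v) (+-congʳ (*-comm b x))))))
          (const v) refl
          (≡.subst (λ n → Poly n (λ x → bin E v * ((1# * x + 0#) ^ v * ((b * x + lam) ^ (N ∸ v) * 1#)))
              (bin E v * (0# ^ v * (lam ^ (N ∸ v) * 1#))) (bin E v * (1# ^ v * (b ^ (N ∸ v) * 1#))))
            (≡.trans (≡.cong (v ℕ.+_) (ℕₚ.+-identityʳ (N ∸ v))) (ℕₚ.m+[n∸m]≡n (ℕₚ.<⇒≤ v<N)))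
            (Poly-scale (bin E v) (Poly-mul^ v 1# 0# (Poly-mul^ (N ∸ v) b lam Poly-1))))
        where
        const : ∀ v → bin E v * (0# ^ v * (lam ^ (N ∸ v) * 1#)) ≈ μδ (lam ^ N) v
        const zero    = trans (*-congʳ (bin-0 E))
          (solve 1 (λ x → con (+ 1) :* (con (+ 1) :* (x :* con (+ 1))) := x :* con (+ 1) :+ con (+ 0)) refl (lam ^ N))
        const (suc v) = solve 4 (λ x y z u → x :* (con (+ 0) :* y :* z) := u :* con (+ 0) :+ con (+ 0)) refl
          (bin E (suc v)) (0# ^ v) (lam ^ (N ∸ suc v) * 1#) (lam ^ N)

      Poly-lin^ω : ∀ k J → J < M →
        ∃ λ ℓ → Poly (k ℕ.+ N) (λ x → lin^ k (- 1#) (x - b) (ω x) J) (lin^ k (- 1#) (- b) (μδ (lam ^ N)) J) ℓ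
      Poly-lin^ω zero    J       J<M = Poly-ω J J<M
      Poly-lin^ω (suc k) zero    J<M = _ , Poly-cong (λ x → *-congʳ (+-congʳ (*-identityˡ x))) refl refl
        (Poly-mul 1# (- b) (proj₂ (Poly-lin^ω k zero J<M)))
      Poly-lin^ω (suc k) (suc J) J<M = _ , Poly-cong (λ x → +-congˡ (*-congʳ (+-congʳ (*-identityˡ x)))) refl refl
        (Poly-linear (- 1#) (Poly-raise (proj₂ (Poly-lin^ω k J (ℕₚ.<⇒≤ J<M)))) (Poly-mul 1# (- b) (proj₂ (Poly-lin^ω k (suc J) J<M))))

      -- As `v < N`, a positive exponent `N ∸ v` remains, so that the case `y ≈ 0#` fits in as well.
      residue-power : ∀ {y} v → v < N → Residue y → y ^ (E ∸ v) ≈ y ^ (N ∸ v)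
      residue-power {y} v v<N r = trans (reflexive (≡.cong (y ^_) exponent)) (go r)
        where
        exponent : E ∸ v ≡ suc (N ∸ suc v) ℕ.+ e
        exponent = ≡.trans (ℕₚ.+-∸-comm e (ℕₚ.<⇒≤ v<N)) (≡.cong (ℕ._+ e) (ℕₚ.+-∸-assoc 1 v<N))
        exponent′ : N ∸ v ≡ suc (N ∸ suc v)
        exponent′ = ℕₚ.+-∸-assoc 1 v<N
        go : Residue y → y ^ (suc (N ∸ suc v) ℕ.+ e) ≈ y ^ (N ∸ v)
        go (inj₁ yᵉ≈1) = trans (^-homo-* y (suc (N ∸ suc v)) e) (trans (*-congˡ yᵉ≈1)
          (trans (*-identityʳ _) (reflexive (≡.cong (y ^_) (≡.sym exponent′)))))
        go (inj₂ y≈0)  = trans (0^n≈0 (N ∸ suc v ℕ.+ e) y≈0) (sym (trans (reflexive (≡.cong (y ^_) exponent′)) (0^n≈0 (N ∸ suc v) y≈0)))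

      term≈ω : ∀ i J → J < M → term-at b (a i) J ≈ lin^ k (- 1#) (a i - b) (ω (a i)) J
      term≈ω i J J<M with residues i
      -- On the diagonal the factor `(a i - x) ^ k` has order `k ≥ M` at `b`, so both sides vanish
      -- whatever the other factor is.
      ... | inj₂ (aᵢ≈b , M≤k) = trans (lin^-0-low k (≈⇒-‿≈0 aᵢ≈b) J (ℕₚ.≤-trans J<M M≤k))
                                 (sym (lin^-0-low k (≈⇒-‿≈0 aᵢ≈b) J (ℕₚ.≤-trans J<M M≤k)))
      ... | inj₁ r = lin^-cong-< k M coefficient J J<M
        where
        coefficient : ∀ v → v < M → lin^ E (a i) (a i * b + lam) δ v ≈ ω (a i) v
        coefficient v v<M with small v v<M
        ... | inj₁ v<N   = trans (lin^-coefficient E (a i) _ v) (*-congˡ (*-congˡ (residue-power v v<N r)))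
        ... | inj₂ bin≈0 = trans (lin^-coefficient E (a i) _ v)
          (trans (trans (*-congʳ bin≈0) (zeroˡ _)) (sym (trans (*-congʳ bin≈0) (zeroˡ _))))

      f-at≈0 : ∀ J → J < M → f-at b J ≈ 0#
      f-at≈0 J J<M = begin
        - σ₀ * const-at b J + ⟨ (λ x → term-at b x J) ⟩
          ≈⟨ +-congˡ (⟨⟩-cong (λ x → term-at b x J) (λ x → lin^ k (- 1#) (x - b) (ω x) J) (λ i → term≈ω i J J<M)) ⟩
        - σ₀ * const-at b J + ⟨ (λ x → lin^ k (- 1#) (x - b) (ω x) J) ⟩
          ≈⟨ +-congˡ (Poly-eval (proj₂ (Poly-lin^ω k J J<M)) N+k<s) ⟩
        - σ₀ * const-at b J + σ₀ * const-at b J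
          ≈⟨ solve 2 (λ x y → :- x :* y :+ x :* y := con (+ 0)) refl σ₀ (const-at b J) ⟩
        0# ∎

    μδ-coefficient : ∀ k {α} μ J → ¬ J ≡ k → lin^ k α 0# (μδ μ) J ≈ 0#
    μδ-coefficient zero    μ zero    J≢k = ⊥-elim (J≢k ≡.refl)
    μδ-coefficient zero    μ (suc J) J≢k = trans (+-identityʳ _) (zeroʳ _)
    μδ-coefficient (suc k) μ zero    J≢k = zeroˡ _
    μδ-coefficient (suc k) μ (suc J) J≢k = trans
      (+-cong (trans (*-congˡ (μδ-coefficient k μ J (λ e → J≢k (≡.cong suc e)))) (zeroʳ _)) (zeroˡ _)) (+-identityʳ _)

    leading : ℕ → Carrier
    leading J = bin E J * lam ^ (E ∸ J)

    -- Each choice of `- X` instead of `x` among the `k` factors loses two degrees in `x`: the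
    -- factor `x` itself, and one more because a smaller power of `x X` is then needed to reach
    -- `X ^ J`. Hence the two raises below, and a top coefficient coming from the choice of `x`
    -- throughout.
    Poly-term : ∀ k J → Poly (k ℕ.+ J) (λ x → lin^ k (- 1#) x (lin^ E x lam δ) J) (lin^ k (- 1#) 0# (μδ (lam ^ E)) J) (leading J)
    Poly-term zero J = Poly-cong
      (λ x → trans (*-congˡ (*-cong (^-congˡ J (trans (+-identityʳ _) (*-identityˡ _))) (*-identityʳ _))) (sym (lin^-coefficient E x lam J)))
      (const J)
      (*-congˡ (trans (*-cong (1^n≈1 J) (*-identityʳ _)) (*-identityˡ _)))
      (≡.subst (λ n → Poly n (λ x → bin E J * ((1# * x + 0#) ^ J * (lam ^ (E ∸ J) * 1#)))
          (bin E J * (0# ^ J * (lam ^ (E ∸ J) * 1#))) (bin E J * (1# ^ J * (lam ^ (E ∸ J) * 1#))))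
        (ℕₚ.+-identityʳ J)
        (Poly-scale (bin E J) (Poly-mul^ J 1# 0# (Poly-scale (lam ^ (E ∸ J)) Poly-1))))
      where
      const : ∀ J → bin E J * (0# ^ J * (lam ^ (E ∸ J) * 1#)) ≈ μδ (lam ^ E) J
      const zero    = trans (*-congʳ (bin-0 E))
        (solve 1 (λ x → con (+ 1) :* (con (+ 1) :* (x :* con (+ 1))) := x :* con (+ 1) :+ con (+ 0)) refl (lam ^ E))
      const (suc J) = solve 4 (λ x y z u → x :* (con (+ 0) :* y :* z) := u :* con (+ 0) :+ con (+ 0)) refl
        (bin E (suc J)) (0# ^ J) (lam ^ (E ∸ suc J) * 1#) (lam ^ E)
    Poly-term (suc k) zero = Poly-cong (λ x → *-congʳ (trans (+-identityʳ _) (*-identityˡ x))) refl (*-identityˡ _)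
      (Poly-mul 1# 0# (Poly-term k zero))
    Poly-term (suc k) (suc J) = Poly-cong (λ x → +-congˡ (*-congʳ (trans (+-identityʳ _) (*-identityˡ x)))) refl
      (trans (+-congʳ (zeroʳ _)) (trans (+-identityˡ _) (*-identityˡ _)))
      (Poly-linear (- 1#)
        (≡.subst (λ n → Poly (suc n) (λ x → term′ x) z 0#) (≡.sym (ℕₚ.+-suc k J)) (Poly-raise (Poly-raise (Poly-term k J))))
        (Poly-mul 1# 0# (Poly-term k (suc J))))
      where
      term′ : Carrier → Carrier
      term′ x = lin^ k (- 1#) x (lin^ E x lam δ) J
      z : Carrier
      z = lin^ k (- 1#) 0# (μδ (lam ^ E)) J

    f≈⟨term⟩ : ∀ J → ¬ J ≡ k → f J ≈ ⟨ (λ x → term x J) ⟩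
    f≈⟨term⟩ J J≢k = trans (+-congʳ (trans (*-congˡ (μδ-coefficient k (lam ^ N) J J≢k)) (zeroʳ _))) (+-identityˡ _)

    -- The weights see the constant term in `x`, which is present only for `J = k`. That index is
    -- excluded because `λ ^ E` and the subtracted `λ ^ N` may differ.
    f-low : ∀ J → ¬ J ≡ k → k ℕ.+ J < s → f J ≈ 0#
    f-low J J≢k k+J<s = trans (f≈⟨term⟩ J J≢k) (trans (Poly-eval (Poly-term k J) k+J<s)
      (trans (*-congˡ (μδ-coefficient k (lam ^ E) J J≢k)) (zeroʳ _)))

    f-first : ∀ J → ¬ J ≡ k → k ℕ.+ J ≡ s → f J ≈ leading J
    f-first J J≢k k+J≡s = trans (f≈⟨term⟩ J J≢k) (trans (Poly-eval-top (Poly-term k J) k+J≡s)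
      (trans (+-congʳ (trans (*-congˡ (μδ-coefficient k (lam ^ E) J J≢k)) (zeroʳ _))) (+-identityˡ _)))

    -- When E is a multiple of s, (x y + λ)ᴱ is a polynomial in yˢ.
    f-sparse : k < s → (∀ v → s < v → v < s ℕ.+ s → bin E v ≈ 0#) → f (s ℕ.+ k) ≈ (- 1#) ^ k * leading s
    f-sparse k<s gap = begin
      f (s ℕ.+ k)                                              ≈⟨ f≈⟨term⟩ (s ℕ.+ k) (λ e → ℕₚ.m+1+n≢n s′ (≡.trans (ℕₚ.+-suc s′ k) e)) ⟩
      ⟨ (λ x → term x (s ℕ.+ k)) ⟩                            ≈⟨ ⟨⟩-cong (λ x → term x (s ℕ.+ k)) (λ x → (- 1#) ^ k * leading s * x ^ s + 0#) (λ i → value (a i) k k<s) ⟩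
      ⟨ (λ x → (- 1#) ^ k * leading s * x ^ s + 0#) ⟩          ≈⟨ L-linear c a ((- 1#) ^ k * leading s) (_^ s) (λ _ → 0#) ⟩
      (- 1#) ^ k * leading s * ⟨ _^ s ⟩ + ⟨ (λ _ → 0#) ⟩
        ≈⟨ +-cong (trans (*-congˡ ⟨s⟩≈1) (*-identityʳ _)) ⟨0⟩≈0 ⟩
      (- 1#) ^ k * leading s + 0#                              ≈⟨ +-identityʳ _ ⟩
      (- 1#) ^ k * leading s                                   ∎
      where
      -- Each factor `x - X` raises degrees by at most one, so it shrinks the gap only from below;
      -- degree `s + j` is reached from degree `s` solely by taking `- X` every time.
      gaps : ∀ x j v → s ℕ.+ j < v → v < s ℕ.+ s → lin^ j (- 1#) x (lin^ E x lam δ) v ≈ 0#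
      gaps x zero    v       s<v v<2s = trans (lin^-coefficient E x lam v)
        (trans (*-congʳ (gap v (≡.subst (_< v) (ℕₚ.+-identityʳ s) s<v) v<2s)) (zeroˡ _))
      gaps x (suc j) (suc v) s<v v<2s = trans (+-cong
        (trans (*-congˡ (gaps x j v (≡.subst (_≤ v) (ℕₚ.+-suc s j) (ℕₚ.≤-pred s<v)) (ℕₚ.<⇒≤ v<2s))) (zeroʳ _))
        (trans (*-congˡ (gaps x j (suc v) (ℕₚ.<-trans (ℕₚ.+-monoʳ-< s (ℕₚ.n<1+n j)) s<v) v<2s)) (zeroʳ _))) (+-identityʳ _)
      value : ∀ x j → j < s → lin^ j (- 1#) x (lin^ E x lam δ) (s ℕ.+ j) ≈ (- 1#) ^ j * leading s * x ^ s + 0#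
      value x zero    _   = trans (reflexive (≡.cong (lin^ E x lam δ) (ℕₚ.+-identityʳ s))) (trans (lin^-coefficient E x lam s)
        (solve 3 (λ b y l → b :* (y :* l) := con (+ 1) :* (b :* l) :* y :+ con (+ 0)) refl (bin E s) (x ^ s) (lam ^ (E ∸ s))))
      value x (suc j) j<s = begin
        lin^ (suc j) (- 1#) x h (s ℕ.+ suc j)     ≡⟨ ≡.cong (lin^ (suc j) (- 1#) x h) (ℕₚ.+-suc s j) ⟩
        - 1# * lin^ j (- 1#) x h (s ℕ.+ j) + x * lin^ j (- 1#) x h (suc (s ℕ.+ j))
          ≈⟨ +-cong (*-congˡ (value x j (ℕₚ.<⇒≤ j<s))) (trans (*-congˡ (gaps x j (suc (s ℕ.+ j)) ℕₚ.≤-refl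
               (≡.subst (_< s ℕ.+ s) (ℕₚ.+-suc s j) (ℕₚ.+-monoʳ-< s j<s)))) (zeroʳ _)) ⟩
        - 1# * ((- 1#) ^ j * leading s * x ^ s + 0#) + 0#
          ≈⟨ solve 3 (λ p l y → :- con (+ 1) :* (p :* l :* y :+ con (+ 0)) :+ con (+ 0) := :- con (+ 1) :* p :* l :* y :+ con (+ 0)) refl ((- 1#) ^ j) (leading s) (x ^ s) ⟩
        - 1# * (- 1#) ^ j * leading s * x ^ s + 0# ∎
        where
        h : Seq
        h = lin^ E x lam δ

    -- `M` is the order at each `a j`, `M₀` the order at 0 and `J` the index of a nonzero
    -- coefficient. The bounds below are four choices of these together with `N` and `k`.
    contradiction : ∀ M M₀ J → k ℕ.+ N < s → (∀ v → v < M → v < N ⊎ bin E v ≈ 0#) →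
      (∀ i j → Residue (a i * a j + lam) ⊎ (a i ≈ a j × M ≤ k)) →
      (∀ J → J < M₀ → f J ≈ 0#) → ¬ f J ≈ 0# → D ≤ s ℕ.* M ℕ.+ M₀ → ⊥
    contradiction M M₀ J N+k<s small residues low f≉0 D≤ = f≉0
      (vanishes₀ s M M₀ a a-injective a≉0 f-below
        (λ j → Taylor⇒Div (Taylor-f (a j)) (Order.f-at≈0 (a j) M N+k<s small (λ i → residues i j)))
        (Taylor⇒Div (Taylor-0 f-below) low) D≤ J z≤n)
      where
      f-below : Below D f
      f-below = Taylor⇒Below (Taylor-f 0#)

-- Choices of `N` and `k`

module Bounds {q : ℕ} (F : FiniteField q) (s′ : ℕ)
  (frob : Binomials.FrobeniusExponent F (suc s′))
  (lam : FiniteField.Carrier F) (lam≉0 : ¬ FiniteField._≈_ F lam (FiniteField.0# F))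
  (a : Fin (suc s′) → FiniteField.Carrier F) (distinct : DistinctNonzero F (suc s′) a)
  (τ l e : ℕ) (e≡ : e ≡ τ ℕ.* suc s′ ℕ.+ suc l) (l<s : suc l < suc s′) where
  open FiniteField F hiding (zero)
  open Field F
  open Sequences F
  open Binomials F
  open Functionals F
  open Lucas s′ frob
  open Relation.Binary.Reasoning.Setoid setoid

  s : ℕ
  s = suc s′

  Residue : Carrier → Set
  Residue y = y ^ e ≈ 1# ⊎ y ≈ 0#

  module W where
    solution : ∃ λ c → (∀ w → 0 < w → w < s → L c a (_^ w) ≈ 0#) × L c a (_^ s) ≈ 1#
    solution = weights s′ a (proj₁ distinct) (proj₂ distinct)
    c : Fin s → Carrier
    c = proj₁ solution
    open Stepanov F s′ c a public
    open Construction (proj₁ (proj₂ solution)) (proj₂ (proj₂ solution)) (proj₁ distinct) (proj₂ distinct) lam public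

  off-diagonal : (∀ i j → ¬ i ≡ j → Residue (a i * a j + lam)) → ∀ k i j →
    Residue (a i * a j + lam) ⊎ (a i ≈ a j × k ≤ k)
  off-diagonal res k i j with i Finₚ.≟ j
  ... | yes ≡.refl = inj₂ (refl , ℕₚ.≤-refl)
  ... | no i≢j     = inj₁ (res i j i≢j)

  leading≉0 : ∀ {x} n → ¬ x ≈ 0# → ¬ x * lam ^ n ≈ 0#
  leading≉0 n x≉0 = *-≉0 x≉0 (^-≉0 n lam≉0)

  -- With `N = s - 1` one gets `E = (τ + 1) s + l` with `l < s - 1`, so the binomial coefficient at
  -- `v = s - 1` vanishes and the order at each point is `s` rather than `N`. The coefficient at
  -- `J = s` is `τ + 1` times a power of `λ`.
  all-residues : ¬ ι (suc τ) ≈ 0# → s ℕ.+ e ≤ s ℕ.* s → ¬ (∀ i j → Residue (a i * a j + lam))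
  all-residues T≉0 s+e≤ res = W.contradiction s′ 0 e s 0 s ℕₚ.≤-refl small (λ i j → inj₁ (res i j)) (λ _ ())
    (λ f≈0 → leading≉0 (E ∸ s) bin≉0 (trans (sym (W.f-first s′ 0 e s (λ ()) ≡.refl)) f≈0))
    (≡.subst₂ _≤_ (≡.sym (ℕₚ.+-comm E 1)) (≡.sym (ℕₚ.+-identityʳ (s ℕ.* s))) s+e≤)
    where
    E : ℕ
    E = s′ ℕ.+ e
    E≡ : E ≡ suc τ ℕ.* s ℕ.+ l
    E≡ = ≡.trans (≡.cong (s′ ℕ.+_) e≡) (solveℕ 3 (λ x t l → x ⊕ (t ⊕ (# 1 ⊕ l))
      ⊜ # 1 ⊕ x ⊕ t ⊕ l) ≡.refl s′ (τ ℕ.* s) l)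
    small : ∀ v → v < s → v < s′ ⊎ bin E v ≈ 0#
    small v v<s with v ℕ.<? s′
    ... | yes v<s′ = inj₁ v<s′
    ... | no v≮s′  = inj₂ (begin
      bin E v                       ≡⟨ ≡.cong (λ n → bin n v) E≡ ⟩
      bin (suc τ ℕ.* s ℕ.+ l) v     ≈⟨ lucas-low (suc τ) l v v<s ⟩
      bin l v                       ≈⟨ bin-above {l} (ℕₚ.≤-trans (ℕₚ.≤-pred l<s) (ℕₚ.≮⇒≥ v≮s′)) ⟩
      0#                            ∎)
    bin≉0 : ¬ bin E s ≈ 0#
    bin≉0 bin≈0 = T≉0 (begin
      ι (suc τ)                     ≈⟨ trans (+-congʳ (bin-above {l} (ℕₚ.<⇒≤ l<s))) (trans (+-identityˡ _) (trans (*-congˡ (bin-0 l)) (*-identityʳ _))) ⟨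
      bin l s + ι (suc τ) * bin l 0 ≈⟨ lucas-high (suc τ) l 0 (s≤s z≤n) ⟨
      bin (suc τ ℕ.* s ℕ.+ l) s     ≡⟨ ≡.cong (λ n → bin n s) E≡ ⟨
      bin E s                       ≈⟨ bin≈0 ⟩
      0#                            ∎)

  module OffDiagonal (res : ∀ i j → ¬ i ≡ j → Residue (a i * a j + lam)) where

    -- `N` is chosen so that `J = N + suc l`, the remainder of `E` modulo `s`, satisfies
    -- `k + J = s`; then `bin E J` equals `bin J J = 1`. The degree bound is at most
    -- `(τ + 1) (s + 1)`, matched by order `k = τ + 1` at the `s` points and at 0.
    small-l : ∀ N → suc τ ≤ N → ¬ N ℕ.+ suc l ℕ.+ suc τ ≡ s
    small-l N τ<N N≡ = W.contradiction N k e k k J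
      (ℕₚ.≤-trans (s≤s (ℕₚ.m≤n+m _ l)) (ℕₚ.≤-reflexive (≡.trans (sumA τ N l) N≡)))
      (λ v v<k → inj₁ (ℕₚ.≤-trans v<k τ<N)) (off-diagonal res k)
      (λ j j<k → W.f-low N k e j (λ { ≡.refl → ℕₚ.<-irrefl ≡.refl j<k }) (below j j<k))
      (λ f≈0 → leading≉0 (E ∸ J) bin≉0 (trans (sym (W.f-first N k e J J≢k (≡.trans (ℕₚ.+-comm k J) N≡))) f≈0))
      (ℕₚ.≤-trans (ℕₚ.≤-reflexive (≡.trans (≡.cong (λ x → k ℕ.+ (N ℕ.+ x ℕ.+ 1)) e≡) (sumB τ N l (τ ℕ.* s))))
      (ℕₚ.≤-trans (ℕₚ.+-monoʳ-≤ (k ℕ.+ τ ℕ.* s) N+l<s) (ℕₚ.≤-reflexive (sumC τ s))))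
      where
      k J E : ℕ
      k = suc τ
      J = N ℕ.+ suc l
      E = N ℕ.+ e
      sumA : ∀ t n l → suc (l ℕ.+ (suc t ℕ.+ n)) ≡ n ℕ.+ suc l ℕ.+ suc t
      sumA = solveℕ 3 (λ t n l → # 1 ⊕ (l ⊕ (# 1 ⊕ t ⊕ n)) ⊜ n ⊕ (# 1 ⊕ l) ⊕ (# 1 ⊕ t)) ≡.refl
      sumB : ∀ t n l x → suc t ℕ.+ (n ℕ.+ (x ℕ.+ suc l) ℕ.+ 1) ≡ suc t ℕ.+ x ℕ.+ (suc (n ℕ.+ suc l))
      sumB = solveℕ 4 (λ t n l x → # 1 ⊕ t ⊕ (n ⊕ (x ⊕ (# 1 ⊕ l)) ⊕ # 1) ⊜ # 1 ⊕ t ⊕ x ⊕ (# 1 ⊕ (n ⊕ (# 1 ⊕ l)))) ≡.refl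
      sumC : ∀ t s → suc t ℕ.+ t ℕ.* s ℕ.+ s ≡ s ℕ.* suc t ℕ.+ suc t
      sumC = solveℕ 2 (λ t s → # 1 ⊕ t ⊕ t ⊗ s ⊕ s ⊜ s ⊗ (# 1 ⊕ t) ⊕ (# 1 ⊕ t)) ≡.refl
      N+l<s : suc J ≤ s
      N+l<s = ℕₚ.≤-trans (≡.subst (suc J ≤_) (ℕₚ.+-comm k J) (ℕₚ.+-monoˡ-≤ J (s≤s (z≤n {τ})))) (ℕₚ.≤-reflexive N≡)
      k<J : k < J
      k<J = ℕₚ.≤-trans (s≤s τ<N) (≡.subst (suc N ≤_) (≡.sym (ℕₚ.+-suc N l)) (s≤s (ℕₚ.m≤m+n N l)))
      J≢k : ¬ J ≡ k
      J≢k J≡k = ℕₚ.<-irrefl (≡.sym J≡k) k<J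
      below : ∀ j → j < k → k ℕ.+ j < s
      below j j<k = ℕₚ.≤-trans (ℕₚ.+-monoʳ-< k (ℕₚ.<-trans j<k k<J)) (ℕₚ.≤-reflexive (≡.trans (ℕₚ.+-comm k J) N≡))
      E≡ : E ≡ τ ℕ.* s ℕ.+ J
      E≡ = ≡.trans (≡.cong (N ℕ.+_) e≡) (≡.trans (≡.sym (ℕₚ.+-assoc N _ _)) (≡.trans (≡.cong (ℕ._+ suc l) (ℕₚ.+-comm N (τ ℕ.* s))) (ℕₚ.+-assoc (τ ℕ.* s) N (suc l))))
      bin≉0 : ¬ bin E J ≈ 0#
      bin≉0 bin≈0 = 1≉0 (begin
        1#                        ≈⟨ bin-n J ⟨
        bin J J                   ≈⟨ lucas-low τ J J N+l<s ⟨
        bin (τ ℕ.* s ℕ.+ J) J     ≡⟨ ≡.cong (λ n → bin n J) E≡ ⟨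
        bin E J                   ≈⟨ bin≈0 ⟩
        0#                        ∎)

    -- `N` completes `e` to `E = (τ + 1) s`, and `k = l` is the largest value with `N + k < s`. The
    -- degree bound `(l + 1) + (τ + 1) s` is at most `(τ + 2) s ≤ l s`, so the order `l` at the
    -- points `a j` suffices.
    large-l : ¬ ι (suc τ) ≈ 0# → ¬ suc (suc τ) ≤ l
    large-l T≉0 τ+2≤l = W.contradiction N l e l 0 (s ℕ.+ l)
      (ℕₚ.≤-reflexive (≡.trans (≡.cong suc (ℕₚ.+-comm l N)) (≡.trans (≡.sym (ℕₚ.+-suc N l)) N+l≡s)))
      small (off-diagonal res l) (λ _ ())
      (λ f≈0 → *-≉0 (^-≉0 l -1≉0) (leading≉0 (E ∸ s) bin≉0) (trans (sym (W.f-sparse N l e (ℕₚ.<⇒≤ l<s) gap)) f≈0))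
      (ℕₚ.≤-trans (ℕₚ.≤-reflexive (≡.trans (≡.cong (λ x → l ℕ.+ (x ℕ.+ 1)) E≡) (sumA l (suc τ ℕ.* s))))
      (ℕₚ.≤-trans (ℕₚ.+-monoˡ-≤ (suc τ ℕ.* s) (ℕₚ.<⇒≤ l<s))
      (ℕₚ.≤-trans (ℕₚ.*-monoˡ-≤ s τ+2≤l) (ℕₚ.≤-reflexive (≡.trans (ℕₚ.*-comm l s) (≡.sym (ℕₚ.+-identityʳ _)))))))
      where
      N E : ℕ
      N = s ∸ suc l
      E = N ℕ.+ e
      sumA : ∀ l x → l ℕ.+ (x ℕ.+ 0 ℕ.+ 1) ≡ suc l ℕ.+ x
      sumA = solveℕ 2 (λ l x → l ⊕ (x ⊕ # 0 ⊕ # 1) ⊜ # 1 ⊕ l ⊕ x) ≡.refl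
      N+l≡s : N ℕ.+ suc l ≡ s
      N+l≡s = ℕₚ.m∸n+n≡m (ℕₚ.<⇒≤ l<s)
      E≡ : E ≡ suc τ ℕ.* s ℕ.+ 0
      E≡ = ≡.trans (≡.cong (N ℕ.+_) e≡) (≡.trans (≡.cong (N ℕ.+_) (ℕₚ.+-comm _ (suc l)))
        (≡.trans (≡.sym (ℕₚ.+-assoc N (suc l) _)) (≡.trans (≡.cong (ℕ._+ τ ℕ.* s) N+l≡s) (≡.sym (ℕₚ.+-identityʳ _)))))
      -1≉0 : ¬ - 1# ≈ 0#
      -1≉0 e = 1≉0 (trans (solve 0 (con (+ 1) := :- (:- con (+ 1))) refl) (trans (-‿cong e) (solve 0 (:- con (+ 0) := con (+ 0)) refl)))
      small : ∀ v → v < l → v < N ⊎ bin E v ≈ 0#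
      small zero    _   = inj₁ (ℕₚ.m<n⇒0<n∸m l<s)
      small (suc v) v<l = inj₂ (trans (reflexive (≡.cong (λ n → bin n (suc v)) E≡)) (lucas-low (suc τ) 0 (suc v) (ℕₚ.<-trans v<l (ℕₚ.<⇒≤ l<s))))
      gap : ∀ v → s < v → v < s ℕ.+ s → bin E v ≈ 0#
      gap v s<v v<2s with ℕₚ.m≤n⇒∃[o]m+o≡n s<v
      ... | u , ≡.refl = begin
        bin E (suc (s ℕ.+ u))                        ≡⟨ ≡.cong₂ bin E≡ (≡.cong suc (ℕₚ.+-comm s u)) ⟩
        bin (suc τ ℕ.* s ℕ.+ 0) (suc u ℕ.+ s)        ≈⟨ lucas-high (suc τ) 0 (suc u) (ℕₚ.+-cancelˡ-< s _ _ (≡.subst (_< s ℕ.+ s) (≡.sym (ℕₚ.+-suc s u)) v<2s)) ⟩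
        0# + ι (suc τ) * 0#                          ≈⟨ trans (+-identityˡ _) (zeroʳ _) ⟩
        0#                                           ∎
      bin≉0 : ¬ bin E s ≈ 0#
      bin≉0 bin≈0 = T≉0 (begin
        ι (suc τ)                      ≈⟨ trans (+-identityˡ _) (*-identityʳ _) ⟨
        0# + ι (suc τ) * 1#            ≈⟨ lucas-high (suc τ) 0 0 (s≤s z≤n) ⟨
        bin (suc τ ℕ.* s ℕ.+ 0) s      ≡⟨ ≡.cong (λ n → bin n s) E≡ ⟨
        bin E s                        ≈⟨ bin≈0 ⟩
        0#                             ∎)

    -- The `N` of `small-l` would be `g`, one short of `k = g + 1`. Raising it to `k` puts `J = 2 g`
    -- one below the remainder of `E`, and the binomial coefficient becomes `2 g + 1`. It is nonzero
    -- because `3 (2 g + 1) = 2 s + 1`, which is 1 in the field.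
    third : ι s ≈ 0# → ∀ g → 2 ≤ g → τ ≡ g → suc l ≡ g → ¬ s ≡ suc (3 ℕ.* g)
    third ιs≈0 g 2≤g τ≡g l≡g s≡ = W.contradiction k k e k k J
      (≡.subst (k ℕ.+ k <_) (≡.sym s≡) (≡.subst₂ _≤_ (sumA g) (sumB g) (ℕₚ.+-monoʳ-≤ (suc (g ℕ.+ g)) 2≤g)))
      (λ v v<k → inj₁ v<k) (off-diagonal res k)
      (λ j j<k → W.f-low k k e j (λ { ≡.refl → ℕₚ.<-irrefl ≡.refl j<k }) (below j j<k))
      (λ f≈0 → leading≉0 (E ∸ J) bin≉0 (trans (sym (W.f-first k k e J J≢k k+J≡s)) f≈0))
      (≡.subst₂ _≤_ (≡.sym (≡.trans (≡.cong (λ x → k ℕ.+ (k ℕ.+ x ℕ.+ 1)) e≡g) (sumD g (g ℕ.* s))))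
        (≡.sym (≡.trans (sumE g s) (≡.cong (λ x → g ℕ.* s ℕ.+ (x ℕ.+ suc g)) s≡)))
        (ℕₚ.+-monoʳ-≤ (g ℕ.* s) (≡.subst₂ _≤_ (sumF g) (sumG g) (ℕₚ.+-monoʳ-≤ (2 ℕ.+ 3 ℕ.* g) (ℕₚ.≤-trans (s≤s z≤n) 2≤g)))))
      where
      k J E : ℕ
      k = suc g
      J = 2 ℕ.* g
      E = k ℕ.+ e
      e≡g : e ≡ g ℕ.* s ℕ.+ g
      e≡g = ≡.trans e≡ (≡.cong₂ (λ t x → t ℕ.* s ℕ.+ x) τ≡g l≡g)
      sumA : ∀ g → suc (g ℕ.+ g) ℕ.+ 2 ≡ suc (suc g ℕ.+ suc g)
      sumA = solveℕ 1 (λ g → # 1 ⊕ (g ⊕ g) ⊕ # 2 ⊜ # 1 ⊕ (# 1 ⊕ g ⊕ (# 1 ⊕ g))) ≡.refl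
      sumB : ∀ g → suc (g ℕ.+ g) ℕ.+ g ≡ suc (3 ℕ.* g)
      sumB = solveℕ 1 (λ g → # 1 ⊕ (g ⊕ g) ⊕ g ⊜ # 1 ⊕ # 3 ⊗ g) ≡.refl
      sumC : ∀ g → suc g ℕ.+ 2 ℕ.* g ≡ suc (3 ℕ.* g)
      sumC = solveℕ 1 (λ g → # 1 ⊕ g ⊕ # 2 ⊗ g ⊜ # 1 ⊕ # 3 ⊗ g) ≡.refl
      sumD : ∀ g x → suc g ℕ.+ (suc g ℕ.+ (x ℕ.+ g) ℕ.+ 1) ≡ x ℕ.+ (3 ℕ.+ 3 ℕ.* g)
      sumD = solveℕ 2 (λ g x → # 1 ⊕ g ⊕ (# 1 ⊕ g ⊕ (x ⊕ g) ⊕ # 1) ⊜ x ⊕ (# 3 ⊕ # 3 ⊗ g)) ≡.refl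
      sumE : ∀ g s → s ℕ.* suc g ℕ.+ suc g ≡ g ℕ.* s ℕ.+ (s ℕ.+ suc g)
      sumE = solveℕ 2 (λ g s → s ⊗ (# 1 ⊕ g) ⊕ (# 1 ⊕ g) ⊜ g ⊗ s ⊕ (s ⊕ (# 1 ⊕ g))) ≡.refl
      sumF : ∀ g → 2 ℕ.+ 3 ℕ.* g ℕ.+ 1 ≡ 3 ℕ.+ 3 ℕ.* g
      sumF = solveℕ 1 (λ g → # 2 ⊕ # 3 ⊗ g ⊕ # 1 ⊜ # 3 ⊕ # 3 ⊗ g) ≡.refl
      sumG : ∀ g → 2 ℕ.+ 3 ℕ.* g ℕ.+ g ≡ suc (3 ℕ.* g) ℕ.+ suc g
      sumG = solveℕ 1 (λ g → # 2 ⊕ # 3 ⊗ g ⊕ g ⊜ # 1 ⊕ # 3 ⊗ g ⊕ (# 1 ⊕ g)) ≡.refl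
      k+J≡s : k ℕ.+ J ≡ s
      k+J≡s = ≡.trans (sumC g) (≡.sym s≡)
      k≤J : k ≤ J
      k≤J = ≡.subst₂ _≤_ (ℕₚ.+-comm g 1) (≡.cong (g ℕ.+_) (≡.sym (ℕₚ.+-identityʳ g))) (ℕₚ.+-monoʳ-≤ g (ℕₚ.≤-trans (s≤s z≤n) 2≤g))
      J≢k : ¬ J ≡ k
      J≢k J≡k = ℕₚ.<-irrefl ≡.refl (≡.subst (2 ≤_) (ℕₚ.+-cancelˡ-≡ g g 1
        (≡.trans (≡.cong (g ℕ.+_) (≡.sym (ℕₚ.+-identityʳ g))) (≡.trans J≡k (ℕₚ.+-comm 1 g)))) 2≤g)
      below : ∀ j → j < k → k ℕ.+ j < s
      below j j<k = ℕₚ.≤-trans (ℕₚ.+-monoʳ-< k (ℕₚ.≤-trans j<k k≤J)) (ℕₚ.≤-reflexive k+J≡s)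
      E≡ : E ≡ g ℕ.* s ℕ.+ suc J
      E≡ = ≡.trans (≡.cong (k ℕ.+_) e≡g) (solveℕ 2 (λ g x → # 1 ⊕ g ⊕ (x ⊕ g) ⊜ x ⊕ (# 1 ⊕ # 2 ⊗ g)) ≡.refl g (g ℕ.* s))
      J<s : J < s
      J<s = ≡.subst (J <_) k+J≡s (s≤s (ℕₚ.m≤n+m J g))
      bin≉0 : ¬ bin E J ≈ 0#
      bin≉0 bin≈0 = 1≉0 (begin
        1#                              ≈⟨ +-identityʳ _ ⟨
        1# + 0#                         ≈⟨ +-congˡ (trans (ι-* 2 s) (trans (*-congˡ ιs≈0) (zeroʳ _))) ⟨
        ι (suc (2 ℕ.* s))               ≡⟨ ≡.cong ι (≡.trans (≡.cong (λ x → suc (2 ℕ.* x)) s≡) (sumH g)) ⟩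
        ι (3 ℕ.* suc J)                 ≈⟨ ι-* 3 (suc J) ⟩
        ι 3 * ι (suc J)                 ≈⟨ *-congˡ (bin-suc-n J) ⟨
        ι 3 * bin (suc J) J             ≈⟨ *-congˡ (lucas-low g (suc J) J J<s) ⟨
        ι 3 * bin (g ℕ.* s ℕ.+ suc J) J ≡⟨ ≡.cong (λ n → ι 3 * bin n J) E≡ ⟨
        ι 3 * bin E J                   ≈⟨ trans (*-congˡ bin≈0) (zeroʳ _) ⟩
        0#                              ∎)
        where
        sumH : ∀ g → suc (2 ℕ.* suc (3 ℕ.* g)) ≡ 3 ℕ.* suc (2 ℕ.* g)
        sumH = solveℕ 1 (λ g → # 1 ⊕ # 2 ⊗ (# 1 ⊕ # 3 ⊗ g) ⊜ # 3 ⊗ (# 1 ⊕ # 2 ⊗ g)) ≡.refl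

-- The exceptional case q = 25, d = 3

module Roots {q : ℕ} (F : FiniteField q) where
  open FiniteField F hiding (zero)
  open Field F
  open Functionals F
  open Relation.Binary.Reasoning.Setoid setoid

  evaluate : ℕ → (ℕ → Carrier) → Carrier → Carrier
  evaluate zero    v x = 0#
  evaluate (suc n) v x = v n * x ^ n + evaluate n v x

  -- The divided-difference functional at the `n` points kills all powers below the top one and so
  -- returns the leading coefficient, which is therefore 0. Dropping one point then handles the
  -- rest.
  coefficients-vanish : ∀ n v (b : Fin n → Carrier) → (∀ i j → b i ≈ b j → i ≡ j) →
    (∀ i → evaluate n v (b i) ≈ 0#) → ∀ w → w < n → v w ≈ 0#
  coefficients-vanish (suc n) v b inj root = go
    where
    c : Fin (suc n) → Carrier
    c = proj₁ (dividedDifference n b inj)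
    low : ∀ w → w < n → L c b (_^ w) ≈ 0#
    low = proj₁ (proj₂ (dividedDifference n b inj))
    top : L c b (_^ n) ≈ 1#
    top = proj₂ (proj₂ (dividedDifference n b inj))
    lower : ∀ m → m ≤ n → L c b (evaluate m v) ≈ 0#
    lower zero    _   = L-zero c b
    lower (suc m) m<n = trans (L-linear c b (v m) (_^ m) (evaluate m v))
      (trans (+-cong (trans (*-congˡ (low m m<n)) (zeroʳ _)) (lower m (ℕₚ.<⇒≤ m<n))) (+-identityʳ _))
    last : v n ≈ 0#
    last = begin
      v n                                                  ≈⟨ *-identityʳ _ ⟨
      v n * 1#                                             ≈⟨ *-congˡ top ⟨
      v n * L c b (_^ n)                                   ≈⟨ +-identityʳ _ ⟨
      v n * L c b (_^ n) + 0#                              ≈⟨ +-congˡ (lower n ℕₚ.≤-refl) ⟨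
      v n * L c b (_^ n) + L c b (evaluate n v)            ≈⟨ L-linear c b (v n) (_^ n) (evaluate n v) ⟨
      L c b (evaluate (suc n) v)                           ≈⟨ L-cong c b (evaluate (suc n) v) (λ _ → 0#) root ⟩
      L c b (λ _ → 0#)                                     ≈⟨ L-zero c b ⟩
      0#                                                   ∎
    go : ∀ w → w < suc n → v w ≈ 0#
    go w (s≤s w≤n) with w ℕ.≟ n
    ... | yes ≡.refl = last
    ... | no w≢n     = coefficients-vanish n v (b ∘ suc) (λ i j e → Finₚ.suc-injective (inj _ _ e))
      (λ i → trans (sym (trans (+-congʳ (trans (*-congʳ last) (zeroˡ _))) (+-identityˡ _))) (root (suc i)))
      w (ℕₚ.≤∧≢⇒< w≤n w≢n)

module Order25 {q : ℕ} (F : FiniteField q) where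
  open FiniteField F hiding (zero)
  open Field F
  open Functionals F
  open Roots F
  open Relation.Binary.Reasoning.Setoid setoid

  -- The choice `N = k = 2` fails by one: `f` has 13 coefficients, while order 2 at five points and
  -- at 0 accounts for 12. The weights are therefore applied to a different form, built from the map
  -- `x ↦ x ^ 5`.
  module Quintuple (ι5≈0 : ι 5 ≈ 0#) (lam : Carrier) (lam≉0 : ¬ lam ≈ 0#)
    (a : Fin 5 → Carrier) (distinct : DistinctNonzero F 5 a)
    (res : ∀ i j → ¬ i ≡ j → (a i * a j + lam) ^ 8 ≈ 1# ⊎ a i * a j + lam ≈ 0#) where

    5x≈0 : ∀ x → (1# + 1# + 1# + 1# + 1#) * x ≈ 0#
    5x≈0 x = trans (*-congʳ (trans
      (solve 0 (con (+ 1) :+ con (+ 1) :+ con (+ 1) :+ con (+ 1) :+ con (+ 1) :=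
        con (+ 1) :+ (con (+ 1) :+ (con (+ 1) :+ (con (+ 1) :+ (con (+ 1) :+ con (+ 0)))))) refl) ι5≈0)) (zeroˡ x)

    2x≈0⇒x≈0 : ∀ {x} → (1# + 1#) * x ≈ 0# → x ≈ 0#
    2x≈0⇒x≈0 {x} 2x≈0 = begin
      x  ≈⟨ solve 1 (λ x → x := con (+ 5) :* x :- con (+ 2) :* (con (+ 2) :* x)) refl x ⟩
      (1# + 1# + 1# + 1# + 1#) * x - (1# + 1#) * ((1# + 1#) * x)  ≈⟨ +-cong (5x≈0 x) (-‿cong (*-congˡ 2x≈0)) ⟩
      0# - (1# + 1#) * 0#  ≈⟨ solve 0 (con (+ 0) :- con (+ 2) :* con (+ 0) := con (+ 0)) refl ⟩
      0# ∎

    frobenius-- : ∀ x y → (x - y) ^ 5 ≈ x ^ 5 - y ^ 5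
    frobenius-- x y = begin
      (x - y) ^ 5
        ≈⟨ solve 2 (λ x y → (x :- y) :^ 5 := x :^ 5 :- y :^ 5 :+
             con (+ 5) :* (:- (x :^ 4 :* y) :+ con (+ 2) :* (x :^ 3 :* y :^ 2) :- con (+ 2) :* (x :^ 2 :* y :^ 3) :+ x :* y :^ 4)) refl x y ⟩
      x ^ 5 - y ^ 5 + (1# + 1# + 1# + 1# + 1#) * (- (x ^ 4 * y) + (1# + 1#) * (x ^ 3 * y ^ 2) - (1# + 1#) * (x ^ 2 * y ^ 3) + x * y ^ 4)
        ≈⟨ trans (+-congˡ (5x≈0 _)) (+-identityʳ _) ⟩
      x ^ 5 - y ^ 5 ∎

    frobenius-+ : ∀ x y → (x + y) ^ 5 ≈ x ^ 5 + y ^ 5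
    frobenius-+ x y = trans (solve 2 (λ x y → (x :+ y) :^ 5 := (x :- :- y) :^ 5) refl x y)
      (trans (frobenius-- x (- y)) (solve 2 (λ x y → x :^ 5 :- (:- y) :^ 5 := x :^ 5 :+ y :^ 5) refl x y))

    -- Here `y ^ 10 = y ^ 8 * y ^ 2 = y ^ 2` for `y = x * b + lam`, and the fifth power is additive.
    conj-square : ∀ {x b} → (x * b + lam) ^ 8 ≈ 1# ⊎ x * b + lam ≈ 0# →
      (x ^ 5 * b ^ 5 + lam ^ 5) ^ 2 ≈ (x * b + lam) ^ 2
    conj-square {x} {b} r = begin
      (x ^ 5 * b ^ 5 + lam ^ 5) ^ 2   ≈⟨ ^-congˡ 2 (+-congʳ (^-distrib-* x b 5)) ⟨
      ((x * b) ^ 5 + lam ^ 5) ^ 2     ≈⟨ ^-congˡ 2 (frobenius-+ (x * b) lam) ⟨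
      ((x * b + lam) ^ 5) ^ 2         ≈⟨ ^-assocʳ (x * b + lam) 5 2 ⟩
      (x * b + lam) ^ 10              ≈⟨ ^-homo-* (x * b + lam) 8 2 ⟩
      (x * b + lam) ^ 8 * (x * b + lam) ^ 2  ≈⟨ go r ⟩
      (x * b + lam) ^ 2               ∎
      where
      go : (x * b + lam) ^ 8 ≈ 1# ⊎ x * b + lam ≈ 0# → (x * b + lam) ^ 8 * (x * b + lam) ^ 2 ≈ (x * b + lam) ^ 2
      go (inj₁ y⁸≈1) = trans (*-congʳ y⁸≈1) (*-identityˡ _)
      go (inj₂ y≈0)  = trans (*-congˡ (0^n≈0 1 y≈0)) (trans (zeroʳ _) (sym (0^n≈0 1 y≈0)))

    X : Fin 5 → Carrier
    X i = a i ^ 5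

    X-injective : ∀ i j → X i ≈ X j → i ≡ j
    X-injective i j Xi≈Xj = proj₂ distinct i j (-‿≈0 (x^n≈0⇒x≈0 5 (trans (frobenius-- (a i) (a j)) (≈⇒-‿≈0 Xi≈Xj))))

    X≉0 : ∀ i → ¬ X i ≈ 0#
    X≉0 i = ^-≉0 5 (proj₁ distinct i)

    solution : ∃ λ c → (∀ w → 0 < w → w < 5 → L c a (_^ w) ≈ 0#) × L c a (_^ 5) ≈ 1#
    solution = weights 4 a (proj₁ distinct) (proj₂ distinct)

    c : Fin 5 → Carrier
    c = proj₁ solution

    σ : ℕ → Carrier
    σ w = L c a (_^ w)

    σ≈0 : ∀ w → w < 4 → σ (suc w) ≈ 0#
    σ≈0 w w<4 = proj₁ (proj₂ solution) (suc w) (s≤s z≤n) (s≤s w<4)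

    σ5≈1 : σ 5 ≈ 1#
    σ5≈1 = proj₂ (proj₂ solution)

    sparse : List (Carrier × ℕ) → Carrier → Carrier
    sparse []             x = 0#
    sparse ((v , w) ∷ ts) x = v * x ^ w + sparse ts x

    moments : List (Carrier × ℕ) → Carrier
    moments []             = 0#
    moments ((v , w) ∷ ts) = v * σ w + moments ts

    moments≈0 : ∀ ts → (∀ i → sparse ts (a i) ≈ 0#) → moments ts ≈ 0#
    moments≈0 ts root = trans (sym (expand ts)) (trans (L-cong c a (sparse ts) (λ _ → 0#) root) (L-zero c a))
      where
      expand : ∀ ts → L c a (sparse ts) ≈ moments ts
      expand []             = L-zero c a
      expand ((v , w) ∷ ts) = trans (L-linear c a v (_^ w) (sparse ts)) (+-congˡ (expand ts))

    Λ κ 2# : Carrier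
    Λ = lam ^ 5
    κ = Λ ^ 2 - lam ^ 2
    2# = 1# + 1#

    K : Carrier
    K = κ * σ 0

    2Λ≉0 : ¬ 2# * Λ ≈ 0#
    2Λ≉0 e = ^-≉0 5 lam≉0 (2x≈0⇒x≈0 e)

    -- The difference of the two squares in `conj-square` times `x - b`; the extra factor makes it
    -- vanish at `x = b` too. Listing coefficients with exponents lets the weights turn each power
    -- into a moment, most of which are 0 or 1.
    conj-form : Carrier → List (Carrier × ℕ)
    conj-form b = (b ^ 10 , 11) ∷ (- (b ^ 11) , 10) ∷ (2# * (Λ * b ^ 5) , 6) ∷ (- (2# * (Λ * b ^ 6)) , 5) ∷
      (- (b ^ 2) , 3) ∷ (b ^ 3 - 2# * (lam * b) , 2) ∷ (κ + 2# * (lam * b ^ 2) , 1) ∷ (- (κ * b) , 0) ∷ []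

    conj-form-x : Carrier → List (Carrier × ℕ)
    conj-form-x b = (b ^ 10 , 12) ∷ (- (b ^ 11) , 11) ∷ (2# * (Λ * b ^ 5) , 7) ∷ (- (2# * (Λ * b ^ 6)) , 6) ∷
      (- (b ^ 2) , 4) ∷ (b ^ 3 - 2# * (lam * b) , 3) ∷ (κ + 2# * (lam * b ^ 2) , 2) ∷ (- (κ * b) , 1) ∷ []

    sparse-conj-form : ∀ b x → sparse (conj-form b) x ≈ ((x ^ 5 * b ^ 5 + Λ) ^ 2 - (x * b + lam) ^ 2) * (x - b)
    sparse-conj-form b x = solve 4 (λ b x Λ l → let κ = Λ :^ 2 :- l :^ 2; two = con (+ 2) in
      b :^ 10 :* x :^ 11 :+ (:- (b :^ 11) :* x :^ 10 :+ (two :* (Λ :* b :^ 5) :* x :^ 6 :+ (:- (two :* (Λ :* b :^ 6)) :* x :^ 5 :+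
      (:- (b :^ 2) :* x :^ 3 :+ ((b :^ 3 :- two :* (l :* b)) :* x :^ 2 :+ ((κ :+ two :* (l :* b :^ 2)) :* x :^ 1 :+ (:- (κ :* b) :* x :^ 0 :+ con (+ 0))))))))
      := ((x :^ 5 :* b :^ 5 :+ Λ) :^ 2 :- (x :* b :+ l) :^ 2) :* (x :- b)) refl b x Λ lam

    sparse-conj-form-x : ∀ b x → sparse (conj-form-x b) x ≈ x * sparse (conj-form b) x
    sparse-conj-form-x b x = solve 4 (λ b x Λ l → let κ = Λ :^ 2 :- l :^ 2; two = con (+ 2) in
      b :^ 10 :* x :^ 12 :+ (:- (b :^ 11) :* x :^ 11 :+ (two :* (Λ :* b :^ 5) :* x :^ 7 :+ (:- (two :* (Λ :* b :^ 6)) :* x :^ 6 :+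
      (:- (b :^ 2) :* x :^ 4 :+ ((b :^ 3 :- two :* (l :* b)) :* x :^ 3 :+ ((κ :+ two :* (l :* b :^ 2)) :* x :^ 2 :+ (:- (κ :* b) :* x :^ 1 :+ con (+ 0)))))))) :=
      x :* (b :^ 10 :* x :^ 11 :+ (:- (b :^ 11) :* x :^ 10 :+ (two :* (Λ :* b :^ 5) :* x :^ 6 :+ (:- (two :* (Λ :* b :^ 6)) :* x :^ 5 :+
      (:- (b :^ 2) :* x :^ 3 :+ ((b :^ 3 :- two :* (l :* b)) :* x :^ 2 :+ ((κ :+ two :* (l :* b :^ 2)) :* x :^ 1 :+ (:- (κ :* b) :* x :^ 0 :+ con (+ 0)))))))))) refl b x Λ lam

    conj-form-root : ∀ j i → sparse (conj-form (a j)) (a i) ≈ 0#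
    conj-form-root j i = trans (sparse-conj-form (a j) (a i)) go
      where
      go : ((a i ^ 5 * a j ^ 5 + Λ) ^ 2 - (a i * a j + lam) ^ 2) * (a i - a j) ≈ 0#
      go with i Finₚ.≟ j
      ... | yes ≡.refl = trans (*-congˡ (-‿inverseʳ (a i))) (zeroʳ _)
      ... | no i≢j     = trans (*-congʳ (≈⇒-‿≈0 (conj-square (res i j i≢j)))) (zeroˡ _)

    -- The two relations below, linear in b = aⱼ over polynomials in b⁵, say that
    -- the conjugated form has a double zero in x at x = b.
    relation₁ : ∀ j → let b = a j in
      X j * (X j * (σ 11 - b * σ 10) + 2# * Λ * (σ 6 - b)) - K * b ≈ 0#
    relation₁ j = begin
      X j * (X j * (σ 11 - b * σ 10) + 2# * Λ * (σ 6 - b)) - K * b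
        ≈⟨ solve 7 (λ b Λ l s11 s10 s6 s0 → let κ = Λ :^ 2 :- l :^ 2; two = con (+ 2); X = b :^ 5 in
             X :* (X :* (s11 :- b :* s10) :+ two :* Λ :* (s6 :- b)) :- κ :* s0 :* b :=
             b :^ 10 :* s11 :+ (:- (b :^ 11) :* s10 :+ (two :* (Λ :* b :^ 5) :* s6 :+ (:- (two :* (Λ :* b :^ 6)) :* con (+ 1) :+
             (:- (b :^ 2) :* con (+ 0) :+ ((b :^ 3 :- two :* (l :* b)) :* con (+ 0) :+ ((κ :+ two :* (l :* b :^ 2)) :* con (+ 0) :+ (:- (κ :* b) :* s0 :+ con (+ 0)))))))))
             refl b Λ lam (σ 11) (σ 10) (σ 6) (σ 0) ⟩
      b ^ 10 * σ 11 + (- (b ^ 11) * σ 10 + (2# * (Λ * b ^ 5) * σ 6 + (- (2# * (Λ * b ^ 6)) * 1# +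
        (- (b ^ 2) * 0# + ((b ^ 3 - 2# * (lam * b)) * 0# + ((κ + 2# * (lam * b ^ 2)) * 0# + (- (κ * b) * σ 0 + 0#)))))))
        ≈⟨ +-congˡ (+-congˡ (+-congˡ (+-cong (*-congˡ σ5≈1) (+-cong (*-congˡ (σ≈0 2 (s≤s (s≤s (s≤s z≤n)))))
             (+-cong (*-congˡ (σ≈0 1 (s≤s (s≤s z≤n)))) (+-congʳ (*-congˡ (σ≈0 0 (s≤s z≤n))))))))) ⟨
      moments (conj-form b)  ≈⟨ moments≈0 (conj-form b) (conj-form-root j) ⟩
      0# ∎
      where b = a j

    relation₂ : ∀ j → let b = a j in X j * (σ 12 - b * σ 11) + 2# * Λ * (σ 7 - b * σ 6) ≈ 0#
    relation₂ j = noZeroDivisor (begin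
      X j * (X j * (σ 12 - b * σ 11) + 2# * Λ * (σ 7 - b * σ 6))
        ≈⟨ solve 7 (λ b Λ l s12 s11 s7 s6 → let κ = Λ :^ 2 :- l :^ 2; two = con (+ 2); X = b :^ 5 in
             X :* (X :* (s12 :- b :* s11) :+ two :* Λ :* (s7 :- b :* s6)) :=
             b :^ 10 :* s12 :+ (:- (b :^ 11) :* s11 :+ (two :* (Λ :* b :^ 5) :* s7 :+ (:- (two :* (Λ :* b :^ 6)) :* s6 :+
             (:- (b :^ 2) :* con (+ 0) :+ ((b :^ 3 :- two :* (l :* b)) :* con (+ 0) :+ ((κ :+ two :* (l :* b :^ 2)) :* con (+ 0) :+ (:- (κ :* b) :* con (+ 0) :+ con (+ 0)))))))))
             refl b Λ lam (σ 12) (σ 11) (σ 7) (σ 6) ⟩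
      b ^ 10 * σ 12 + (- (b ^ 11) * σ 11 + (2# * (Λ * b ^ 5) * σ 7 + (- (2# * (Λ * b ^ 6)) * σ 6 +
        (- (b ^ 2) * 0# + ((b ^ 3 - 2# * (lam * b)) * 0# + ((κ + 2# * (lam * b ^ 2)) * 0# + (- (κ * b) * 0# + 0#)))))))
        ≈⟨ +-congˡ (+-congˡ (+-congˡ (+-congˡ (+-cong (*-congˡ (σ≈0 3 (s≤s (s≤s (s≤s (s≤s z≤n))))))
             (+-cong (*-congˡ (σ≈0 2 (s≤s (s≤s (s≤s z≤n))))) (+-cong (*-congˡ (σ≈0 1 (s≤s (s≤s z≤n)))) (+-congʳ (*-congˡ (σ≈0 0 (s≤s z≤n)))))))))) ⟨
      moments (conj-form-x b)  ≈⟨ moments≈0 (conj-form-x b) (λ i → trans (sparse-conj-form-x b (a i)) (trans (*-congˡ (conj-form-root j i)) (zeroʳ _))) ⟩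
      0# ∎) (X≉0 j)
      where b = a j

    -- Write the relations as `P - b Q` and `U - b V`, where `P`, `Q`, `U`, `V` are polynomials in
    -- `X = b ^ 5`. These are the coefficients of `Q U - P V`; being of degree 3 with five roots, it
    -- is zero.
    cubic : ℕ → Carrier
    cubic 0 = K * (2# * Λ * σ 7)
    cubic 1 = K * σ 12 + 2# * Λ * (2# * Λ) * (σ 7 - σ 6 * σ 6)
    cubic 2 = 2# * Λ * (σ 12 + σ 10 * σ 7 - 2# * (σ 6 * σ 11))
    cubic _ = σ 10 * σ 12 - σ 11 * σ 11

    -- Eliminating b from the two relations.
    cubic-root : ∀ j → evaluate 4 cubic (X j) ≈ 0#
    cubic-root j = begin
      evaluate 4 cubic (X j)
        ≈⟨ solve 9 (λ b x Λ K s6 s7 s10 s11 s12 → let two = con (+ 2) in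
             (s10 :* s12 :- s11 :* s11) :* x :^ 3 :+ (two :* Λ :* (s12 :+ s10 :* s7 :- two :* (s6 :* s11)) :* x :^ 2 :+
             ((K :* s12 :+ two :* Λ :* (two :* Λ) :* (s7 :- s6 :* s6)) :* x :^ 1 :+ (K :* (two :* Λ :* s7) :* x :^ 0 :+ con (+ 0)))) :=
             (K :+ two :* Λ :* x :+ x :* x :* s10) :* (x :* (s12 :- b :* s11) :+ two :* Λ :* (s7 :- b :* s6)) :-
             (two :* Λ :* s6 :+ x :* s11) :* (x :* (x :* (s11 :- b :* s10) :+ two :* Λ :* (s6 :- b)) :- K :* b))
             refl (a j) (X j) Λ K (σ 6) (σ 7) (σ 10) (σ 11) (σ 12) ⟩
      (K + 2# * Λ * X j + X j * X j * σ 10) * (X j * (σ 12 - a j * σ 11) + 2# * Λ * (σ 7 - a j * σ 6)) -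
        (2# * Λ * σ 6 + X j * σ 11) * (X j * (X j * (σ 11 - a j * σ 10) + 2# * Λ * (σ 6 - a j)) - K * a j)
        ≈⟨ +-cong (*-congˡ (relation₂ j)) (-‿cong (*-congˡ (relation₁ j))) ⟩
      (K + 2# * Λ * X j + X j * X j * σ 10) * 0# - (2# * Λ * σ 6 + X j * σ 11) * 0#
        ≈⟨ solve 2 (λ u v → u :* con (+ 0) :- v :* con (+ 0) := con (+ 0)) refl _ _ ⟩
      0# ∎

    vanish-at : (b : Fin 5 → Carrier) → (∀ i j → b i ≈ b j → i ≡ j) → ∀ n → n ≤ 5 → ∀ v →
      (∀ j → evaluate n v (b j) ≈ 0#) → ∀ w → w < n → v w ≈ 0#
    vanish-at b inj n n≤5 v root = coefficients-vanish n v (λ i → b (inject≤ i n≤5))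
      (λ i j e → Finₚ.inject≤-injective n≤5 n≤5 i j (inj _ _ e)) (λ i → root (inject≤ i n≤5))

    cubic≈0 : ∀ w → w < 4 → cubic w ≈ 0#
    cubic≈0 = vanish-at X X-injective 4 (s≤s (s≤s (s≤s (s≤s z≤n)))) cubic cubic-root

    -- The second relation is itself a sparse polynomial in `b` vanishing at all `a j`, so the
    -- weights apply to it and to its product with `b`. With `cubic` this gives zero for `σ 7`,
    -- `σ 6`, `σ 12` and `σ 11`. The first relation then becomes `σ 10 X^2 + 2 Λ X + K` with five
    -- roots, so `2 Λ` would vanish.
    K≉0⇒⊥ : ¬ K ≈ 0# → ⊥
    K≉0⇒⊥ K≉0 = 2Λ≉0 (quadratic≈0 1 (s≤s (s≤s z≤n)))
      where
      form form-x : List (Carrier × ℕ)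
      form   = (- σ 11 , 6) ∷ (σ 12 , 5) ∷ (- (2# * Λ * σ 6) , 1) ∷ (2# * Λ * σ 7 , 0) ∷ []
      form-x = (- σ 11 , 7) ∷ (σ 12 , 6) ∷ (- (2# * Λ * σ 6) , 2) ∷ (2# * Λ * σ 7 , 1) ∷ []
      form-root : ∀ i → sparse form (a i) ≈ 0#
      form-root i = trans (solve 6 (λ b Λ s6 s7 s11 s12 → let two = con (+ 2) in
        :- s11 :* b :^ 6 :+ (s12 :* b :^ 5 :+ (:- (two :* Λ :* s6) :* b :^ 1 :+ (two :* Λ :* s7 :* b :^ 0 :+ con (+ 0)))) :=
        b :^ 5 :* (s12 :- b :* s11) :+ two :* Λ :* (s7 :- b :* s6)) refl (a i) Λ (σ 6) (σ 7) (σ 11) (σ 12)) (relation₂ i)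
      form-x-root : ∀ i → sparse form-x (a i) ≈ 0#
      form-x-root i = trans (solve 6 (λ b Λ s6 s7 s11 s12 → let two = con (+ 2) in
        :- s11 :* b :^ 7 :+ (s12 :* b :^ 6 :+ (:- (two :* Λ :* s6) :* b :^ 2 :+ (two :* Λ :* s7 :* b :^ 1 :+ con (+ 0)))) :=
        b :* (b :^ 5 :* (s12 :- b :* s11) :+ two :* Λ :* (s7 :- b :* s6))) refl (a i) Λ (σ 6) (σ 7) (σ 11) (σ 12))
        (trans (*-congˡ (relation₂ i)) (zeroʳ _))
      σ7≈0 : σ 7 ≈ 0#
      σ7≈0 = noZeroDivisor (noZeroDivisor (cubic≈0 0 (s≤s z≤n)) K≉0) 2Λ≉0
      σ12≈σ11σ6 : σ 12 ≈ σ 11 * σ 6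
      σ12≈σ11σ6 = -‿≈0 (begin
        σ 12 - σ 11 * σ 6
          ≈⟨ solve 5 (λ Λ s6 s11 s12 s0 → let two = con (+ 2) in s12 :- s11 :* s6 :=
               :- s11 :* s6 :+ (s12 :* con (+ 1) :+ (:- (two :* Λ :* s6) :* con (+ 0) :+ (two :* Λ :* con (+ 0) :* s0 :+ con (+ 0)))))
               refl Λ (σ 6) (σ 11) (σ 12) (σ 0) ⟩
        - σ 11 * σ 6 + (σ 12 * 1# + (- (2# * Λ * σ 6) * 0# + (2# * Λ * 0# * σ 0 + 0#)))
          ≈⟨ +-congˡ (+-cong (*-congˡ σ5≈1) (+-cong (*-congˡ (σ≈0 0 (s≤s z≤n))) (+-congʳ (*-congʳ (*-congˡ σ7≈0))))) ⟨
        moments form ≈⟨ moments≈0 form form-root ⟩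
        0# ∎)
      σ12σ6≈0 : σ 12 * σ 6 ≈ 0#
      σ12σ6≈0 = begin
        σ 12 * σ 6
          ≈⟨ solve 4 (λ Λ s6 s11 s12 → let two = con (+ 2) in s12 :* s6 :=
               :- s11 :* con (+ 0) :+ (s12 :* s6 :+ (:- (two :* Λ :* s6) :* con (+ 0) :+ (two :* Λ :* con (+ 0) :* con (+ 0) :+ con (+ 0)))))
               refl Λ (σ 6) (σ 11) (σ 12) ⟩
        - σ 11 * 0# + (σ 12 * σ 6 + (- (2# * Λ * σ 6) * 0# + (2# * Λ * 0# * 0# + 0#)))
          ≈⟨ +-cong (*-congˡ σ7≈0) (+-congˡ (+-cong (*-congˡ (σ≈0 1 (s≤s (s≤s z≤n)))) (+-congʳ (*-cong (*-congˡ σ7≈0) (σ≈0 0 (s≤s z≤n)))))) ⟨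
        moments form-x ≈⟨ moments≈0 form-x form-x-root ⟩
        0# ∎
      σ6≈0 : σ 6 ≈ 0#
      σ6≈0 = x^n≈0⇒x≈0 3 (noZeroDivisor (begin
        2# * Λ * (2# * Λ) * σ 6 ^ 3
          ≈⟨ solve 4 (λ L K s6 s12 → L :* L :* s6 :^ 3 := K :* (s12 :* s6) :- s6 :* (K :* s12 :+ L :* L :* (con (+ 0) :- s6 :* s6)))
               refl (2# * Λ) K (σ 6) (σ 12) ⟩
        K * (σ 12 * σ 6) - σ 6 * (K * σ 12 + 2# * Λ * (2# * Λ) * (0# - σ 6 * σ 6))
          ≈⟨ +-cong (*-congˡ σ12σ6≈0) (-‿cong (*-congˡ (trans (+-congˡ (*-congˡ (+-congʳ (sym σ7≈0)))) (cubic≈0 1 (s≤s (s≤s z≤n)))))) ⟩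
        K * 0# - σ 6 * 0#
          ≈⟨ solve 2 (λ u v → u :* con (+ 0) :- v :* con (+ 0) := con (+ 0)) refl K (σ 6) ⟩
        0# ∎) (*-≉0 2Λ≉0 2Λ≉0))
      σ12≈0 : σ 12 ≈ 0#
      σ12≈0 = trans σ12≈σ11σ6 (trans (*-congˡ σ6≈0) (zeroʳ _))
      σ11≈0 : σ 11 ≈ 0#
      σ11≈0 = noZeroDivisor (noZeroDivisor (begin
        X zero * (a zero * σ 11)
          ≈⟨ solve 4 (λ x b L s11 → x :* (b :* s11) := :- (x :* (con (+ 0) :- b :* s11) :+ L :* (con (+ 0) :- b :* con (+ 0))))
               refl (X zero) (a zero) (2# * Λ) (σ 11) ⟩
        - (X zero * (0# - a zero * σ 11) + 2# * Λ * (0# - a zero * 0#))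
          ≈⟨ -‿cong (+-cong (*-congˡ (+-congʳ (sym σ12≈0))) (*-congˡ (+-cong (sym σ7≈0) (-‿cong (*-congˡ (sym σ6≈0)))))) ⟩
        - (X zero * (σ 12 - a zero * σ 11) + 2# * Λ * (σ 7 - a zero * σ 6))
          ≈⟨ trans (-‿cong (relation₂ zero)) (solve 0 (:- con (+ 0) := con (+ 0)) refl) ⟩
        0# ∎) (X≉0 zero)) (proj₁ distinct zero)
      quadratic : ℕ → Carrier
      quadratic 0 = K
      quadratic 1 = 2# * Λ
      quadratic _ = σ 10
      quadratic-root : ∀ j → evaluate 3 quadratic (X j) ≈ 0#
      quadratic-root j = noZeroDivisor (begin
        a j * evaluate 3 quadratic (X j)
          ≈⟨ solve 5 (λ b x L K s10 → b :* (s10 :* x :^ 2 :+ (L :* x :^ 1 :+ (K :* x :^ 0 :+ con (+ 0)))) :=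
               :- (x :* (x :* (con (+ 0) :- b :* s10) :+ L :* (con (+ 0) :- b)) :- K :* b)) refl (a j) (X j) (2# * Λ) K (σ 10) ⟩
        - (X j * (X j * (0# - a j * σ 10) + 2# * Λ * (0# - a j)) - K * a j)
          ≈⟨ -‿cong (+-congʳ (*-congˡ (+-cong (*-congˡ (+-congʳ (sym σ11≈0))) (*-congˡ (+-congʳ (sym σ6≈0)))))) ⟩
        - (X j * (X j * (σ 11 - a j * σ 10) + 2# * Λ * (σ 6 - a j)) - K * a j)
          ≈⟨ trans (-‿cong (relation₁ j)) (solve 0 (:- con (+ 0) := con (+ 0)) refl) ⟩
        0# ∎) (proj₁ distinct j)
      quadratic≈0 : ∀ w → w < 3 → quadratic w ≈ 0#
      quadratic≈0 = vanish-at X X-injective 3 (s≤s (s≤s (s≤s z≤n))) quadratic quadratic-root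

    -- Without its `K` term the first relation loses a factor `X`. Subtracting the second from `σ 6`
    -- times the result leaves a linear polynomial in `b` with five roots, whence `σ 11 = σ 6 σ 10`
    -- and the factorisation `(σ 6 - b) (σ 10 X + 2 Λ) = 0`.
    K≈0⇒⊥ : K ≈ 0# → ⊥
    K≈0⇒⊥ K≈0 = 2Λ≉0 (begin
      2# * Λ                               ≈⟨ solve 3 (λ L s t → L := :- (s :* t :- L) :- s :* :- t) refl (2# * Λ) (σ 6 ^ 5) (σ 10) ⟩
      - (σ 6 ^ 5 * σ 10 - 2# * Λ) - σ 6 ^ 5 * - σ 10
        ≈⟨ +-cong (-‿cong (quadratic≈0 1 (s≤s (s≤s z≤n)))) (-‿cong (*-congˡ (quadratic≈0 2 (s≤s (s≤s (s≤s z≤n)))))) ⟩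
      - 0# - σ 6 ^ 5 * 0#                  ≈⟨ solve 1 (λ s → :- con (+ 0) :- s :* con (+ 0) := con (+ 0)) refl (σ 6 ^ 5) ⟩
      0#                                   ∎)
      where
      σ7≈σ6σ6 : σ 7 ≈ σ 6 * σ 6
      σ7≈σ6σ6 = -‿≈0 (noZeroDivisor
        (trans (trans (sym (+-identityˡ _)) (+-congʳ (sym (trans (*-congʳ K≈0) (zeroˡ _))))) (cubic≈0 1 (s≤s (s≤s z≤n))))
        (*-≉0 2Λ≉0 2Λ≉0))
      reduced₁ : ∀ j → X j * (σ 11 - a j * σ 10) + 2# * Λ * (σ 6 - a j) ≈ 0#
      reduced₁ j = noZeroDivisor (trans (trans (solve 2 (λ u b → u := u :- con (+ 0) :* b) refl _ (a j))
        (+-congˡ (-‿cong (*-congʳ (sym K≈0))))) (relation₁ j)) (X≉0 j)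
      linear : ℕ → Carrier
      linear 0 = σ 6 * σ 11 - σ 12
      linear _ = σ 11 - σ 6 * σ 10
      linear-root : ∀ j → evaluate 2 linear (a j) ≈ 0#
      linear-root j = noZeroDivisor (begin
        X j * evaluate 2 linear (a j)
          ≈⟨ solve 7 (λ b x L s6 s10 s11 s12 →
               x :* ((s11 :- s6 :* s10) :* b :^ 1 :+ ((s6 :* s11 :- s12) :* b :^ 0 :+ con (+ 0))) :=
               s6 :* (x :* (s11 :- b :* s10) :+ L :* (s6 :- b)) :- (x :* (s12 :- b :* s11) :+ L :* (s6 :* s6 :- b :* s6)))
               refl (a j) (X j) (2# * Λ) (σ 6) (σ 10) (σ 11) (σ 12) ⟩
        σ 6 * (X j * (σ 11 - a j * σ 10) + 2# * Λ * (σ 6 - a j)) - (X j * (σ 12 - a j * σ 11) + 2# * Λ * (σ 6 * σ 6 - a j * σ 6))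
          ≈⟨ +-cong (*-congˡ (reduced₁ j)) (-‿cong (trans (+-congˡ (*-congˡ (+-congʳ (sym σ7≈σ6σ6)))) (relation₂ j))) ⟩
        σ 6 * 0# - 0#  ≈⟨ solve 1 (λ s → s :* con (+ 0) :- con (+ 0) := con (+ 0)) refl (σ 6) ⟩
        0# ∎) (X≉0 j)
      σ11≈σ6σ10 : σ 11 ≈ σ 6 * σ 10
      σ11≈σ6σ10 = -‿≈0 (vanish-at a (proj₂ distinct) 2 (s≤s (s≤s z≤n)) linear linear-root 1 (s≤s (s≤s z≤n)))
      -- The coefficients of `(σ 6 ^ 5 - X) (σ 10 X + 2 Λ)`. Raising `σ 6 - b` to the fifth power
      -- makes the factorisation a polynomial in `X` alone and avoids asking whether some `a j`
      -- equals `σ 6`.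
      quadratic : ℕ → Carrier
      quadratic 0 = σ 6 ^ 5 * (2# * Λ)
      quadratic 1 = σ 6 ^ 5 * σ 10 - 2# * Λ
      quadratic _ = - σ 10
      quadratic-root : ∀ j → evaluate 3 quadratic (X j) ≈ 0#
      quadratic-root j = begin
        evaluate 3 quadratic (X j)
          ≈⟨ solve 4 (λ x L s s10 → :- s10 :* x :^ 2 :+ ((s :* s10 :- L) :* x :^ 1 :+ (s :* L :* x :^ 0 :+ con (+ 0))) :=
               (s :- x) :* (x :* s10 :+ L)) refl (X j) (2# * Λ) (σ 6 ^ 5) (σ 10) ⟩
        (σ 6 ^ 5 - X j) * (X j * σ 10 + 2# * Λ)        ≈⟨ *-congʳ (frobenius-- (σ 6) (a j)) ⟨
        (σ 6 - a j) ^ 5 * (X j * σ 10 + 2# * Λ)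
          ≈⟨ solve 5 (λ b x L s6 s10 → (s6 :- b) :^ 5 :* (x :* s10 :+ L) :=
               (s6 :- b) :^ 4 :* (x :* (s6 :* s10 :- b :* s10) :+ L :* (s6 :- b))) refl (a j) (X j) (2# * Λ) (σ 6) (σ 10) ⟩
        (σ 6 - a j) ^ 4 * (X j * (σ 6 * σ 10 - a j * σ 10) + 2# * Λ * (σ 6 - a j))
          ≈⟨ *-congˡ (trans (+-congʳ (*-congˡ (+-congʳ (sym σ11≈σ6σ10)))) (reduced₁ j)) ⟩
        (σ 6 - a j) ^ 4 * 0#                           ≈⟨ zeroʳ _ ⟩
        0# ∎
      quadratic≈0 : ∀ w → w < 3 → quadratic w ≈ 0#
      quadratic≈0 = vanish-at X X-injective 3 (s≤s (s≤s (s≤s z≤n))) quadratic quadratic-root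

    impossible : ⊥
    impossible with K ≟ 0#
    ... | yes K≈0 = K≈0⇒⊥ K≈0
    ... | no K≉0  = K≉0⇒⊥ K≉0

-- The theorem

open import Data.Nat using (_+_; _*_; _^_)

module SquareOrder {q : ℕ} (F : FiniteField q) (s′ : ℕ) (q≡s² : suc (suc s′) * suc (suc s′) ≡ q)
  {p k : ℕ} (p-prime : Prime p) (q≡p^k : q ≡ p ^ k) where
  open FiniteField F using (Carrier; _≈_; 0#; 1#; cring)
  module R = FiniteField F
  open Field F using (ι)
  private module K = Field F

  s : ℕ
  s = suc (suc s′)

  ιp≈0 : ι p ≈ 0#
  ιp≈0 = K.x^n≈0⇒x≈0 k (R.trans (R.sym (K.ι-^ p k)) (R.trans (R.reflexive (≡.cong ι (≡.sym q≡p^k))) K.ιq≈0))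

  s≡p^h : ∃ λ h → s ≡ p ^ h
  s≡p^h = root-prime-power p-prime k s (≡.trans q≡s² q≡p^k)

  ιs≈0 : ι s ≈ 0#
  ιs≈0 with s≡p^h
  ... | suc h , s≡ = R.trans (R.reflexive (≡.cong ι s≡)) (R.trans (K.ι-* p (p ^ h)) (R.trans (R.*-congʳ ιp≈0) (R.zeroˡ _)))

  frob : Binomials.FrobeniusExponent F s
  frob = ≡.subst (Binomials.FrobeniusExponent F) (≡.sym (proj₂ s≡p^h)) (Binomials.bin-prime-power F p-prime ιp≈0 (proj₁ s≡p^h))

  pow≡^ : ∀ x n → pow F x n ≡ x K.^ n
  pow≡^ x zero    = ≡.refl
  pow≡^ x (suc n) = ≡.cong (x R.*_) (pow≡^ x n)

  residue : ∀ d e {y} → q ∸ 1 ≡ e * d → InS₀ F d y → y K.^ e ≈ 1# ⊎ y ≈ 0#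
  residue d e q-1≡ (inj₂ y≈0) = inj₂ y≈0
  residue d e {y} q-1≡ (inj₁ (x , x≉0 , y≈)) = inj₁ (begin
    y K.^ e             ≈⟨ K.^-congˡ e (R.trans y≈ (R.reflexive (pow≡^ x d))) ⟩
    (x K.^ d) K.^ e     ≈⟨ K.^-assocʳ x d e ⟩
    x K.^ (d * e)       ≡⟨ ≡.cong (x K.^_) (≡.trans (ℕₚ.*-comm d e) (≡.sym q-1≡)) ⟩
    x K.^ (q ∸ 1)       ≈⟨ K.fermat x≉0 ⟩
    1#                  ∎)
    where open import Relation.Binary.Reasoning.Setoid R.setoid

  module Exponent (d e r t : ℕ) (q-1≡ : q ∸ 1 ≡ e * d) (e≡ : e ≡ t * (p * s) + r) (r≤ : r ≤ (p ∸ 1) * s) where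

    e*d+1≡s² : e * d + 1 ≡ s * s
    e*d+1≡s² = ≡.trans (≡.cong (_+ 1) (≡.trans (≡.sym q-1≡) (≡.cong (_∸ 1) (≡.sym q≡s²)))) (ℕₚ.+-comm (s * s ∸ 1) 1)

    c τ : ℕ
    c = r / s
    τ = t * p + c

    r≡ : r ≡ c * s + r % s
    r≡ = ≡.trans (m≡m%n+[m/n]*n r s) (ℕₚ.+-comm (r % s) (c * s))

    e≡τs : e ≡ τ * s + r % s
    e≡τs = ≡.trans e≡ (≡.trans (≡.cong (ℕ._+_ (t * (p * s))) r≡)
      (solveℕ 5 (λ t p s c l → t ⊗ (p ⊗ s) ⊕ (c ⊗ s ⊕ l) ⊜ (t ⊗ p ⊕ c) ⊗ s ⊕ l) ≡.refl t p s c (r % s)))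

    -- If `s` divided `e`, then `e * d + 1 = s * s` would make it divide 1.
    r%s≢0 : ¬ r % s ≡ 0
    r%s≢0 l≡0 with ∣1⇒≡1 (∣m+n∣m⇒∣n (≡.subst (s ∣_) (≡.sym e*d+1≡s²) (n∣m*n s)) s∣ed)
      where
      s∣e : s ∣ e
      s∣e = divides τ (≡.trans e≡τs (≡.trans (≡.cong (ℕ._+_ (τ * s)) l≡0) (ℕₚ.+-identityʳ _)))
      s∣ed : s ∣ e * d
      s∣ed = ∣-trans s∣e (m∣m*n d)
    ... | ()

    -- Modulo `p` this is `c + 1`. As `r` is not a multiple of `s`, `c * s < r ≤ (p - 1) * s` is
    -- strict on the left, so `0 < c + 1 < p`.
    τ+1≉0 : ¬ ι (suc τ) ≈ 0#
    τ+1≉0 e≈0 = K.ι-unit p-prime ιp≈0 (s≤s z≤n) c+1<p (begin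
      ι (suc c)              ≈⟨ R.+-identityˡ _ ⟨
      0# R.+ ι (suc c)       ≈⟨ R.+-congʳ (R.trans (K.ι-* t p) (R.trans (R.*-congˡ ιp≈0) (R.zeroʳ _))) ⟨
      ι (t * p) R.+ ι (suc c)  ≈⟨ K.ι-+ (t * p) (suc c) ⟨
      ι (t * p + suc c)      ≡⟨ ≡.cong ι (ℕₚ.+-suc (t * p) c) ⟩
      ι (suc τ)              ≈⟨ e≈0 ⟩
      0#                     ∎)
      where
      open import Relation.Binary.Reasoning.Setoid R.setoid
      c<p-1 : c < p ∸ 1
      c<p-1 = ℕₚ.*-cancelʳ-< s c (p ∸ 1) (ℕₚ.<-≤-trans
        (≡.subst (c * s <_) (≡.sym r≡) (ℕₚ.m<m+n (c * s) (ℕₚ.n≢0⇒n>0 r%s≢0))) r≤)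
      c+1<p : suc c < p
      c+1<p = ≡.subst (suc c <_) (ℕₚ.m+[n∸m]≡n (ℕ.>-nonZero⁻¹ p {{prime⇒nonZero p-prime}})) (s≤s c<p-1)

    parameters : ∃ λ l → e ≡ τ * s + suc l × suc l < s
    parameters with r % s in eq
    ... | zero  = ⊥-elim (r%s≢0 eq)
    ... | suc l = l , ≡.trans e≡τs (≡.cong (ℕ._+_ (τ * s)) eq) , ≡.subst (_< s) eq (m%n<n r s)

    module Tuple (lam : Carrier) (lam≉0 : ¬ lam ≈ 0#) (a : Fin s → Carrier) (distinct : DistinctNonzero F s a) where

      l : ℕ
      l = proj₁ parameters

      l<s : suc l < s
      l<s = proj₂ (proj₂ parameters)

      open Bounds F (suc s′) frob lam lam≉0 a distinct τ l e (proj₁ (proj₂ parameters)) l<s hiding (s)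

      strong : 2 ≤ d → ¬ (∀ i j → Residue (a i R.* a j R.+ lam))
      strong 2≤d = all-residues τ+1≉0 (half-bound s d e (s≤s (s≤s z≤n)) 2≤d e*d+1≡s²)

      weak : 5 ≤ s → 3 ≤ d → ¬ (∀ i j → ¬ i ≡ j → Residue (a i R.* a j R.+ lam))
      weak 5≤s 3≤d res with parameter-cases s d τ (suc l) 5≤s 3≤d (s≤s z≤n)
        (≡.trans (≡.cong (λ x → x * d + 1) (≡.sym (proj₁ (proj₂ parameters)))) e*d+1≡s²)
      ... | inj₁ bound = small-l N (ℕₚ.+-cancelʳ-≤ (suc l + suc τ) _ _ (≡.subst₂ _≤_
            (solveℕ 2 (λ t l → # 1 ⊕ l ⊕ (# 1 ⊕ t ⊕ (# 1 ⊕ t)) ⊜ # 1 ⊕ t ⊕ (# 1 ⊕ l ⊕ (# 1 ⊕ t))) ≡.refl τ l) (≡.sym N≡) bound))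
            (≡.trans (ℕₚ.+-assoc N (suc l) (suc τ)) N≡)
        where
        open OffDiagonal res
        N : ℕ
        N = s ∸ (suc l + suc τ)
        N≡ : N + (suc l + suc τ) ≡ s
        N≡ = ℕₚ.m∸n+n≡m (ℕₚ.≤-trans (ℕₚ.+-monoʳ-≤ (suc l) (ℕₚ.m≤m+n (suc τ) (suc τ))) bound)
      ... | inj₂ (inj₁ (2≤τ , l≡τ , s≡)) = OffDiagonal.third res ιs≈0 τ 2≤τ ≡.refl l≡τ s≡
      ... | inj₂ (inj₂ (inj₁ τ+3≤l)) = OffDiagonal.large-l res τ+1≉0 (ℕₚ.≤-pred τ+3≤l)
      ... | inj₂ (inj₂ (inj₂ (s≡5 , τ≡1 , l≡3))) = order25 s≡5 e≡8 ιs≈0 a distinct res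
        where
        e≡8 : e ≡ 8
        e≡8 = ≡.trans (proj₁ (proj₂ parameters)) (≡.cong₂ _+_ (≡.cong₂ _*_ τ≡1 s≡5) l≡3)
        -- `s` and `e` are generalised to variables so that both equations can be matched by
        -- reflexivity.
        order25 : ∀ {s e} → s ≡ 5 → e ≡ 8 → ι s ≈ 0# → (a : Fin s → Carrier) → DistinctNonzero F s a →
          ¬ (∀ i j → ¬ i ≡ j → (a i R.* a j R.+ lam) K.^ e ≈ 1# ⊎ a i R.* a j R.+ lam ≈ 0#)
        order25 ≡.refl ≡.refl ι5≈0 a distinct res = Order25.Quintuple.impossible F ι5≈0 lam lam≉0 a distinct res

initial-segment : ∀ {q} (F : FiniteField q) {m s} (a : Fin m → FiniteField.Carrier F) (s≤m : s ≤ m) →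
  DistinctNonzero F m a → DistinctNonzero F s (λ i → a (inject≤ i s≤m))
initial-segment F a s≤m (a≉0 , inj) = (λ i → a≉0 _) , (λ i j e → Finₚ.inject≤-injective s≤m s≤m i j (inj _ _ e))

theorem4p5 : (p k q s : ℕ) → Prime p → q ≡ p ^ k → s * s ≡ q →
    (F : FiniteField q) → (λ' : FiniteField.Carrier F) →
    ¬ (FiniteField._≈_ F λ' (FiniteField.0# F)) →
    (((d e r t : ℕ) → 2 ≤ d → q ∸ 1 ≡ e * d →
    e ≡ t * (p * s) + r → r < p * s → r ≤ (p ∸ 1) * s →
    MSD≤ F d λ' (s ∸ 1))
    ×
    ((d e r t : ℕ) → 25 ≤ q → 3 ≤ d → q ∸ 1 ≡ e * d →
    e ≡ t * (p * s) + r → r < p * s → r ≤ (p ∸ 1) * s →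
    MD≤ F d λ' (s ∸ 1)))
-- The values `s = 0` and `s = 1` would give a field with no element or with a single one.
theorem4p5 p k q zero p-prime q≡p^k ≡.refl F λ' λ≉0 = ⊥-elim (Finₚ.¬Fin0 (Field.toFin F (FiniteField.0# F)))
theorem4p5 p k q (suc zero) p-prime q≡p^k ≡.refl F λ' λ≉0 = ⊥-elim (FiniteField.1≉0 F
  (Bijection.injective (FiniteField.enum F) (Fin1-unique _ _)))
  where
  Fin1-unique : (i j : Fin 1) → i ≡ j
  Fin1-unique zero zero = ≡.refl
theorem4p5 p k q s@(suc (suc s′)) p-prime q≡p^k s²≡q F λ' λ≉0 =
  -- A set exceeding `s - 1` elements has at least `s`; its first `s` elements keep the property and
  -- are refuted.
  (λ d e r t 2≤d q-1≡ e≡ _ r≤ m a (distinct , inS) → ℕₚ.≮⇒≥ (λ s≤m →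
    Exponent.Tuple.strong d e r t q-1≡ e≡ r≤ λ' λ≉0 _ (initial-segment F a s≤m distinct) 2≤d
      (λ i j → residue d e q-1≡ (inS _ _)))) ,
  (λ d e r t 25≤q 3≤d q-1≡ e≡ _ r≤ m a (distinct , inS) → ℕₚ.≮⇒≥ (λ s≤m →
    Exponent.Tuple.weak d e r t q-1≡ e≡ r≤ λ' λ≉0 _ (initial-segment F a s≤m distinct)
      (square-cancel (≡.subst (25 ≤_) (≡.sym s²≡q) 25≤q)) 3≤d
      (λ i j i≢j → residue d e q-1≡ (inS _ _ (λ e → i≢j (Finₚ.inject≤-injective s≤m s≤m i j e))))))
  where open SquareOrder F s′ s²≡q {k = k} p-prime q≡p^k
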